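{- Let $M$ be a simple connected binary matroid, and let $e$ and $f$ be distinct elements of $M$. Then every circuit of $M$ containing $\{e,f\}$ is spanning if and only if the canonical tree decomposition of $M$ is a path $\mathcal{P}$ with vertices, in order, $P_0,P_1,\dots,P_n$ (where $n\ge 0$) such that (i) each vertex is labeled by a circuit of size at least three, by $U_{1,3}$, or by a copy of $Z_r\backslash y_r$ for some $r\geq 3$; (ii) neither $P_0$ nor $P_n$ is labeled by $U_{1,3}$; (iii) if $n=0$ and $P_0$ is a binary spike with a tip and a cotip, then this pair of elements (tip and cotip) is $\{e,f\}$; (iv) if $n\geq 1$, then one of $e$ and $f$ is in $E(P_0)$ and the other is in $E(P_n)$, and, when $P_i$ is labeled by a spike with a tip and a cotip, (a) for $0<i<n$, the tip and the cotip are the two basepoints of $P_i$, and (b) for $i\in\{0,n\}$, the pair consisting of the tip and the cotip coincides with the pair consisting of the single basepoint in $P_i$ and the single member of $\{e,f\}$ in $P_i$.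
   Context: All matroids are finite. A circuit $C$ of a matroid $M$ is spanning if $r_M(C)=r(M)$. $U_{k,n}$ denotes the uniform matroid of rank $k$ on $n$ elements. A vertex of a tree decomposition is "labeled by" a matroid $N$ if its label is isomorphic to $N$; "labeled by a circuit" of size $k$ means the label is isomorphic to $U_{k-1,k}$, and "labeled by a cocircuit" means the label is isomorphic to $U_{1,k}$ for some $k$. Spikes. For $r\geq 3$, $Z_r$ is the rank-$r$ binary spike with tip $t$: the binary matroid on $\{x_1,y_1,x_2,y_2,\dots,x_r,y_r,t\}$ represented over $\mathrm{GF}(2)$ by letting $x_1,\dots,x_r$ be the standard basis vectors of $\mathrm{GF}(2)^r$, $t$ the all-ones vector, and $y_i=x_i+t$ (so each $\{x_i,y_i,t\}$ is a triangle). The matroid $Z_r\backslash y_r$ is called a rank-$r$ binary spike with tip $t$ and cotip $x_r$. If a matroid $P$ is isomorphic to $Z_r\backslash y_r$, the statement that a given pair of elements of $P$ is the pair consisting of the tip and the cotip means that there is an isomorphism from $P$ to $Z_r\backslash y_r$ mapping this pair (as an unordered pair) to $\{t,x_r\}$. (When $r=3$, $Z_3\backslash y_3\cong M(K_4)$ and there is more than one such pair.) 2-sums. If $M_1$ and $M_2$ are connected matroids, each with at least three elements and with $E(M_1)\cap E(M_2)=\{p\}$, then $M_1\oplus_2 M_2$ is the 2-sum with basepoint $p$: the matroid on $(E(M_1)\cup E(M_2))-\{p\}$ whose circuits are the circuits of $M_1$ avoiding $p$, the circuits of $M_2$ avoiding $p$, and all sets $(C_1\cup C_2)-\{p\}$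 where $C_i$ is a circuit of $M_i$ containing $p$. Tree decompositions. A tree decomposition of a connected matroid $M$ is a tree $\mathcal{T}$ with vertex set $\{M_1,\dots,M_k\}$, where each $M_i$ is a connected matroid (the label of that vertex), and edge set $\{e_1,\dots,e_{k-1}\}$, such that (i) $E(M)=(E(M_1)\cup\dots\cup E(M_k))-\{e_1,\dots,e_{k-1}\}$; (ii) if $M_{j_1}$ and $M_{j_2}$ are joined by an edge $e_i$, then $E(M_{j_1})\cap E(M_{j_2})=\{e_i\}$, and otherwise $E(M_{j_1})\cap E(M_{j_2})=\emptyset$; (iii) $|E(M_i)|\geq 3$ for all $i$ unless $|E(M)|<3$, in which case $k=1$ and $M_1=M$; and (iv) $M$ can be obtained from $\mathcal{T}$ by repeatedly taking an edge $e_i$ with ends $M_{j_1}$ and $M_{j_2}$, contracting $e_i$ from the current tree, and labeling the resulting composite vertex by $M_{j_1}\oplus_2 M_{j_2}$. The basepoints of a vertex $M_j$ are the elements of $E(M_j)$ that are edges of $\mathcal{T}$. By a theorem of Cunningham and Edmonds, every connected matroid $M$ has a tree decomposition, unique up to its edge labels, in which every vertex is labeled by a circuit, a cocircuit, or a 3-connected matroid with at least four elements, and no two adjacent vertices are both labeled by circuits or both labeled by cocircuits. This is the canonical tree decomposition of $M$. -}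

module Defs where

open import Algebra.Bundles using (CommutativeRing)
open import Data.Bool.Base using (Bool; true; false; _∧_; _xor_)
open import Data.Bool.Properties using (xor-∧-commutativeRing)
open import Data.Fin.Base using (Fin; zero; suc; toℕ; fromℕ; punchIn; splitAt; _↑ˡ_; _↑ʳ_)
open import Data.Fin.Properties using (_≟_)
open import Data.Fin.Subset
open import Data.Fin.Subset.Properties using (_⊆?_)
open import Data.List.Base as List using (List; []; _∷_; filter; _++_)
open import Data.List.Extrema.Nat using (max)
import Data.List.Membership.Propositional as List∈
open import Data.List.Relation.Unary.Unique.Propositional using (Unique)
open import Data.Nat.Base using (ℕ; zero; suc; _+_; _∸_; _≤_; _<_)
open import Data.Product.Base using (Σ; ∃; ∃₂; _×_; _,_; proj₁; proj₂)
import Data.Product.Base as Product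
open import Data.Sum.Base using (_⊎_; [_,_]′)
import Data.Vec.Base as Vec
open import Function.Base using (_∘_)
open import Function.Bundles using (_⇔_; _↔_; Inverse)
open import Function.Definitions using (Injective; Surjective)
open import Level using (0ℓ)
open import Relation.Binary.PropositionalEquality using (_≡_; _≢_)
open import Relation.Nullary.Decidable using (does; _×-dec_)
open import Relation.Nullary.Negation using (¬_)
open import Relation.Unary using (Pred; Decidable)

open import Algebra.Properties.CommutativeMonoid.Sum
  (CommutativeRing.+-commutativeMonoid xor-∧-commutativeRing) using (sum)

------------------------------------------------------------------------
-- Matroids

-- A pair (E, 𝓘).  Elements come from a common universe Fin N, of which
-- the ground set E is a subset, so that different ground sets may
-- overlap.
record SetSystem (N : ℕ) : Set₁ where
  field
    ground : Subset N
    Indep  : Pred (Subset N) 0ℓ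

-- Independence is decidable, as it is classically for any finite matroid.
record Matroid (N : ℕ) : Set₁ where
  field
    system : SetSystem N
  open SetSystem system public
  field
    Indep?     : Decidable Indep
    Indep⇒⊆    : ∀ {X} → Indep X → X ⊆ ground
    ∅-indep    : Indep ⊥
    hereditary : ∀ {X Y} → X ⊆ Y → Indep Y → Indep X
    augment    : ∀ {X Y} → Indep X → Indep Y → ∣ X ∣ < ∣ Y ∣ →
                 ∃ λ a → a ∈ Y × a ∉ X × Indep (X ∪ ⁅ a ⁆)

open SetSystem public using (ground; Indep)
open Matroid public using (system)

E : ∀ {N} → Matroid N → Subset N
E M = Matroid.ground M

-- Equality of matroids: same ground set, same independent sets.
infix 4 _≈_
_≈_ : ∀ {N} → Matroid N → Matroid N → Set
M₁ ≈ M₂ = E M₁ ≡ E M₂ × (∀ X → Matroid.Indep M₁ X ⇔ Matroid.Indep M₂ X)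

-- Isomorphism: a bijection of ground sets under which independent sets
-- correspond.  The second field says this for Y the image of X.
record _≅_ {m n} (S : SetSystem m) (S′ : SetSystem n) : Set where
  field
    bijection : ∃ (_∈ ground S) ↔ ∃ (_∈ ground S′)
  to : ∃ (_∈ ground S) → Fin n
  to = proj₁ ∘ Inverse.to bijection
  field
    preserves : ∀ X Y → X ⊆ ground S → Y ⊆ ground S′ →
                (∀ a (a∈ : a ∈ ground S) → a ∈ X ⇔ to (a , a∈) ∈ Y) →
                Indep S X ⇔ Indep S′ Y

infix 4 _≅_

IsCircuit : ∀ {N} → Matroid N → Subset N → Set
IsCircuit M C = C ⊆ E M × ¬ Matroid.Indep M C × (∀ D → D ⊂ C → Matroid.Indep M D)

subsets : ∀ n → List (Subset n)
subsets zero    = Vec.[] ∷ []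
subsets (suc n) = List.map (outside Vec.∷_) (subsets n) ++ List.map (inside Vec.∷_) (subsets n)

rank : ∀ {N} → Matroid N → Subset N → ℕ
rank {N} M X =
  max 0 (List.map ∣_∣ (filter (λ I → (I ⊆? X) ×-dec Matroid.Indep? M I) (subsets N)))

Spanning : ∀ {N} → Matroid N → Subset N → Set
Spanning M X = rank M X ≡ rank M (E M)

-- No loops (one-element circuits) and no parallel pairs (two-element
-- circuits); the empty set is never a circuit.
Simple : ∀ {N} → Matroid N → Set
Simple M = ∀ C → IsCircuit M C → 3 ≤ ∣ C ∣

Connected : ∀ {N} → Matroid N → Set
Connected M = ∀ a b → a ∈ E M → b ∈ E M → a ≢ b → ∃ λ C → IsCircuit M C × a ∈ C × b ∈ C

-- (X, E ─ X) is a k-separation: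
-- r(X) + r(E ─ X) ∸ r(M) ≤ k ∸ 1, written without subtraction.
IsSeparation : ∀ {N} → ℕ → Matroid N → Subset N → Set
IsSeparation k M X =
  X ⊆ E M × k ≤ ∣ X ∣ × k ≤ ∣ E M ─ X ∣ ×
  rank M X + rank M (E M ─ X) < rank M (E M) + k

ThreeConnected : ∀ {N} → Matroid N → Set
ThreeConnected M = ∀ k → 1 ≤ k → k < 3 → ∀ X → ¬ IsSeparation k M X

------------------------------------------------------------------------
-- Uniform and binary matroids, spikes

-- U_{k,n}, for k ≤ n.
U : ℕ → (n : ℕ) → SetSystem n
U k n = record { ground = ⊤ ; Indep = λ X → ∣ X ∣ ≤ k }

-- Vectors in GF(2)^r are functions Fin r → Bool, with _xor_ as addition
-- and _∧_ as multiplication.  A subset c of the index set is also the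
-- family of its characteristic coefficients in GF(2).
linearCombination : ∀ {n r} → Subset n → (Fin n → Fin r → Bool) → Fin r → Bool
linearCombination c v j = sum (λ i → Vec.lookup c i ∧ v i j)

LinearlyIndependent : ∀ {n r} → (Fin n → Fin r → Bool) → Subset n → Set
LinearlyIndependent v X =
  ∀ c → c ⊆ X → (∀ j → linearCombination c v j ≡ false) → c ≡ ⊥

Binary : ∀ {N} → Matroid N → Set
Binary {N} M = ∃₂ λ r (v : Fin N → Fin r → Bool) →
  ∀ X → X ⊆ E M → Matroid.Indep M X ⇔ LinearlyIndependent v X

tip : ∀ r → Fin (suc (r + r))
tip r = zero

xᵢ yᵢ : ∀ {r} → Fin r → Fin (suc (r + r))
xᵢ {r} i = suc (i ↑ˡ r)
yᵢ {r} i = suc (r ↑ʳ i)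

standardBasis : ∀ {r} → Fin r → Fin r → Bool
standardBasis i j = does (i ≟ j)

spikeVector : ∀ r → Fin (suc (r + r)) → Fin r → Bool
spikeVector r zero    = λ _ → true
spikeVector r (suc a) =
  [ standardBasis , (λ i j → standardBasis i j xor true) ]′ (splitAt r a)

Z : ∀ r → SetSystem (suc (r + r))
Z r = record { ground = ⊤ ; Indep = LinearlyIndependent (spikeVector r) }

infixl 6 _∖_
_∖_ : ∀ {n} → SetSystem n → Fin n → SetSystem n
S ∖ a = record { ground = ground S - a ; Indep = λ X → a ∉ X × Indep S X }

-- Z_r \ y_r with r = suc m; the last index is fromℕ m.
Z∖y : ∀ m → SetSystem (suc (suc m + suc m))
Z∖y m = Z (suc m) ∖ yᵢ (fromℕ m)

cotip : ∀ m → Fin (suc (suc m + suc m))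
cotip m = xᵢ (fromℕ m)

IsCircuitOfSize : ∀ {N} → ℕ → Matroid N → Set
IsCircuitOfSize k M = 1 ≤ k × system M ≅ U (k ∸ 1) k

IsCircuitMatroid : ∀ {N} → Matroid N → Set
IsCircuitMatroid M = ∃ λ k → IsCircuitOfSize k M

IsCocircuitMatroid : ∀ {N} → Matroid N → Set
IsCocircuitMatroid M = ∃ λ k → 1 ≤ k × system M ≅ U 1 k

IsSpike : ∀ {N} → Matroid N → Set
IsSpike M = ∃ λ m → 3 ≤ suc m × system M ≅ Z∖y m

-- The unordered pair {a, b} is the pair consisting of the tip and the
-- cotip of M, for some isomorphism from M to a binary spike.
IsTipCotipPair : ∀ {N} → Matroid N → Fin N → Fin N → Set
IsTipCotipPair M a b =
  ∃ λ m → 3 ≤ suc m × Σ (system M ≅ Z∖y m) λ φ →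
  Σ (a ∈ E M) λ a∈ → Σ (b ∈ E M) λ b∈ →
    (_≅_.to φ (a , a∈) ≡ tip (suc m) × _≅_.to φ (b , b∈) ≡ cotip m) ⊎
    (_≅_.to φ (a , a∈) ≡ cotip m × _≅_.to φ (b , b∈) ≡ tip (suc m))

------------------------------------------------------------------------
-- 2-sums

-- M is the 2-sum of M₁ and M₂ with basepoint p.
record Is2Sum {N} (p : Fin N) (M₁ M₂ M : Matroid N) : Set where
  field
    connected₁ : Connected M₁
    connected₂ : Connected M₂
    size₁      : 3 ≤ ∣ E M₁ ∣
    size₂      : 3 ≤ ∣ E M₂ ∣
    basepoint  : E M₁ ∩ E M₂ ≡ ⁅ p ⁆
    groundSet  : E M ≡ (E M₁ ∪ E M₂) - p
    circuits   : ∀ C → IsCircuit M C ⇔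
      ( (IsCircuit M₁ C × p ∉ C)
      ⊎ (IsCircuit M₂ C × p ∉ C)
      ⊎ (∃₂ λ C₁ C₂ → IsCircuit M₁ C₁ × p ∈ C₁ × IsCircuit M₂ C₂ × p ∈ C₂ ×
                      C ≡ (C₁ ∪ C₂) - p))

------------------------------------------------------------------------
-- Trees

-- A multigraph with vertex set Fin k and edge set Fin m.  The order in
-- which the ends of an edge are listed is immaterial.
Graph : ℕ → ℕ → Set
Graph k m = Fin m → Fin k × Fin k

Joins : ∀ {k m} → Graph k m → Fin m → Fin k → Fin k → Set
Joins G e u v = G e ≡ (u , v) ⊎ G e ≡ (v , u)

Adjacent : ∀ {k m} → Graph k m → Fin k → Fin k → Set
Adjacent G u v = ∃ λ e → Joins G e u v

data Walk {k m} (G : Graph k m) : Fin k → Fin k → Set where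
  stop : ∀ {u} → Walk G u u
  step : ∀ {u w v} e → Joins G e u w → Walk G w v → Walk G u v

walkVertices : ∀ {k m} {G : Graph k m} {u v} → Walk G u v → List (Fin k)
walkVertices {u = u} stop         = u ∷ []
walkVertices {u = u} (step _ _ w) = u ∷ walkVertices w

walkEdges : ∀ {k m} {G : Graph k m} {u v} → Walk G u v → List (Fin m)
walkEdges stop         = []
walkEdges (step e _ w) = e ∷ walkEdges w

-- A cycle is a path from u to v closed up by a further edge from v to u;
-- this includes loops and pairs of parallel edges.
record Cycle {k m} (G : Graph k m) : Set where
  field
    {u v}    : Fin k
    path     : Walk G u v
    distinct : Unique (walkVertices path)
    closing  : Fin m
    closes   : Joins G closing v u
    fresh    : closing List∈.∉ walkEdges path

IsTree : ∀ {k m} → Graph k m → Set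
IsTree {k} G = 1 ≤ k × (∀ u v → Walk G u v) × ¬ Cycle G

------------------------------------------------------------------------
-- Tree decompositions

-- A graph whose vertices are labelled by matroids and whose edges are
-- named by elements of the universe Fin N.
record LabelledGraph (N k m : ℕ) : Set₁ where
  field
    graph : Graph k m
    label : Fin k → Matroid N
    name  : Fin m → Fin N

open LabelledGraph public

-- H arises from G by contracting one edge and labelling the composite
-- vertex by the 2-sum of the labels of its ends.  The map π sends each
-- vertex of G to the vertex of H that contains it.
record Contraction {N k m} (G : LabelledGraph N (suc k) (suc m))
                           (H : LabelledGraph N k m) : Set where
  field
    edge : Fin (suc m)
    π    : Fin (suc k) → Fin k
  u : Fin (suc k)
  u = proj₁ (graph G edge)
  v : Fin (suc k)
  v = proj₂ (graph G edge)
  field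
    π-surjective : Surjective _≡_ _≡_ π
    π-identifies : ∀ a b → π a ≡ π b ⇔ (a ≡ b ⊎ (a ≡ u × b ≡ v) ⊎ (a ≡ v × b ≡ u))
    graph-H      : ∀ i → graph H i ≡ Product.map π π (graph G (punchIn edge i))
    name-H       : ∀ i → name H i ≡ name G (punchIn edge i)
    label-H      : ∀ a → a ≢ u → a ≢ v → label H (π a) ≈ label G a
    composite    : Is2Sum (name G edge) (label G u) (label G v) (label H (π u))

-- M can be obtained from a labelled graph by repeated contraction.
data _Yields_ {N} : ∀ {k m} → LabelledGraph N k m → Matroid N → Set₁ where
  single   : ∀ {G : LabelledGraph N 1 0} {M} → label G zero ≈ M → G Yields M
  contract : ∀ {k m} {G : LabelledGraph N (suc k) (suc m)} {H : LabelledGraph N k m} {M} →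
             Contraction G H → H Yields M → G Yields M

record IsTreeDecomposition {N k m} (T : LabelledGraph N k m) (M : Matroid N) : Set₁ where
  field
    isTree          : IsTree (graph T)
    labelsConnected : ∀ i → Connected (label T i)
    namesDistinct   : Injective _≡_ _≡_ (name T)
    groundSet       : ∀ a → a ∈ E M ⇔ ((∃ λ i → a ∈ E (label T i)) × (∀ e → name T e ≢ a))
    joined          : ∀ e i j → Joins (graph T) e i j →
                      E (label T i) ∩ E (label T j) ≡ ⁅ name T e ⁆
    notJoined       : ∀ i j → i ≢ j → ¬ Adjacent (graph T) i j →
                      E (label T i) ∩ E (label T j) ≡ ⊥
    large           : 3 ≤ ∣ E M ∣ → ∀ i → 3 ≤ ∣ E (label T i) ∣
    small           : ∣ E M ∣ < 3 → k ≡ 1 × (∀ i → label T i ≈ M)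
    yields          : T Yields M

record IsCanonicalTreeDecomposition {N k m} (T : LabelledGraph N k m) (M : Matroid N) : Set₁ where
  field
    isTreeDecomposition  : IsTreeDecomposition T M
    labels              : ∀ i → IsCircuitMatroid (label T i)
                              ⊎ IsCocircuitMatroid (label T i)
                              ⊎ (ThreeConnected (label T i) × 4 ≤ ∣ E (label T i) ∣)
    noAdjacentCircuits   : ∀ i j → Adjacent (graph T) i j →
                          ¬ (IsCircuitMatroid (label T i) × IsCircuitMatroid (label T j))
    noAdjacentCocircuits : ∀ i j → Adjacent (graph T) i j →
                          ¬ (IsCocircuitMatroid (label T i) × IsCocircuitMatroid (label T j))

IsBasepoint : ∀ {N k m} → LabelledGraph N k m → Fin k → Fin N → Set
IsBasepoint T i a = a ∈ E (label T i) × (∃ λ e → name T e ≡ a)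

-- The graph is a path whose vertices, in order, are P 0, …, P n.
record PathOrder {k m} (G : Graph k m) (n : ℕ) : Set where
  field
    order       : Fin (suc n) ↔ Fin k
  P : Fin (suc n) → Fin k
  P = Inverse.to order
  field
    consecutive : ∀ i j → Adjacent G (P i) (P j) ⇔
                  (toℕ j ≡ suc (toℕ i) ⊎ toℕ i ≡ suc (toℕ j))

record IsSpikePath {N k m} (T : LabelledGraph N k m) (e f : Fin N) : Set where
  field
    n         : ℕ
    pathOrder : PathOrder (graph T) n

  P : Fin (suc n) → Matroid N
  P i = label T (PathOrder.P pathOrder i)

  Basepoint : Fin (suc n) → Fin N → Set
  Basepoint i = IsBasepoint T (PathOrder.P pathOrder i)

  first : Fin (suc n)
  first = zero

  last : Fin (suc n)
  last = fromℕ n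

  field
    labels : ∀ i → (∃ λ s → 3 ≤ s × IsCircuitOfSize s (P i))
                 ⊎ (system (P i) ≅ U 1 3)
                 ⊎ IsSpike (P i)

    first≇U₁₃ : ¬ (system (P first) ≅ U 1 3)
    last≇U₁₃  : ¬ (system (P last) ≅ U 1 3)

    oneVertex : n ≡ 0 → IsSpike (P first) → IsTipCotipPair (P first) e f

    endElements : 1 ≤ n → (e ∈ E (P first) × f ∈ E (P last))
                        ⊎ (f ∈ E (P first) × e ∈ E (P last))

    -- {p, q} is the set of basepoints of P i.
    interiorSpike : ∀ i → 0 < toℕ i → toℕ i < n → IsSpike (P i) →
      ∃₂ λ p q → p ≢ q × (∀ a → Basepoint i a ⇔ (a ≡ p ⊎ a ≡ q)) ×
                 IsTipCotipPair (P i) p q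

    -- p is the single basepoint of P i, and g is the single member of
    -- {e, f} in P i.
    endSpike : 1 ≤ n → ∀ i → i ≡ first ⊎ i ≡ last → IsSpike (P i) →
      ∃₂ λ p g → (∀ a → Basepoint i a ⇔ a ≡ p) ×
                 (∀ a → (a ∈ E (P i) × (a ≡ e ⊎ a ≡ f)) ⇔ a ≡ g) ×
                 IsTipCotipPair (P i) p g

{-# OPTIONS --safe #-}
-- A circuit C of a binary matroid is spanning iff every x ∉ C lies in a cycle contained in C ∪ {x}; this
-- condition can be tested on circuits alone.  Let M = M₁ ⊕₂ M₂ with basepoint p.
--   * If e ∈ M₁ and f ∈ M₂, all circuits of M through e and f span iff the same holds for (M₁, e, p) and (M₂, p, f).
--   * If e, f ∈ M₁, then all circuits of M₂ through p span, which forces M₂ to be a circuit, and all circuits of M₁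
--     through e and f contain p.  No contraction of a canonical tree decomposition has an edge of this kind.
-- Hence, undoing the contractions one at a time, the tree stays a path from e to f whose labels have the same property
-- with respect to their two terminals.  For a 3-connected label with terminals e and f, fix a circuit C through both.
-- Every x ∉ C splits C into a side A containing e and a side B containing f.  Two incomparable sides differ by the
-- exchange of one element, and comparable ones would give a 2-separation; so either all A or all B have two elements,
-- which is the structure of a spike with tip e or f.

module Submission where

open import Defs
open import Algebra.Bundles using (CommutativeRing)
open import Data.Bool.Base using (Bool; true; false; _∧_; _xor_)
open import Data.Bool.Properties using
  (xor-comm; xor-assoc; xor-same; xor-identityʳ; xor-∧-commutativeRing; ∧-distribʳ-xor; ∧-identityʳ;
  ∧-zeroʳ; ∧-distribˡ-xor) renaming (_≟_ to _≟ᵇ_)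
open import Data.Empty using (⊥-elim) renaming (⊥ to False)
open import Data.Fin.Base using
  (Fin; zero; suc; punchIn; punchOut; fromℕ; inject₁; splitAt; _↑ˡ_; _↑ʳ_; toℕ; fromℕ<)
open import Data.Fin.Permutation using (↔⇒≡)
open import Data.Fin.Properties using
  (_≟_; any?; all?; punchIn-injective; punchInᵢ≢i; punchIn-punchOut; injective⇒≤; splitAt-↑ˡ; splitAt-↑ʳ;
  splitAt⁻¹-↑ˡ; splitAt⁻¹-↑ʳ; ↑ˡ-injective; ↑ʳ-injective; suc-injective; fromℕ≢inject₁;
  punchOut-injective; toℕ-injective; toℕ-inject₁; toℕ-fromℕ; toℕ-fromℕ<; toℕ<n)
open import Data.Fin.Relation.Unary.Top using (view; view-fromℕ; view-inject₁; ‵fromℕ; ‵inject₁; View)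
open import Data.Fin.Subset
open import Data.Fin.Subset.Properties
open import Data.List.Base as List using (List; length; []; _∷_; _++_)
import Data.List.Extrema.Nat as Extrema
open import Data.List.Membership.Propositional using () renaming (_∈_ to _∈ₗ_; _∉_ to _∉ₗ_)
open import Data.List.Membership.Propositional.Properties using
  (∈-map⁺; ∈-map⁻; ∈-++⁺ˡ; ∈-++⁺ʳ; ∈-filter⁺; ∈-filter⁻; ∈-++⁻; ∈-∃++; ∈-tabulate⁺)
open import Data.List.Properties using (length-++; length-map; ++-assoc; length-tabulate)
open import Data.List.Relation.Unary.All as All using (All)
open import Data.List.Relation.Unary.Any using (here; there; index)
open import Data.List.Relation.Unary.Any.Properties using (lookup-index)
open import Data.Nat.Base using (ℕ; zero; suc; _+_; _≤_; _<_; z≤n; s≤s; s≤s⁻¹; _∸_)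
open import Data.Nat.Induction using (<-wellFounded)
import Data.Nat.Properties as ℕ
open import Data.Product.Base using (∃; ∃₂; _×_; _,_; proj₁; proj₂)
import Data.Sum.Base as Sum
open import Data.Sum.Base using (_⊎_; inj₁; inj₂; [_,_]′)
open import Data.Vec.Base using ([]; _∷_; lookup; tabulate; zipWith; here; there)
open import Data.Vec.Properties using
  (zipWith-comm; zipWith-assoc; []=⇒lookup; lookup⇒[]=; lookup-zipWith; lookup∘tabulate)
open import Data.Vec.Properties.WithK using ([]=-irrelevant)
open import Function.Base using (_∘_; id)
open import Function.Bundles using (_⇔_; mk⇔; Equivalence; _↔_; mk↔ₛ′; Inverse)
open import Function.Properties.Inverse using (↔-sym; ↔-trans)
open import Induction.WellFounded using (Acc; acc)
open import Relation.Binary.PropositionalEquality using (_≡_; _≢_; refl; sym; trans; cong; cong₂; subst)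
open import Relation.Nullary.Decidable using (Dec; yes; no; does; _×-dec_; ¬?; decidable-stable; _⊎-dec_)
open import Relation.Nullary.Negation using (¬_; contradiction)
open import Relation.Unary using (Decidable)

open import Algebra.Properties.CommutativeMonoid.Sum
  (CommutativeRing.+-commutativeMonoid xor-∧-commutativeRing) using (sum; ∑-distrib-+; sum-cong-≗)

-- Intermediate trees have 2-sums as labels, so 3-connectivity is lost on them. Three properties
-- bridge the gap. Cycle spaces and the absence of parallel pairs descend from `M` to the labels,
-- while `NoBadCircuit` ascends from the canonical tree to its contractions. It forbids an edge from
-- a whole circuit to a label in which two elements other than the basepoint `q` have all their
-- common circuits pass through `q` and span. The three kinds of canonical label exclude this for
-- different reasons: two circuits are never adjacent; in a cocircuit the pair itself is a circuit
-- missing `q`; in a 3-connected label an exchange of sides produces a circuit missing `q`. For `M`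
-- and its labels, being binary enters only as closure of the cycles under symmetric difference. In
-- this form it passes to the parts of a 2-sum without new matrices. Coordinates over GF(2) are
-- needed only at the two ends: to read off the cycles of `M`, and to compare a label with a spike.
-- The converse merges the chain edge by edge. It relies on `e` and `f` never being names of edges,
-- so that every contracted edge sits between two consecutive vertices.

private variable
  N K k m : ℕ

-- Finite subsets, symmetric difference and cardinality

module Sets where
  private variable
    n : ℕ
    p q r : Subset n
    x y z : Fin n

  set : {P : Fin n → Set} → Decidable P → Subset n
  set P? = tabulate (does ∘ P?)

  set⁺ : {P : Fin n → Set} (P? : Decidable P) → P x → x ∈ set P?
  set⁺ {x = x} P? px = lookup⇒[]= x _ (trans (lookup∘tabulate _ x) lemma)
    where
    lemma : does (P? x) ≡ true
    lemma with P? x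
    ... | yes _ = refl
    ... | no ¬px = contradiction px ¬px

  set⁻ : {P : Fin n → Set} (P? : Decidable P) → x ∈ set P? → P x
  set⁻ {x = x} P? x∈ with P? x | trans (sym (lookup∘tabulate (does ∘ P?) x)) ([]=⇒lookup x∈)
  ... | yes px | _ = px

  -⁺ : x ∈ p → x ≢ y → x ∈ p - y
  -⁺ = x∈p∧x≢y⇒x∈p-y

  ─⁻ : x ∈ p ─ q → x ∈ p × x ∉ q
  ─⁻ {p = p} {q = q} x∈ = p─q⊆p p q x∈ , lemma x∈
    where
    lemma : ∀ {n} {x : Fin n} {p q : Subset n} → x ∈ p ─ q → x ∉ q
    lemma {p = _ ∷ p} {true ∷ q} () here
    lemma {p = _ ∷ p} {_ ∷ q} (there x∈) (there x∈q) = lemma x∈ x∈q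

  -⁻ : x ∈ p - y → x ∈ p × x ≢ y
  -⁻ {y = y} x∈ with ─⁻ x∈
  ... | x∈p , x∉y = x∈p , λ { refl → x∉y (x∈⁅x⁆ y) }

  ∈∪ˡ : x ∈ p → x ∈ p ∪ q
  ∈∪ˡ = x∈p∪q⁺ ∘ inj₁

  ∈∪ʳ : x ∈ q → x ∈ p ∪ q
  ∈∪ʳ = x∈p∪q⁺ ∘ inj₂

  ∪⁻ : x ∈ p ∪ q → x ∈ p ⊎ x ∈ q
  ∪⁻ = x∈p∪q⁻ _ _

  ∩⁺ : x ∈ p → x ∈ q → x ∈ p ∩ q
  ∩⁺ a b = x∈p∩q⁺ (a , b)

  ∩⁻ : x ∈ p ∩ q → x ∈ p × x ∈ q
  ∩⁻ = x∈p∩q⁻ _ _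

  insert-new : x ∈ p ∪ ⁅ x ⁆
  insert-new {x = x} = ∈∪ʳ (x∈⁅x⁆ x)

  insert⁻ : x ∈ p ∪ ⁅ y ⁆ → x ∈ p ⊎ x ≡ y
  insert⁻ {y = y} x∈ with ∪⁻ x∈
  ... | inj₁ a = inj₁ a
  ... | inj₂ b = inj₂ (x∈⁅y⁆⇒x≡y y b)

  pair : Fin n → Fin n → Subset n
  pair x y = ⁅ x ⁆ ∪ ⁅ y ⁆

  pair⁻ : z ∈ pair x y → z ≡ x ⊎ z ≡ y
  pair⁻ {x = x} z∈ with insert⁻ z∈
  ... | inj₁ a = inj₁ (x∈⁅y⁆⇒x≡y x a)
  ... | inj₂ b = inj₂ b

  pairˡ : x ∈ pair x y
  pairˡ {x = x} = ∈∪ˡ (x∈⁅x⁆ x)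

  pairʳ : y ∈ pair x y
  pairʳ = insert-new

  pair⊆ : x ∈ p → y ∈ p → pair x y ⊆ p
  pair⊆ x∈ y∈ z∈ with pair⁻ z∈
  ... | inj₁ refl = x∈
  ... | inj₂ refl = y∈

  insert⊆ : p ⊆ q → x ∈ q → p ∪ ⁅ x ⁆ ⊆ q
  insert⊆ p⊆q x∈ z∈ with insert⁻ z∈
  ... | inj₁ a = p⊆q a
  ... | inj₂ refl = x∈

  ⊆⊎∃ : ∀ (p q : Subset n) → p ⊆ q ⊎ ∃ λ x → x ∈ p × x ∉ q
  ⊆⊎∃ p q with any? (λ x → (x ∈? p) ×-dec ¬? (x ∈? q))
  ... | yes e = inj₂ e
  ... | no ¬e = inj₁ λ {x} x∈p → decidable-stable (x ∈? q) λ x∉q → ¬e (x , x∈p , x∉q)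

  infixl 6 _⊕_
  _⊕_ : Subset n → Subset n → Subset n
  _⊕_ = zipWith _xor_

  ∉⇒lookup : x ∉ p → lookup p x ≡ false
  ∉⇒lookup {x = x} {p} x∉ with lookup p x in eq
  ... | true = contradiction (lookup⇒[]= x p eq) x∉
  ... | false = refl

  ⊕⁺ˡ : x ∈ p → x ∉ q → x ∈ p ⊕ q
  ⊕⁺ˡ {x = x} {p} {q} x∈ x∉ = lookup⇒[]= x _ (trans (lookup-zipWith _xor_ x p q)
    (cong₂ _xor_ ([]=⇒lookup x∈) (∉⇒lookup x∉)))

  ⊕⁺ʳ : x ∉ p → x ∈ q → x ∈ p ⊕ q
  ⊕⁺ʳ {x = x} {p} {q} x∉ x∈ = lookup⇒[]= x _ (trans (lookup-zipWith _xor_ x p q)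
    (cong₂ _xor_ (∉⇒lookup x∉) ([]=⇒lookup x∈)))

  ⊕⁻ : x ∈ p ⊕ q → (x ∈ p × x ∉ q) ⊎ (x ∉ p × x ∈ q)
  ⊕⁻ {x = x} {p} {q} x∈ with x ∈? p | x ∈? q | []=⇒lookup x∈
  ... | yes a | no b  | _ = inj₁ (a , b)
  ... | no a  | yes b | _ = inj₂ (a , b)
  ... | yes a | yes b | e with () ← trans (sym e) (trans (lookup-zipWith _xor_ x p q)
                               (cong₂ _xor_ ([]=⇒lookup a) ([]=⇒lookup b)))
  ... | no a  | no b  | e with () ← trans (sym e) (trans (lookup-zipWith _xor_ x p q)
                               (cong₂ _xor_ (∉⇒lookup a) (∉⇒lookup b)))

  ⊕∉₀ : x ∉ p → x ∉ q → x ∉ p ⊕ q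
  ⊕∉₀ a b x∈ with ⊕⁻ x∈
  ... | inj₁ (c , _) = a c
  ... | inj₂ (_ , c) = b c

  ⊕∉₂ : x ∈ p → x ∈ q → x ∉ p ⊕ q
  ⊕∉₂ a b x∈ with ⊕⁻ x∈
  ... | inj₁ (_ , c) = c b
  ... | inj₂ (c , _) = c a

  ⊕⊆ : p ⊆ r → q ⊆ r → p ⊕ q ⊆ r
  ⊕⊆ p⊆ q⊆ x∈ with ⊕⁻ x∈
  ... | inj₁ (c , _) = p⊆ c
  ... | inj₂ (_ , c) = q⊆ c

  ⊕-empty⇒≡ : Empty (p ⊕ q) → p ≡ q
  ⊕-empty⇒≡ {p = p} {q} empty = ⊆-antisym
    (λ {x} x∈p → decidable-stable (x ∈? q) λ x∉q → empty (x , ⊕⁺ˡ x∈p x∉q))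
    (λ {x} x∈q → decidable-stable (x ∈? p) λ x∉p → empty (x , ⊕⁺ʳ x∉p x∈q))

  ⊕-comm : ∀ (p q : Subset n) → p ⊕ q ≡ q ⊕ p
  ⊕-comm = zipWith-comm xor-comm

  ⊕-assoc : ∀ (p q r : Subset n) → (p ⊕ q) ⊕ r ≡ p ⊕ (q ⊕ r)
  ⊕-assoc = zipWith-assoc xor-assoc

  ⊕-cancelʳ : ∀ (p q : Subset n) → (p ⊕ q) ⊕ q ≡ p
  ⊕-cancelʳ [] [] = refl
  ⊕-cancelʳ (a ∷ p) (b ∷ q) = cong₂ _∷_
    (trans (xor-assoc a b b) (trans (cong (a xor_) (xor-same b)) (xor-identityʳ a))) (⊕-cancelʳ p q)

  ∣p-x∣ : ∀ (p : Subset n) → x ∈ p → ∣ p ∣ ≡ suc ∣ p - x ∣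
  ∣p-x∣ (_ ∷ p) here = cong suc (cong ∣_∣ (sym (p─⊥≡p p)))
  ∣p-x∣ (true ∷ p) (there x∈) = cong suc (∣p-x∣ p x∈)
  ∣p-x∣ (false ∷ p) (there x∈) = ∣p-x∣ p x∈

  ∣p∩q∣+∣p─q∣ : ∀ (p q : Subset n) → ∣ p ∩ q ∣ + ∣ p ─ q ∣ ≡ ∣ p ∣
  ∣p∩q∣+∣p─q∣ [] [] = refl
  ∣p∩q∣+∣p─q∣ (true ∷ p) (true ∷ q) = cong suc (∣p∩q∣+∣p─q∣ p q)
  ∣p∩q∣+∣p─q∣ (true ∷ p) (false ∷ q) = trans (ℕ.+-suc _ _) (cong suc (∣p∩q∣+∣p─q∣ p q))
  ∣p∩q∣+∣p─q∣ (false ∷ p) (true ∷ q) = ∣p∩q∣+∣p─q∣ p q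
  ∣p∩q∣+∣p─q∣ (false ∷ p) (false ∷ q) = ∣p∩q∣+∣p─q∣ p q

  ∣insert∣ : ∀ (p : Subset n) → x ∉ p → ∣ p ∪ ⁅ x ⁆ ∣ ≡ suc ∣ p ∣
  ∣insert∣ {x = x} p x∉ = trans (∣p-x∣ (p ∪ ⁅ x ⁆) insert-new) (cong (suc ∘ ∣_∣) (⊆-antisym f g))
    where
    f : (p ∪ ⁅ x ⁆) - x ⊆ p
    f z∈ with -⁻ z∈
    ... | z∈' , z≢x with insert⁻ z∈'
    ... | inj₁ a = a
    ... | inj₂ b = contradiction b z≢x
    g : p ⊆ (p ∪ ⁅ x ⁆) - x
    g z∈ = -⁺ (∈∪ˡ z∈) λ { refl → x∉ z∈ }

  ∣pair∣ : x ≢ y → ∣ pair x y ∣ ≡ 2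
  ∣pair∣ {x = x} x≢y = trans (∣insert∣ ⁅ x ⁆ (λ y∈ → x≢y (sym (x∈⁅y⁆⇒x≡y _ y∈)))) (cong suc (∣⁅x⁆∣≡1 x))

  ∣pair∣≤2 : ∀ (x y : Fin n) → ∣ pair x y ∣ ≤ 2
  ∣pair∣≤2 x y with x ≟ y
  ... | no x≢y = ℕ.≤-reflexive (∣pair∣ x≢y)
  ... | yes refl = ℕ.≤-trans (p⊆q⇒∣p∣≤∣q∣ {p = pair x x} {q = ⁅ x ⁆} (pair⊆ (x∈⁅x⁆ x) (x∈⁅x⁆ x)))
                     (ℕ.≤-trans (ℕ.≤-reflexive (∣⁅x⁆∣≡1 x)) (s≤s z≤n))

  2≤∣p∣ : x ∈ p → y ∈ p → x ≢ y → 2 ≤ ∣ p ∣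
  2≤∣p∣ {x = x} {p} {y = y} x∈ y∈ x≢y =
    subst (_≤ ∣ p ∣) (∣pair∣ x≢y) (p⊆q⇒∣p∣≤∣q∣ {p = pair x y} {q = p} (pair⊆ x∈ y∈))

  ∃-outside : ∣ q ∣ < ∣ p ∣ → ∃ λ x → x ∈ p × x ∉ q
  ∃-outside {q = q} {p} lt with ⊆⊎∃ p q
  ... | inj₁ p⊆q = contradiction (p⊆q⇒∣p∣≤∣q∣ p⊆q) (ℕ.<⇒≱ lt)
  ... | inj₂ e = e

  ∃-third : 3 ≤ ∣ p ∣ → ∀ x y → ∃ λ z → z ∈ p × z ≢ x × z ≢ y
  ∃-third {p = p} 3≤ x y with ∃-outside {q = pair x y} {p = p} (ℕ.≤-trans (s≤s (∣pair∣≤2 x y)) 3≤)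
  ... | z , z∈ , z∉ = z , z∈ , (λ { refl → z∉ pairˡ }) , (λ { refl → z∉ pairʳ })

  ∃-two : ∀ (p : Subset n) → 2 ≤ ∣ p ∣ → ∃₂ λ x y → x ∈ p × y ∈ p × x ≢ y
  ∃-two {n} p 2≤ =
    let (x , x∈ , _) = ∃-outside {q = ⊥} {p = p} (subst (λ k → suc k ≤ ∣ p ∣) (sym (∣⊥∣≡0 n)) (ℕ.<⇒≤ 2≤))
        (y , y∈ , y∉) = ∃-outside {q = ⁅ x ⁆} {p = p} (subst (λ k → suc k ≤ ∣ p ∣) (sym (∣⁅x⁆∣≡1 x)) 2≤)
    in x , y , x∈ , y∈ , λ x≡y → y∉ (subst (_∈ ⁅ x ⁆) x≡y (x∈⁅x⁆ x))

  ⊆-∣∣⇒≡ : p ⊆ q → ∣ q ∣ ≤ ∣ p ∣ → q ⊆ p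
  ⊆-∣∣⇒≡ {p = p} {q} p⊆q le with ⊆⊎∃ q p
  ... | inj₁ q⊆p = q⊆p
  ... | inj₂ e = contradiction (p⊂q⇒∣p∣<∣q∣ {p = p} {q = q} (p⊆q , e)) (ℕ.≤⇒≯ le)

open Sets

-- Rank, circuits and spanning circuits

subsets-complete : ∀ (X : Subset N) → X ∈ₗ subsets N
subsets-complete [] = here refl
subsets-complete (false ∷ X) = ∈-++⁺ˡ (∈-map⁺ _ (subsets-complete X))
subsets-complete {suc N} (true ∷ X) = ∈-++⁺ʳ (List.map (outside ∷_) (subsets N)) (∈-map⁺ _ (subsets-complete X))

module _ {N : ℕ} (M : Matroid N) where
  open Matroid M renaming (Indep to Ind) using (Indep?; hereditary; augment; ∅-indep)

  rank-≥ : ∀ I {X} → I ⊆ X → Ind I → ∣ I ∣ ≤ rank M X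
  rank-≥ I {X} I⊆X i = All.lookup (Extrema.xs≤max 0 _)
    (∈-map⁺ ∣_∣ (∈-filter⁺ (λ I → (I ⊆? X) ×-dec Indep? I) (subsets-complete I) (I⊆X , i)))

  rank-≤ : ∀ {X b} → (∀ I → I ⊆ X → Ind I → ∣ I ∣ ≤ b) → rank M X ≤ b
  rank-≤ {X} {b} h = Extrema.max≤v⁺ {xs = List.map ∣_∣ _} z≤n (All.tabulate λ m → go m)
    where
    go : ∀ {k} → k ∈ₗ List.map ∣_∣ (List.filter (λ I → (I ⊆? X) ×-dec Indep? I) (subsets N)) → k ≤ b
    go m with ∈-map⁻ ∣_∣ m
    ... | I , I∈ , refl with ∈-filter⁻ (λ I → (I ⊆? X) ×-dec Indep? I) {xs = subsets N} I∈
    ... | _ , I⊆X , i = h I I⊆X i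

  rank-mono : ∀ {X Y} → X ⊆ Y → rank M X ≤ rank M Y
  rank-mono X⊆Y = rank-≤ λ I I⊆X i → rank-≥ I (λ z → X⊆Y (I⊆X z)) i

  -- An independent subset of `X` larger than `S` would augment `S` by an element of `X`.
  rank-≤-spanned : ∀ {X S} → Ind S → (∀ {x} → x ∈ X → x ∉ S → ¬ Ind (S ∪ ⁅ x ⁆)) → rank M X ≤ ∣ S ∣
  rank-≤-spanned {X} {S} iS sp = rank-≤ go
    where
    go : ∀ I → I ⊆ X → Ind I → ∣ I ∣ ≤ ∣ S ∣
    go I I⊆X i with ℕ.≤-<-connex ∣ I ∣ ∣ S ∣
    ... | inj₁ le = le
    ... | inj₂ lt with augment iS i lt
    ... | a , a∈ , a∉ , ia = contradiction ia (sp (I⊆X a∈) a∉)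

  dep⇒circuit : ∀ {X} → X ⊆ E M → ¬ Ind X → ∃ λ C → IsCircuit M C × C ⊆ X
  dep⇒circuit {X} = go _ X ℕ.≤-refl
    where
    go : ∀ b X → ∣ X ∣ ≤ b → X ⊆ E M → ¬ Ind X → ∃ λ C → IsCircuit M C × C ⊆ X
    go b X le X⊆ d with any? (λ x → (x ∈? X) ×-dec ¬? (Indep? (X - x)))
    go zero X le X⊆ d | yes (x , x∈ , _) =
      contradiction (ℕ.≤-trans (ℕ.≤-reflexive (sym (∣p-x∣ X x∈))) le) λ ()
    go (suc b) X le X⊆ d | yes (x , x∈ , d') with
      go b (X - x) (s≤s⁻¹ (ℕ.≤-trans (ℕ.≤-reflexive (sym (∣p-x∣ X x∈))) le)) (λ z → X⊆ (proj₁ (-⁻ z))) d'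
    ... | C , c , C⊆ = C , c , λ z → proj₁ (-⁻ (C⊆ z))
    go b X le X⊆ d | no ¬e = X , (X⊆ , d , min) , id
      where
      min : ∀ D → D ⊂ X → Ind D
      min D (D⊆ , x , x∈ , x∉) = hereditary
        (λ {z} z∈ → -⁺ (D⊆ z∈) λ { refl → x∉ z∈ })
        (decidable-stable (Indep? (X - x)) λ d' → ¬e (x , x∈ , d'))

  circuit-⊆ : ∀ {C D} → IsCircuit M C → ¬ Ind D → D ⊆ C → C ⊆ D
  circuit-⊆ {C} {D} (_ , _ , min) d D⊆C with ⊆⊎∃ C D
  ... | inj₁ C⊆D = C⊆D
  ... | inj₂ e = contradiction (min D (D⊆C , e)) d

  circuit-nonempty : ∀ {C} → IsCircuit M C → Nonempty C
  circuit-nonempty {C} (_ , d , _) with nonempty? C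
  ... | yes ne = ne
  ... | no e = contradiction (subst Ind (sym (Empty-unique e)) ∅-indep) d

  Spans : Subset N → Set
  Spans C = ∀ x → x ∈ E M → x ∉ C → ∃ λ D → IsCircuit M D × x ∈ D × D ⊆ C ∪ ⁅ x ⁆

  -- A circuit in D that avoided x would be a proper subset of C.
  dep⇒circuit-through : ∀ {C D x c} → IsCircuit M C → x ∈ E M → ¬ Ind D → D ⊆ C ∪ ⁅ x ⁆ → c ∈ C → c ∉ D →
    ∃ λ D′ → IsCircuit M D′ × x ∈ D′ × D′ ⊆ D
  dep⇒circuit-through {C} {D} {x} {c} (C⊆ , _ , min) x∈ d D⊆ c∈ c∉
    with dep⇒circuit (λ z∈ → insert⊆ C⊆ x∈ (D⊆ z∈)) d
  ... | D′ , cD′ , D′⊆D with x ∈? D′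
  ... | yes x∈D′ = D′ , cD′ , x∈D′ , D′⊆D
  ... | no x∉D′ = contradiction (min D′ (D′⊆C , c , c∈ , λ z → c∉ (D′⊆D z))) (proj₁ (proj₂ cD′))
    where
    D′⊆C : D′ ⊆ C
    D′⊆C z∈ with insert⁻ (D⊆ (D′⊆D z∈))
    ... | inj₁ a = a
    ... | inj₂ refl = contradiction z∈ x∉D′

  circuit-indep : ∀ {C c X} → IsCircuit M C → X ⊆ C → c ∈ C → c ∉ X → Ind X
  circuit-indep (_ , _ , min) X⊆C c∈ c∉ = min _ (X⊆C , _ , c∈ , c∉)

  circuit-rank : ∀ {C} → IsCircuit M C → ∣ C ∣ ≤ suc (rank M (E M))
  circuit-rank {C} cC@(C⊆ , _ , min) with circuit-nonempty cC
  ... | c , c∈ = ℕ.≤-trans (ℕ.≤-reflexive (∣p-x∣ C c∈))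
    (s≤s (rank-≥ (C - c) (λ z → C⊆ (proj₁ (-⁻ z))) (circuit-indep cC (λ z → proj₁ (-⁻ z)) c∈ (λ z → proj₂ (-⁻ z) refl))))

  -- Let `B = C - c`. Independent subsets of `C` have at most `∣ B ∣` elements, so if `C` spans then
  -- `B ∪ ⁅ x ⁆` is too large to be independent, and a circuit in it must use `x`. Conversely,
  -- closing circuits make `B` a maximal independent set of `M`, so the rank of `M` is attained
  -- inside `C`.
  Spanning⇔Spans : ∀ {C} → IsCircuit M C → Spanning M C ⇔ Spans C
  Spanning⇔Spans {C} cC@(C⊆ , dC , min) with circuit-nonempty cC
  ... | c , c∈ = mk⇔ to from
    where
    B = C - c
    B⊆C : B ⊆ C
    B⊆C z = proj₁ (-⁻ z)
    iB : Ind B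
    iB = circuit-indep cC B⊆C c∈ (λ z → proj₂ (-⁻ z) refl)
    to : Spanning M C → Spans C
    to sp x x∈ x∉ with dep⇒circuit-through cC x∈ dBx (insert⊆ (λ z → ∈∪ˡ (B⊆C z)) insert-new) c∈ c∉
      where
      dBx : ¬ Ind (B ∪ ⁅ x ⁆)
      dBx i = ℕ.<-irrefl refl (ℕ.≤-trans
        (subst (_≤ rank M (E M)) (∣insert∣ B (λ z → x∉ (B⊆C z)))
          (rank-≥ (B ∪ ⁅ x ⁆) (insert⊆ (λ z → C⊆ (B⊆C z)) x∈) i))
        (ℕ.≤-trans (ℕ.≤-reflexive (sym sp)) (ℕ.≤-trans (rank-≤ bound) ℕ.≤-refl)))
        where
        bound : ∀ I → I ⊆ C → Ind I → ∣ I ∣ ≤ ∣ B ∣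
        bound I I⊆ i with ⊆⊎∃ C I
        ... | inj₁ C⊆I = contradiction (hereditary C⊆I i) dC
        ... | inj₂ e = s≤s⁻¹ (subst (suc ∣ I ∣ ≤_) (∣p-x∣ C c∈) (p⊂q⇒∣p∣<∣q∣ {p = I} {q = C} (I⊆ , e)))
      c∉ : c ∉ B ∪ ⁅ x ⁆
      c∉ z with insert⁻ z
      ... | inj₁ a = proj₂ (-⁻ a) refl
      ... | inj₂ refl = x∉ c∈
    ... | D′ , cD′ , x∈D′ , D′⊆ = D′ , cD′ , x∈D′ , λ z → insert⊆ (λ w → ∈∪ˡ (B⊆C w)) insert-new (D′⊆ z)
    from : Spans C → Spanning M C
    from sp = ℕ.≤-antisym (rank-mono C⊆) (ℕ.≤-trans (rank-≤-spanned iB dep) (rank-≥ B B⊆C iB))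
      where
      dep : ∀ {x} → x ∈ E M → x ∉ B → ¬ Ind (B ∪ ⁅ x ⁆)
      dep {x} x∈ x∉ i with x ∈? C
      ... | yes x∈C = dC (hereditary sub i)
        where
        sub : C ⊆ B ∪ ⁅ x ⁆
        sub {z} z∈ with z ≟ x
        ... | yes refl = insert-new
        ... | no z≢x with z ≟ c
        ... | no z≢c = ∈∪ˡ (-⁺ z∈ z≢c)
        ... | yes refl with x ≟ z
        ... | yes refl = insert-new
        ... | no x≢z = contradiction (-⁺ x∈C x≢z) x∉
      ... | no x∉C with sp x x∈ x∉C
      ... | D , (_ , dD , minD) , x∈D , D⊆ with ⊆⊎∃ C D
      ... | inj₁ C⊆D = dC (minD C (C⊆D , x , x∈D , x∉C))
      -- `C - c₂` has as many elements as `B`, so an independent `B ∪ ⁅ x ⁆` would augment it.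
      -- Adding `x` puts `D` inside an independent set; the only other candidate is `c₂`, which
      -- restores `C`.
      ... | inj₂ (c₂ , c₂∈C , c₂∉D)
        with augment (circuit-indep cC (λ z → proj₁ (-⁻ z)) c₂∈C (λ z → proj₂ (-⁻ z) refl)) i
             (ℕ.≤-reflexive (trans (sym (∣p-x∣ C c₂∈C)) (trans (∣p-x∣ C c∈) (sym (∣insert∣ B x∉)))))
      ... | z , z∈ , z∉ , iz with insert⁻ z∈
      ... | inj₂ refl = dD (hereditary sub iz)
        where
        sub : D ⊆ (C - c₂) ∪ ⁅ x ⁆
        sub w with insert⁻ (D⊆ w)
        ... | inj₁ a = ∈∪ˡ (-⁺ a λ { refl → c₂∉D w })
        ... | inj₂ refl = insert-new
      ... | inj₁ z∈B = dC (hereditary sub iz)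
        where
        sub : C ⊆ (C - c₂) ∪ ⁅ z ⁆
        sub {w} w∈ with w ≟ c₂ | z ≟ c₂
        ... | no w≢ | _ = ∈∪ˡ (-⁺ w∈ w≢)
        ... | yes refl | yes refl = insert-new
        ... | yes refl | no z≢ = contradiction (-⁺ (B⊆C z∈B) z≢) z∉

-- Binary matroids

CircuitsSpan : Matroid N → Fin N → Fin N → Set
CircuitsSpan M a b = ∀ C → IsCircuit M C → a ∈ C → b ∈ C → Spans M C

-- The cycles are the disjoint unions of circuits; closure under ⊕ is what makes M binary.
record CycleSpace (M : Matroid N) : Set₁ where
  open Matroid M renaming (Indep to Ind) using ()
  field
    Cyc     : Subset N → Set
    Cyc⇒⊆   : ∀ {X} → Cyc X → X ⊆ E M
    Cyc-⊕   : ∀ {X Y} → Cyc X → Cyc Y → Cyc (X ⊕ Y)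
    Cyc⇒dep : ∀ {X} → Cyc X → Nonempty X → ¬ Ind X
    dep⇒Cyc : ∀ {X} → X ⊆ E M → ¬ Ind X → ∃ λ Y → Y ⊆ X × Nonempty Y × Cyc Y

  circuit⇒Cyc : ∀ {C} → IsCircuit M C → Cyc C
  circuit⇒Cyc {C} cC@(C⊆ , dC , _) with dep⇒Cyc C⊆ dC
  ... | Y , Y⊆ , ne , cY = subst Cyc (⊆-antisym Y⊆ (circuit-⊆ M cC (Cyc⇒dep cY ne) Y⊆)) cY

  Cyc⇒circuit : ∀ {X} → Cyc X → Nonempty X → ∃ λ C → IsCircuit M C × C ⊆ X
  Cyc⇒circuit cX ne = dep⇒circuit M (Cyc⇒⊆ cX) (Cyc⇒dep cX ne)

  minimal⇒circuit : ∀ {X} → Cyc X → Nonempty X →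
    (∀ {Y} → Cyc Y → Y ⊆ X → Nonempty Y → X ⊆ Y) → IsCircuit M X
  minimal⇒circuit {X} cX ne min with Cyc⇒circuit cX ne
  ... | C , cC , C⊆X = subst (IsCircuit M) (⊆-antisym C⊆X (min (circuit⇒Cyc cC) C⊆X (circuit-nonempty M cC))) cC

  -- The source of all uniqueness arguments below: proper subsets of a circuit are independent, so
  -- they contain no nonempty cycle. Applied to the sum of two cycles, it shows that they are equal.
  within-circuit : ∀ {C X c} → IsCircuit M C → Cyc X → X ⊆ C → c ∈ C → c ∉ X → Empty X
  within-circuit cC cX X⊆C c∈ c∉ ne = Cyc⇒dep cX ne (circuit-indep M cC X⊆C c∈ c∉)

  module _ {C x T} (cC : IsCircuit M C) (x∉C : x ∉ C) (cT : Cyc T) (x∈T : x ∈ T) (T⊆ : T ⊆ C ∪ ⁅ x ⁆) where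

    -- `C ∪ ⁅ x ⁆` carries at most the cycles ∅, `C`, `T` and `T ⊕ C`, like a theta graph. An
    -- element `c` of `C` outside both `T` and `X` leaves only ∅ and `T`: either `X` itself or
    -- `X ⊕ T` is a cycle properly inside `C`.
    theta : ∀ {X c} → Cyc X → X ⊆ C ∪ ⁅ x ⁆ → c ∈ C → c ∉ T → c ∉ X → Empty X ⊎ X ≡ T
    theta {X} {c} cX X⊆ c∈ c∉T c∉X with x ∈? X
    ... | no x∉X = inj₁ (within-circuit cC cX sub c∈ c∉X)
      where
      sub : X ⊆ C
      sub z∈ with insert⁻ (X⊆ z∈)
      ... | inj₁ a = a
      ... | inj₂ refl = contradiction z∈ x∉X
    ... | yes x∈X = inj₂ (⊕-empty⇒≡ (within-circuit cC (Cyc-⊕ cX cT) sub c∈ (⊕∉₀ c∉X c∉T)))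
      where
      sub : X ⊕ T ⊆ C
      sub {z} z∈ with insert⁻ (⊕⊆ X⊆ T⊆ z∈)
      ... | inj₁ a = a
      ... | inj₂ refl = contradiction z∈ (⊕∉₂ x∈X x∈T)

    theta-circuit : ∀ {c} → c ∈ C → c ∉ T → IsCircuit M T
    theta-circuit c∈ c∉ = minimal⇒circuit cT (x , x∈T) λ cY Y⊆ ne →
      case (theta cY (λ z → T⊆ (Y⊆ z)) c∈ c∉ (λ z → c∉ (Y⊆ z))) ne
      where
      case : ∀ {Y} → Empty Y ⊎ Y ≡ T → Nonempty Y → T ⊆ Y
      case (inj₁ e) ne = contradiction ne e
      case (inj₂ refl) ne = id

    -- If `c` and `d` were different, the circuit closing `c` over `T` would still miss `d`, so
    -- `theta` would make it `T`, which does not contain `c`.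
    theta-spans : ∀ {c d} → c ∈ C → c ∉ T → d ∈ C → d ∉ T → Spans M T → c ≡ d
    theta-spans {c} {d} c∈ c∉ d∈ d∉ sp with c ≟ d
    ... | yes c≡d = c≡d
    ... | no c≢d with sp c (proj₁ cC c∈) c∉
    ... | D , cD , c∈D , D⊆ with theta (circuit⇒Cyc cD) sub d∈ d∉ d∉D
      where
      sub : D ⊆ C ∪ ⁅ x ⁆
      sub z = insert⊆ T⊆ (∈∪ˡ c∈) (D⊆ z)
      d∉D : d ∉ D
      d∉D z with insert⁻ (D⊆ z)
      ... | inj₁ a = d∉ a
      ... | inj₂ d≡c = c≢d (sym d≡c)
    ... | inj₁ e = contradiction (c , c∈D) e
    ... | inj₂ refl = contradiction c∈D c∉

    -- A spanning `T` misses at most one element of `C`, so `T ⊕ C` shrinks to a parallel pair,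
    -- which the callers rule out. The case `C ⊆ T` stands apart because `T` is then not known to be
    -- a circuit.
    theta-short : (IsCircuit M T → Spans M T) → C ⊆ T ⊎ ∃ λ c → c ∈ C × c ∉ T × T ⊕ C ⊆ pair x c
    theta-short sp with ⊆⊎∃ C T
    ... | inj₁ C⊆T = inj₁ C⊆T
    ... | inj₂ (c , c∈ , c∉) = inj₂ (c , c∈ , c∉ , sub)
      where
      sub : T ⊕ C ⊆ pair x c
      sub z∈ with ⊕⁻ z∈
      ... | inj₂ (z∉T , z∈C) with theta-spans c∈ c∉ z∈C z∉T (sp (theta-circuit c∈ c∉))
      ... | refl = pairʳ
      sub z∈ | inj₁ (z∈T , z∉C) with insert⁻ (T⊆ z∈T)
      ... | inj₁ z∈C = contradiction z∈C z∉C
      ... | inj₂ refl = pairˡ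

linearCombination-⊕ : ∀ {r} (X Y : Subset N) (v : Fin N → Fin r → Bool) j →
  linearCombination (X ⊕ Y) v j ≡ linearCombination X v j xor linearCombination Y v j
linearCombination-⊕ X Y v j = trans
  (sum-cong-≗ λ i → trans (cong (_∧ v i j) (lookup-zipWith _xor_ i X Y)) (∧-distribʳ-xor (v i j) (lookup X i) (lookup Y i)))
  (∑-distrib-+ (λ i → lookup X i ∧ v i j) (λ i → lookup Y i ∧ v i j))

InKernel : ∀ {r} → (Fin K → Fin r → Bool) → Subset K → Set
InKernel v X = ∀ j → linearCombination X v j ≡ false

inKernel-⊕ : ∀ {r} (v : Fin K → Fin r → Bool) X Y → InKernel v X → InKernel v Y → InKernel v (X ⊕ Y)
inKernel-⊕ v X Y hX hY j = trans (linearCombination-⊕ X Y v j) (cong₂ _xor_ (hX j) (hY j))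

-- The negated universal statement yields a witness because there are finitely many candidates to
-- search.
dependent⇒kernel : ∀ {r} (v : Fin K → Fin r → Bool) X → ¬ LinearlyIndependent v X →
  ∃ λ Y → Y ⊆ X × Nonempty Y × InKernel v Y
dependent⇒kernel v X d with anySubset? (λ Y → (Y ⊆? X) ×-dec nonempty? Y ×-dec
                              all? (λ j → linearCombination Y v j ≟ᵇ false))
... | yes e = e
... | no ¬e = ⊥-elim (d λ Y Y⊆ k → Empty-unique λ ne → ¬e (Y , (λ {x} → Y⊆ {x}) , ne , k))

Binary⇒CycleSpace : (M : Matroid N) → Binary M → CycleSpace M
Binary⇒CycleSpace {N} M (r , v , rep) = record
  { Cyc = λ X → X ⊆ E M × InKernel v X
  ; Cyc⇒⊆ = λ c {x} → proj₁ c {x}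
  ; Cyc-⊕ = λ {X} {Y} cX cY → (λ {x} → ⊕⊆ (proj₁ cX) (proj₁ cY) {x}) , inKernel-⊕ v X Y (proj₂ cX) (proj₂ cY)
  ; Cyc⇒dep = λ { {X} (X⊆ , k) (x , x∈) i → ∉⊥ (subst (x ∈_) (Equivalence.to (rep X X⊆) i X id k) x∈) }
  ; dep⇒Cyc = λ {X} X⊆ d → dep X X⊆ d
  }
  where
  dep : ∀ X → X ⊆ E M → ¬ Matroid.Indep M X → ∃ λ Y → Y ⊆ X × Nonempty Y × (Y ⊆ E M × InKernel v Y)
  dep X X⊆ d with dependent⇒kernel v X (λ li → d (Equivalence.from (rep X X⊆) li))
  ... | Y , Y⊆ , ne , k = Y , (λ {x} → Y⊆ {x}) , ne , (λ z → X⊆ (Y⊆ z)) , k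

-- 2-sums

CircuitsSpanThrough : Matroid N → Fin N → Fin N → Fin N → Set
CircuitsSpanThrough M a b q = ∀ C → IsCircuit M C → a ∈ C → b ∈ C → q ∈ C × Spans M C

NoParallel : Matroid N → Fin N → Set
NoParallel M p = ∀ x y → x ∈ E M → y ∈ E M → x ≢ p → y ≢ p → x ≢ y → Matroid.Indep M (pair x y)

-- What remains at a basepoint `q` when both terminals lie on one side of an edge: every circuit
-- through the two is forced through `q`.
BadPair : Matroid N → Fin N → Set
BadPair M q = ∃₂ λ a b → a ∈ E M × b ∈ E M × a ≢ b × a ≢ q × b ≢ q × CircuitsSpanThrough M a b q

circuitsSpan-sym : ∀ {M : Matroid N} {a b} → CircuitsSpan M a b → CircuitsSpan M b a
circuitsSpan-sym h C c b∈ a∈ = h C c a∈ b∈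

connected⇒circuit : ∀ (M : Matroid N) → Connected M → 3 ≤ ∣ E M ∣ → ∀ {a} → a ∈ E M →
  ∃ λ C → IsCircuit M C × a ∈ C
connected⇒circuit M con size {a} a∈ with ∃-third {p = E M} size a a
... | y , y∈ , y≢a , _ with con a y a∈ y∈ (y≢a ∘ sym)
... | C , cC , a∈C , _ = C , cC , a∈C

-- A loop would be a proper part of the circuit that joins its element to another one.
connected⇒no-loop : ∀ (M : Matroid N) → Connected M → 3 ≤ ∣ E M ∣ → ∀ {a C} → IsCircuit M C → ¬ (C ⊆ ⁅ a ⁆)
connected⇒no-loop M con size {a} {C} cC@(C⊆ , dC , _) sub with circuit-nonempty M cC
... | z , z∈ with x∈⁅y⁆⇒x≡y a (sub z∈)
... | refl with ∃-third {p = E M} size a a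
... | y , y∈ , y≢a , _ with con a y (C⊆ z∈) y∈ (y≢a ∘ sym)
... | D , cD , a∈D , y∈D = dC (circuit-indep M cD C⊆D y∈D (λ y∈C → y≢a (x∈⁅y⁆⇒x≡y a (sub y∈C))))
  where
  C⊆D : C ⊆ D
  C⊆D w with x∈⁅y⁆⇒x≡y a (sub w)
  ... | refl = a∈D

twoSum-sym : ∀ {p} {M₁ M₂ M : Matroid N} → Is2Sum p M₁ M₂ M → Is2Sum p M₂ M₁ M
twoSum-sym {p = p} {M₁} {M₂} {M} s = record
  { connected₁ = connected₂ ; connected₂ = connected₁ ; size₁ = size₂ ; size₂ = size₁
  ; basepoint = trans (∩-comm (E M₂) (E M₁)) basepoint
  ; groundSet = trans groundSet (cong (_- p) (∪-comm (E M₁) (E M₂)))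
  ; circuits = λ C → mk⇔ (f C ∘ Equivalence.to (circuits C)) (Equivalence.from (circuits C) ∘ g C)
  }
  where
  open Is2Sum s
  f : ∀ C → _ → _
  f C (inj₁ h) = inj₂ (inj₁ h)
  f C (inj₂ (inj₁ h)) = inj₁ h
  f C (inj₂ (inj₂ (C₁ , C₂ , c₁ , p₁ , c₂ , p₂ , eq))) =
    inj₂ (inj₂ (C₂ , C₁ , c₂ , p₂ , c₁ , p₁ , trans eq (cong (_- p) (∪-comm C₁ C₂))))
  g : ∀ C → _ → _
  g C (inj₁ h) = inj₂ (inj₁ h)
  g C (inj₂ (inj₁ h)) = inj₁ h
  g C (inj₂ (inj₂ (C₁ , C₂ , c₁ , p₁ , c₂ , p₂ , eq))) =
    inj₂ (inj₂ (C₂ , C₁ , c₂ , p₂ , c₁ , p₁ , trans eq (cong (_- p) (∪-comm C₁ C₂))))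

module TwoSum {p : Fin N} {M₁ M₂ M : Matroid N} (s : Is2Sum p M₁ M₂ M) where
  open Is2Sum s public

  p∈E₁ : p ∈ E M₁
  p∈E₁ = proj₁ (∩⁻ {p = E M₁} {q = E M₂} (subst (p ∈_) (sym basepoint) (x∈⁅x⁆ p)))

  p∈E₂ : p ∈ E M₂
  p∈E₂ = proj₂ (∩⁻ {p = E M₁} {q = E M₂} (subst (p ∈_) (sym basepoint) (x∈⁅x⁆ p)))

  meet : ∀ {a} → a ∈ E M₁ → a ∈ E M₂ → a ≡ p
  meet a₁ a₂ = x∈⁅y⁆⇒x≡y p (subst (_ ∈_) basepoint (∩⁺ a₁ a₂))

  ground₁ : ∀ {a} → a ∈ E M₁ → a ≢ p → a ∈ E M
  ground₁ a∈ a≢ = subst (_ ∈_) (sym groundSet) (-⁺ (∈∪ˡ a∈) a≢)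

  ground₂ : ∀ {a} → a ∈ E M₂ → a ≢ p → a ∈ E M
  ground₂ a∈ a≢ = subst (_ ∈_) (sym groundSet) (-⁺ (∈∪ʳ a∈) a≢)

  ground⁻ : ∀ {a} → a ∈ E M → (a ∈ E M₁ ⊎ a ∈ E M₂) × a ≢ p
  ground⁻ a∈ with -⁻ (subst (_ ∈_) groundSet a∈)
  ... | a∈' , a≢ = ∪⁻ a∈' , a≢

  glue : Subset N → Subset N → Subset N
  glue C₁ C₂ = (C₁ ∪ C₂) - p

  circuit₁ : ∀ {C} → IsCircuit M₁ C → p ∉ C → IsCircuit M C
  circuit₁ c p∉ = Equivalence.from (circuits _) (inj₁ (c , p∉))

  circuit₂ : ∀ {C} → IsCircuit M₂ C → p ∉ C → IsCircuit M C
  circuit₂ c p∉ = Equivalence.from (circuits _) (inj₂ (inj₁ (c , p∉)))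

  circuit-glue : ∀ {C₁ C₂} → IsCircuit M₁ C₁ → p ∈ C₁ → IsCircuit M₂ C₂ → p ∈ C₂ → IsCircuit M (glue C₁ C₂)
  circuit-glue c₁ p₁ c₂ p₂ = Equivalence.from (circuits _) (inj₂ (inj₂ (_ , _ , c₁ , p₁ , c₂ , p₂ , refl)))

  glueˡ : ∀ {C₁ C₂ x} → x ∈ C₁ → x ≢ p → x ∈ glue C₁ C₂
  glueˡ x∈ x≢ = -⁺ (∈∪ˡ x∈) x≢

  glueʳ : ∀ {C₁ C₂ x} → x ∈ C₂ → x ≢ p → x ∈ glue C₁ C₂
  glueʳ x∈ x≢ = -⁺ (∈∪ʳ x∈) x≢

  glue⁻ˡ : ∀ {C₁ C₂ x} → C₂ ⊆ E M₂ → x ∈ glue C₁ C₂ → x ∈ E M₁ → x ∈ C₁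
  glue⁻ˡ C₂⊆ x∈ x∈E with -⁻ x∈
  ... | x∈' , x≢p with ∪⁻ x∈'
  ... | inj₁ a = a
  ... | inj₂ b = contradiction (meet x∈E (C₂⊆ b)) x≢p

  Through₁ : Subset N → Fin N → Set
  Through₁ D x = (IsCircuit M₁ D × p ∉ D) ⊎
    ∃₂ λ C₁ C₂ → IsCircuit M₁ C₁ × p ∈ C₁ × IsCircuit M₂ C₂ × p ∈ C₂ × D ≡ glue C₁ C₂ × x ∈ C₁

  circuit-through₁ : ∀ {D x} → IsCircuit M D → x ∈ D → x ∈ E M₁ → Through₁ D x
  circuit-through₁ {D} {x} cD x∈ x∈E with Equivalence.to (circuits D) cD
  ... | inj₁ h = inj₁ h
  ... | inj₂ (inj₁ (c₂ , p∉)) = contradiction (subst (_∈ D) (meet x∈E (proj₁ c₂ x∈)) x∈) p∉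
  ... | inj₂ (inj₂ (C₁ , C₂ , c₁ , p₁ , c₂ , p₂ , refl)) =
    inj₂ (C₁ , C₂ , c₁ , p₁ , c₂ , p₂ , refl , glue⁻ˡ {C₁} {C₂} (proj₁ c₂) x∈ x∈E)

  private
    ∃circuit₂ : ∃ λ C₂ → IsCircuit M₂ C₂ × p ∈ C₂
    ∃circuit₂ = connected⇒circuit M₂ connected₂ size₂ p∈E₂

  -- The circuit of `M` closing `x` lies in `M₁` or is glued. In the second case its half in `M₁`
  -- also uses `p`, which is harmless because `p` already belongs to `C₁`.
  spans-glue⁻ : ∀ {C₁ C₂} → IsCircuit M₁ C₁ → p ∈ C₁ → IsCircuit M₂ C₂ → p ∈ C₂ →
    Spans M (glue C₁ C₂) → Spans M₁ C₁
  spans-glue⁻ {C₁} {C₂} c₁ p₁ c₂ p₂ sp x x∈ x∉ = go (sp x (ground₁ x∈ x≢p) x∉')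
    where
    x≢p : x ≢ p
    x≢p refl = x∉ p₁
    x∉' : x ∉ glue C₁ C₂
    x∉' h = x∉ (glue⁻ˡ {C₁} {C₂} (proj₁ c₂) h x∈)
    sub : ∀ {D z} → D ⊆ glue C₁ C₂ ∪ ⁅ x ⁆ → z ∈ D → z ∈ E M₁ → z ∈ C₁ ∪ ⁅ x ⁆
    sub D⊆ z∈ z∈E with insert⁻ (D⊆ z∈)
    ... | inj₁ h = ∈∪ˡ (glue⁻ˡ {C₁} {C₂} (proj₁ c₂) h z∈E)
    ... | inj₂ refl = insert-new
    go : _ → ∃ λ D → IsCircuit M₁ D × x ∈ D × D ⊆ C₁ ∪ ⁅ x ⁆
    go (D , cD , x∈D , D⊆) with circuit-through₁ cD x∈D x∈
    ... | inj₁ (cD₁ , _) = D , cD₁ , x∈D , λ z∈ → sub D⊆ z∈ (proj₁ cD₁ z∈)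
    ... | inj₂ (D₁ , D₂ , d₁ , _ , d₂ , _ , refl , x∈D₁) = D₁ , d₁ , x∈D₁ , sub'
      where
      sub' : D₁ ⊆ C₁ ∪ ⁅ x ⁆
      sub' {z} z∈ with z ≟ p
      ... | yes refl = ∈∪ˡ p₁
      ... | no z≢p = sub D⊆ (glueˡ z∈ z≢p) (proj₁ d₁ z∈)

  -- If the closing circuit in `M₁` uses `p`, then `C₂` is glued to it in place of `p`, adding
  -- nothing outside the glued circuit. Elements of `M₂` follow by exchanging the roles of the
  -- parts.
  spans-glue-half : ∀ {C₁ C₂} → p ∈ C₁ → IsCircuit M₂ C₂ → p ∈ C₂ → Spans M₁ C₁ →
    ∀ x → x ∈ E M₁ → x ≢ p → x ∉ glue C₁ C₂ → ∃ λ D → IsCircuit M D × x ∈ D × D ⊆ glue C₁ C₂ ∪ ⁅ x ⁆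
  spans-glue-half {C₁} {C₂} p₁ c₂ p₂ sp x x∈ x≢p x∉ with sp x x∈ (λ h → x∉ (glueˡ h x≢p))
  ... | D , cD , x∈D , D⊆ with p ∈? D
  ... | no p∉D = D , circuit₁ cD p∉D , x∈D , sub
    where
    sub : D ⊆ glue C₁ C₂ ∪ ⁅ x ⁆
    sub z∈ with insert⁻ (D⊆ z∈)
    ... | inj₁ a = ∈∪ˡ (glueˡ a λ { refl → p∉D z∈ })
    ... | inj₂ refl = insert-new
  ... | yes p∈D = glue D C₂ , circuit-glue cD p∈D c₂ p₂ , glueˡ x∈D x≢p , sub
    where
    sub : glue D C₂ ⊆ glue C₁ C₂ ∪ ⁅ x ⁆
    sub z∈ with -⁻ z∈
    ... | z∈' , z≢p with ∪⁻ z∈'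
    ... | inj₂ b = ∈∪ˡ (glueʳ b z≢p)
    ... | inj₁ a with insert⁻ (D⊆ a)
    ... | inj₁ a' = ∈∪ˡ (glueˡ a' z≢p)
    ... | inj₂ refl = insert-new

  circuitsSpan-split : ∀ {a b} → a ∈ E M₁ → a ≢ p → b ∈ E M₂ → b ≢ p → CircuitsSpan M a b → CircuitsSpan M₁ a p
  circuitsSpan-split a∈ a≢ b∈ b≢ q C₁ c₁ a∈C p∈C with connected₂ p _ p∈E₂ b∈ (b≢ ∘ sym)
  ... | C₂ , c₂ , p∈C₂ , b∈C₂ = spans-glue⁻ c₁ p∈C c₂ p∈C₂
    (q (glue C₁ C₂) (circuit-glue c₁ p∈C c₂ p∈C₂) (glueˡ a∈C a≢) (glueʳ b∈C₂ b≢))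

  -- p is in the closure of C₁, witnessed by any element of M₂ other than p.
  spans-avoid⁻ : ∀ {C} → IsCircuit M₁ C → p ∉ C → Spans M C → Spans M₁ C
  spans-avoid⁻ {C} c p∉ sp x x∈ x∉ with x ≟ p
  ... | no x≢p with sp x (ground₁ x∈ x≢p) x∉
  ... | D , cD , x∈D , D⊆ with circuit-through₁ cD x∈D x∈
  ... | inj₁ (cD₁ , _) = D , cD₁ , x∈D , D⊆
  ... | inj₂ (D₁ , D₂ , d₁ , _ , d₂ , _ , refl , x∈D₁) =
    ⊥-elim (connected⇒no-loop M₂ connected₂ size₂ d₂ D₂⊆)
    where
    D₂⊆ : D₂ ⊆ ⁅ p ⁆
    D₂⊆ {z} z∈ with z ≟ p
    ... | yes refl = x∈⁅x⁆ p
    ... | no z≢p = contradiction (meet (insert⊆ (proj₁ c) x∈ (D⊆ (glueʳ z∈ z≢p))) (proj₁ d₂ z∈)) z≢p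
  spans-avoid⁻ {C} c p∉ sp x x∈ x∉ | yes refl with ∃-third {p = E M₂} size₂ p p
  ... | y , y∈ , y≢p , _ with sp y (ground₂ y∈ y≢p) (λ y∈C → y≢p (meet (proj₁ c y∈C) y∈))
  ... | D , cD , y∈D , D⊆ with Equivalence.to (circuits D) cD
  ... | inj₁ (cD₁ , _) = contradiction (meet (proj₁ cD₁ y∈D) y∈) y≢p
  ... | inj₂ (inj₁ (cD₂ , p∉D)) = ⊥-elim (connected⇒no-loop M₂ connected₂ size₂ cD₂ D⊆y)
    where
    D⊆y : D ⊆ ⁅ y ⁆
    D⊆y z∈ with insert⁻ (D⊆ z∈)
    ... | inj₁ z∈C = contradiction (subst (_∈ D) (meet (proj₁ c z∈C) (proj₁ cD₂ z∈)) z∈) p∉D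
    ... | inj₂ refl = x∈⁅x⁆ y
  ... | inj₂ (inj₂ (D₁ , D₂ , d₁ , p₁ , d₂ , _ , refl)) = D₁ , d₁ , p₁ , sub
    where
    sub : D₁ ⊆ C ∪ ⁅ p ⁆
    sub {z} z∈ with z ≟ p
    ... | yes refl = insert-new
    ... | no z≢p with insert⁻ (D⊆ (glueˡ z∈ z≢p))
    ... | inj₁ a = ∈∪ˡ a
    ... | inj₂ refl = contradiction (meet (proj₁ d₁ z∈) y∈) y≢p

  bad₁₁ : ∀ {a b q} → a ∈ E M₁ → a ≢ p → b ∈ E M₁ → b ≢ p → q ∈ E M₁ → CircuitsSpanThrough M a b q → CircuitsSpanThrough M₁ a b q
  bad₁₁ {a} {b} {q} a∈ a≢ b∈ b≢ q∈ bad C c a∈C b∈C with p ∈? C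
  ... | no p∉ with bad C (circuit₁ c p∉) a∈C b∈C
  ... | q∈C , sp = q∈C , spans-avoid⁻ c p∉ sp
  bad₁₁ {a} {b} {q} a∈ a≢ b∈ b≢ q∈ bad C c a∈C b∈C | yes p∈ with ∃circuit₂
  ... | C₂ , c₂ , p∈₂ with bad (glue C C₂) (circuit-glue c p∈ c₂ p∈₂) (glueˡ a∈C a≢) (glueˡ b∈C b≢)
  ... | q∈C , sp = glue⁻ˡ {C} {C₂} (proj₁ c₂) q∈C q∈ , spans-glue⁻ c p∈ c₂ p∈₂ sp

  bad₁₂ : ∀ {a b q} → a ∈ E M₁ → a ≢ p → b ∈ E M₂ → b ≢ p → q ∈ E M₁ → CircuitsSpanThrough M a b q → CircuitsSpanThrough M₁ a p q
  bad₁₂ {a} {b} {q} a∈ a≢ b∈ b≢ q∈ bad C c a∈C p∈C with connected₂ p b p∈E₂ b∈ (b≢ ∘ sym)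
  ... | C₂ , c₂ , p∈₂ , b∈₂ with bad (glue C C₂) (circuit-glue c p∈C c₂ p∈₂) (glueˡ a∈C a≢) (glueʳ b∈₂ b≢)
  ... | q∈C , sp = glue⁻ˡ {C} {C₂} (proj₁ c₂) q∈C q∈ , spans-glue⁻ c p∈C c₂ p∈₂ sp

  -- A circuit of `M₂` through `a` and `b` must contain `p`, since otherwise it would have to
  -- contain `q`, which lies in the other part. Glued to it, any circuit of `M₁` through `p` is
  -- forced through `q`; hence `c` is arbitrary.
  bad₂₂ : ∀ {a b q} → a ∈ E M₂ → a ≢ p → b ∈ E M₂ → b ≢ p → a ≢ b → q ∈ E M₁ → q ≢ p →
    CircuitsSpanThrough M a b q → ∀ c → CircuitsSpanThrough M₁ p c q
  bad₂₂ {a} {b} {q} a∈ a≢ b∈ b≢ a≢b q∈ q≢ bad _ C c p∈C _ with connected₂ a b a∈ b∈ a≢b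
  ... | C₂ , c₂ , a∈₂ , b∈₂ with p ∈? C₂
  ... | no p∉₂ = contradiction (meet q∈ (proj₁ c₂ (proj₁ (bad C₂ (circuit₂ c₂ p∉₂) a∈₂ b∈₂)))) q≢
  ... | yes p∈₂ with bad (glue C C₂) (circuit-glue c p∈C c₂ p∈₂) (glueʳ a∈₂ a≢) (glueʳ b∈₂ b≢)
  ... | q∈C , sp = glue⁻ˡ {C} {C₂} (proj₁ c₂) q∈C q∈ , spans-glue⁻ c p∈C c₂ p∈₂ sp

  -- A member of the pair that lies in the other part is replaced by `p`. If both do, `p` is paired
  -- with any third element.
  bad-inherit : ∀ {q} → q ∈ E M₁ → q ≢ p → BadPair M q → BadPair M₁ q
  bad-inherit {q} q∈ q≢p (a , b , a∈ , b∈ , a≢b , a≢q , b≢q , bad) with ground⁻ a∈ | ground⁻ b∈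
  ... | inj₁ a₁ , a≢ | inj₁ b₁ , b≢ = a , b , a₁ , b₁ , a≢b , a≢q , b≢q , bad₁₁ a₁ a≢ b₁ b≢ q∈ bad
  ... | inj₁ a₁ , a≢ | inj₂ b₂ , b≢ = a , p , a₁ , p∈E₁ , a≢ , a≢q , q≢p ∘ sym , bad₁₂ a₁ a≢ b₂ b≢ q∈ bad
  ... | inj₂ a₂ , a≢ | inj₁ b₁ , b≢ = b , p , b₁ , p∈E₁ , b≢ , b≢q , q≢p ∘ sym ,
    bad₁₂ b₁ b≢ a₂ a≢ q∈ (λ C c x y → bad C c y x)
  ... | inj₂ a₂ , a≢ | inj₂ b₂ , b≢ with ∃-third {p = E M₁} size₁ p q
  ... | c , c∈ , c≢p , c≢q = p , c , p∈E₁ , c∈ , c≢p ∘ sym , q≢p ∘ sym , c≢q ,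
    bad₂₂ a₂ a≢ b₂ b≢ a≢b q∈ q≢p bad c

  indep₁ : ∀ {X} → X ⊆ E M₁ → p ∉ X → Matroid.Indep M X → Matroid.Indep M₁ X
  indep₁ {X} X⊆ p∉ i = decidable-stable (Matroid.Indep? M₁ X) λ d → go (dep⇒circuit M₁ X⊆ d)
    where
    go : ¬ (∃ λ C → IsCircuit M₁ C × C ⊆ X)
    go (C , c , C⊆) = proj₁ (proj₂ (circuit₁ c (λ z → p∉ (C⊆ z)))) (Matroid.hereditary M C⊆ i)

  whole-circuit₁ : IsCircuit M (E M) → IsCircuit M₁ (E M₁)
  whole-circuit₁ cE with ∃-third {p = E M₁} size₁ p p
  ... | x , x∈ , x≢p , _ with circuit-through₁ cE (ground₁ x∈ x≢p) x∈
  ... | inj₁ (c₁ , p∉) with ∃-third {p = E M₂} size₂ p p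
  ... | y , y∈ , y≢p , _ = contradiction (meet (proj₁ c₁ (ground₂ y∈ y≢p)) y∈) y≢p
  whole-circuit₁ cE | x , x∈ , x≢p , _ | inj₂ (C₁ , C₂ , c₁ , p₁ , c₂ , p₂ , eq , _) =
    subst (IsCircuit M₁) (⊆-antisym (proj₁ c₁) sub) c₁
    where
    sub : E M₁ ⊆ C₁
    sub {z} z∈ with z ≟ p
    ... | yes refl = p₁
    ... | no z≢p = glue⁻ˡ {C₁} {C₂} (proj₁ c₂) (subst (z ∈_) eq (ground₁ z∈ z≢p)) z∈

  -- If a circuit of M₁ through {a, b} avoided p, then it would span every element of M₂ through p only.
  same-side⇒bad : ∀ {a b} → a ∈ E M₁ → a ≢ p → b ∈ E M₁ → b ≢ p → NoParallel M₂ p → CircuitsSpan M a b → CircuitsSpanThrough M₁ a b p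
  same-side⇒bad {a} {b} a∈ a≢ b∈ b≢ np q C c a∈C b∈C with p ∈? C
  ... | yes p∈ with ∃circuit₂
  ... | C₂ , c₂ , p∈₂ = p∈ , spans-glue⁻ c p∈ c₂ p∈₂
        (q (glue C C₂) (circuit-glue c p∈ c₂ p∈₂) (glueˡ a∈C a≢) (glueˡ b∈C b≢))
  same-side⇒bad {a} {b} a∈ a≢ b∈ b≢ np q C c a∈C b∈C | no p∉
    with ∃-third {p = E M₂} size₂ p p
  ... | y , y∈ , y≢p , _ with ∃-third {p = E M₂} size₂ p y
  -- Both `y` and `z` turn out to be parallel to `p`, yet augmenting `⁅ p ⁆` from the independent
  -- pair must succeed with one of them.
  ... | z , z∈ , z≢p , z≢y = ⊥-elim (go (Matroid.augment M₂ ip (np y z y∈ z∈ y≢p z≢p (z≢y ∘ sym)) lt))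
    where
    sp = q C (circuit₁ c p∉) a∈C b∈C
    parallel : ∀ w → w ∈ E M₂ → w ≢ p → ¬ Matroid.Indep M₂ (⁅ p ⁆ ∪ ⁅ w ⁆)
    parallel w w∈ w≢p i with sp w (ground₂ w∈ w≢p) (λ h → w≢p (meet (proj₁ c h) w∈))
    ... | D , cD , w∈D , D⊆ with Equivalence.to (circuits D) cD
    ... | inj₁ (cD₁ , _) = w≢p (meet (proj₁ cD₁ w∈D) w∈)
    ... | inj₂ (inj₁ (cD₂ , p∉D)) = connected⇒no-loop M₂ connected₂ size₂ cD₂ D⊆w
      where
      D⊆w : D ⊆ ⁅ w ⁆
      D⊆w h with insert⁻ (D⊆ h)
      ... | inj₁ h∈C = contradiction (subst (_∈ D) (meet (proj₁ c h∈C) (proj₁ cD₂ h)) h) p∉D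
      ... | inj₂ refl = x∈⁅x⁆ w
    ... | inj₂ (inj₂ (D₁ , D₂ , d₁ , p₁ , d₂ , _ , refl)) = proj₁ (proj₂ d₂) (Matroid.hereditary M₂ sub i)
      where
      sub : D₂ ⊆ ⁅ p ⁆ ∪ ⁅ w ⁆
      sub {v} v∈ with v ≟ p
      ... | yes refl = pairˡ
      ... | no v≢p with insert⁻ (D⊆ (glueʳ v∈ v≢p))
      ... | inj₁ h = contradiction (meet (proj₁ c h) (proj₁ d₂ v∈)) v≢p
      ... | inj₂ refl = insert-new
    ip : Matroid.Indep M₂ ⁅ p ⁆
    ip = decidable-stable (Matroid.Indep? M₂ ⁅ p ⁆) λ d →
      let (D , cD , D⊆) = dep⇒circuit M₂ (λ h → subst (_∈ E M₂) (sym (x∈⁅y⁆⇒x≡y p h)) p∈E₂) d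
      in connected⇒no-loop M₂ connected₂ size₂ cD D⊆
    lt : ∣ ⁅ p ⁆ ∣ < ∣ pair y z ∣
    lt = ℕ.≤-reflexive (trans (cong suc (∣⁅x⁆∣≡1 p)) (sym (∣pair∣ (z≢y ∘ sym))))
    go : ¬ (∃ λ w → w ∈ pair y z × w ∉ ⁅ p ⁆ × Matroid.Indep M₂ (⁅ p ⁆ ∪ ⁅ w ⁆))
    go (w , w∈ , _ , i) with pair⁻ w∈
    ... | inj₁ refl = parallel y y∈ y≢p i
    ... | inj₂ refl = parallel z z∈ z≢p i

  -- Up to relabelling `p`, a part is a minor of `M` and therefore binary. Transferring the cycles
  -- directly avoids forming the minor and representing it anew.
  cycleSpace₁ : CycleSpace M → CycleSpace M₁
  cycleSpace₁ B with ∃circuit₂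
  ... | C₂ , c₂ , p∈₂ = record
    { Cyc = λ X → X ⊆ E M₁ × B.Cyc (lift X)
    ; Cyc⇒⊆ = λ c {x} → proj₁ c {x}
    ; Cyc-⊕ = λ {X} {Y} cX cY → (λ {x} → ⊕⊆ (proj₁ cX) (proj₁ cY) {x}) ,
                subst B.Cyc (lift-⊕ X Y) (B.Cyc-⊕ (proj₂ cX) (proj₂ cY))
    ; Cyc⇒dep = λ {X} → dep X
    ; dep⇒Cyc = λ {X} X⊆ d → findCycle X X⊆ d
    }
    where
    module B = CycleSpace B
    -- p is traded for the rest of the circuit C₂.
    lift : Subset N → Subset N
    lift X with p ∈? X
    ... | yes _ = X ⊕ C₂
    ... | no _ = X

    lift-∈ : ∀ {X} → p ∈ X → lift X ≡ X ⊕ C₂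
    lift-∈ {X} p∈ with p ∈? X
    ... | yes _ = refl
    ... | no p∉ = contradiction p∈ p∉

    lift-∉ : ∀ {X} → p ∉ X → lift X ≡ X
    lift-∉ {X} p∉ with p ∈? X
    ... | yes p∈ = contradiction p∈ p∉
    ... | no _ = refl

    swap : ∀ (X Y : Subset N) → (X ⊕ C₂) ⊕ Y ≡ (X ⊕ Y) ⊕ C₂
    swap X Y = trans (⊕-assoc X C₂ Y) (trans (cong (X ⊕_) (⊕-comm C₂ Y)) (sym (⊕-assoc X Y C₂)))

    lift-⊕ : ∀ X Y → lift X ⊕ lift Y ≡ lift (X ⊕ Y)
    lift-⊕ X Y with p ∈? X | p ∈? Y
    ... | yes a | yes b = trans (swap X (Y ⊕ C₂)) (trans (cong (_⊕ C₂) (sym (⊕-assoc X Y C₂)))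
                            (trans (⊕-cancelʳ (X ⊕ Y) C₂) (sym (lift-∉ (⊕∉₂ a b)))))
    ... | yes a | no b = trans (swap X Y) (sym (lift-∈ (⊕⁺ˡ a b)))
    ... | no a | yes b = trans (sym (⊕-assoc X Y C₂)) (sym (lift-∈ (⊕⁺ʳ a b)))
    ... | no a | no b = sym (lift-∉ (⊕∉₀ a b))

    in-lift : ∀ {X x} → x ∈ lift X → x ∈ E M₁ → x ≢ p → x ∈ X
    in-lift {X} x∈ x∈E x≢p with p ∈? X
    ... | no _ = x∈
    ... | yes _ with ⊕⁻ x∈
    ... | inj₁ (h , _) = h
    ... | inj₂ (_ , h) = contradiction (meet x∈E (proj₁ c₂ h)) x≢p

    in-lift₂ : ∀ {X x} → X ⊆ E M₁ → x ∈ lift X → x ∈ E M₂ → x ≢ p → x ∈ C₂ × p ∈ X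
    in-lift₂ {X} X⊆ x∈ x∈E x≢p with p ∈? X
    ... | no _ = contradiction (meet (X⊆ x∈) x∈E) x≢p
    ... | yes p∈ with ⊕⁻ x∈
    ... | inj₁ (h , _) = contradiction (meet (X⊆ h) x∈E) x≢p
    ... | inj₂ (_ , h) = h , p∈

    lift-nonempty : ∀ X → X ⊆ E M₁ → Nonempty X → Nonempty (lift X)
    lift-nonempty X X⊆ ne with p ∈? X
    ... | no _ = ne
    ... | yes p∈ with ⊆⊎∃ C₂ ⁅ p ⁆
    ... | inj₁ sub = ⊥-elim (connected⇒no-loop M₂ connected₂ size₂ c₂ sub)
    ... | inj₂ (w , w∈ , w∉) = w , ⊕⁺ʳ (λ h → w∉ (subst (_∈ ⁅ p ⁆) (sym (meet (X⊆ h) (proj₁ c₂ w∈))) (x∈⁅x⁆ p))) w∈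

    -- A circuit of `M` inside `lift X` yields a circuit of `M₁` inside `X`: the circuit itself, or
    -- the `M₁` half of a glued one. A circuit of `M₂` avoiding `p` cannot occur, as it would be
    -- properly contained in `C₂`.
    dep : ∀ X → X ⊆ E M₁ × B.Cyc (lift X) → Nonempty X → ¬ Matroid.Indep M₁ X
    dep X (X⊆ , cX) ne i with B.Cyc⇒circuit cX (lift-nonempty X X⊆ ne)
    ... | C , cC , C⊆ with Equivalence.to (circuits C) cC
    ... | inj₁ (c₁ , p∉) = proj₁ (proj₂ c₁) (Matroid.hereditary M₁
            (λ h → in-lift (C⊆ h) (proj₁ c₁ h) λ { refl → p∉ h }) i)
    ... | inj₂ (inj₁ (c , p∉)) = proj₁ (proj₂ c)
            (circuit-indep M₂ c₂ (λ h → proj₁ (in-lift₂ X⊆ (C⊆ h) (proj₁ c h) λ { refl → p∉ h })) p∈₂ p∉)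
    ... | inj₂ (inj₂ (D₁ , D₂ , d₁ , p₁ , d₂ , p₂ , refl)) = proj₁ (proj₂ d₁) (Matroid.hereditary M₁ sub i)
      where
      p∈X : p ∈ X
      p∈X with ⊆⊎∃ D₂ ⁅ p ⁆
      ... | inj₁ D₂⊆ = ⊥-elim (connected⇒no-loop M₂ connected₂ size₂ d₂ D₂⊆)
      ... | inj₂ (w , w∈ , w∉) = proj₂ (in-lift₂ X⊆ (C⊆ (glueʳ w∈ w≢p)) (proj₁ d₂ w∈) w≢p)
        where
        w≢p : w ≢ p
        w≢p refl = w∉ (x∈⁅x⁆ p)
      sub : D₁ ⊆ X
      sub {z} z∈ with z ≟ p
      ... | yes refl = p∈X
      ... | no z≢p = in-lift (C⊆ (glueˡ z∈ z≢p)) (proj₁ d₁ z∈) z≢p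

    findCycle : ∀ X → X ⊆ E M₁ → ¬ Matroid.Indep M₁ X → ∃ λ Y → Y ⊆ X × Nonempty Y × (Y ⊆ E M₁ × B.Cyc (lift Y))
    findCycle X X⊆ d with dep⇒circuit M₁ X⊆ d
    ... | C , c , C⊆ = C , (λ {x} → C⊆ {x}) , circuit-nonempty M₁ c , (λ {x} → proj₁ c {x}) , cyc
      where
      cyc : B.Cyc (lift C)
      cyc with p ∈? C
      ... | no p∉ = B.circuit⇒Cyc (circuit₁ c p∉)
      ... | yes p∈ = subst B.Cyc (⊆-antisym sub sup) (B.circuit⇒Cyc (circuit-glue c p∈ c₂ p∈₂))
        where
        sub : glue C C₂ ⊆ C ⊕ C₂
        sub h with -⁻ h
        ... | h' , z≢p with ∪⁻ h'
        ... | inj₁ a = ⊕⁺ˡ a λ b → z≢p (meet (proj₁ c a) (proj₁ c₂ b))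
        ... | inj₂ b = ⊕⁺ʳ (λ a → z≢p (meet (proj₁ c a) (proj₁ c₂ b))) b
        sup : C ⊕ C₂ ⊆ glue C C₂
        sup h with ⊕⁻ h
        ... | inj₁ (a , b) = glueˡ a λ { refl → b p∈₂ }
        ... | inj₂ (a , b) = glueʳ b λ { refl → a p∈ }

-- If C ∋ p is a circuit and x ∉ C, then C ∪ {x} contains a circuit through p that misses at least two
-- elements of C, and such a circuit cannot span.
spanning⇒whole-circuit : ∀ (M : Matroid N) {p} → CycleSpace M → Connected M → 3 ≤ ∣ E M ∣ → NoParallel M p → p ∈ E M →
  (∀ C → IsCircuit M C → p ∈ C → Spans M C) → IsCircuit M (E M)
spanning⇒whole-circuit {N = N} M {p} B con size np p∈E sp with connected⇒circuit M con size p∈E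
... | C , cC , p∈C with ⊆⊎∃ (E M) C
... | inj₁ E⊆C = subst (IsCircuit M) (⊆-antisym (proj₁ cC) E⊆C) cC
... | inj₂ (x , x∈E , x∉C) = ⊥-elim absurd
  where
  module B = CycleSpace B
  x≢p : x ≢ p
  x≢p refl = x∉C p∈C
  T : ∃ λ T → B.Cyc T × x ∈ T × p ∈ T × T ⊆ C ∪ ⁅ x ⁆
  -- Exactly one of the cycles `D` and `D ⊕ C` contains `p`, and both contain `x`.
  T with sp C cC p∈C x x∈E x∉C
  ... | D , cD , x∈D , D⊆ with p ∈? D
  ... | yes p∈D = D , B.circuit⇒Cyc cD , x∈D , p∈D , λ {z} → D⊆ {z}
  ... | no p∉D = D ⊕ C , B.Cyc-⊕ (B.circuit⇒Cyc cD) (B.circuit⇒Cyc cC) , ⊕⁺ˡ x∈D x∉C , ⊕⁺ʳ p∉D p∈C ,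
                 λ {z} → ⊕⊆ D⊆ ∈∪ˡ {z}
  absurd : False
  absurd with T
  ... | T , cT , x∈T , p∈T , T⊆ with ∃-third {p = E M} size p x
  ... | y , y∈E , y≢p , y≢x = go
    where
    cTC = B.Cyc-⊕ cT (B.circuit⇒Cyc cC)
    dep : ∀ {y} → T ⊕ C ⊆ pair x y → ¬ Matroid.Indep M (pair x y)
    dep sub i = B.Cyc⇒dep cTC (x , ⊕⁺ˡ x∈T x∉C) (Matroid.hereditary M sub i)
    go : False
    go with B.theta-short cC x∉C cT x∈T T⊆ (λ c → sp T c p∈T)
    ... | inj₂ (c , c∈C , c∉T , sub) = dep sub (np x c x∈E (proj₁ cC c∈C) x≢p (λ { refl → c∉T p∈T }) λ { refl → x∉C c∈C })
    ... | inj₁ C⊆T = dep sub (np x y x∈E y∈E x≢p y≢p (y≢x ∘ sym))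
      where
      sub : T ⊕ C ⊆ pair x y
      sub z∈ with ⊕⁻ z∈
      ... | inj₂ (z∉T , z∈C) = contradiction (C⊆T z∈C) z∉T
      ... | inj₁ (z∈T , z∉C) with insert⁻ (T⊆ z∈T)
      ... | inj₁ z∈C = contradiction z∈C z∉C
      ... | inj₂ refl = pairˡ

module _ {p : Fin N} {M₁ M₂ M : Matroid N} (s : Is2Sum p M₁ M₂ M) where
  private
    module S = TwoSum s
    module S′ = TwoSum (twoSum-sym s)

    glue-comm : ∀ C₁ C₂ → S.glue C₁ C₂ ≡ S′.glue C₂ C₁
    glue-comm C₁ C₂ = cong (_- p) (∪-comm C₁ C₂)

  -- Some circuit of `M₁` runs through `a` and `b`, hence through `p`. It can be glued to every
  -- circuit of `M₂` through `p`, and the result spans by hypothesis; so all those circuits of `M₂`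
  -- span, which leaves only a whole circuit.
  same-side : ∀ {a b} → a ∈ E M₁ → a ≢ p → b ∈ E M₁ → b ≢ p → a ≢ b → NoParallel M₂ p → CycleSpace M₂ →
    CircuitsSpan M a b → IsCircuit M₂ (E M₂) × CircuitsSpanThrough M₁ a b p
  same-side {a} {b} a∈ a≢ b∈ b≢ a≢b np B q =
    spanning⇒whole-circuit M₂ B S.connected₂ S.size₂ np S.p∈E₂ sp , bad
    where
    bad = S.same-side⇒bad a∈ a≢ b∈ b≢ np q
    sp : ∀ C → IsCircuit M₂ C → p ∈ C → Spans M₂ C
    sp C₂ c₂ p∈₂ with S.connected₁ a b a∈ b∈ a≢b
    ... | C₁ , c₁ , a∈C , b∈C with proj₁ (bad C₁ c₁ a∈C b∈C)
    ... | p∈₁ = S′.spans-glue⁻ c₂ p∈₂ c₁ p∈₁ (subst (Spans M) (glue-comm C₁ C₂)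
          (q _ (S.circuit-glue c₁ p∈₁ c₂ p∈₂) (S.glueˡ a∈C a≢) (S.glueˡ b∈C b≢)))

  circuitsSpan-splitˡ : ∀ {a b} → a ∈ E M₁ → a ≢ p → b ∈ E M₂ → b ≢ p → CircuitsSpan M a b → CircuitsSpan M₁ a p
  circuitsSpan-splitˡ = S.circuitsSpan-split

  circuitsSpan-splitʳ : ∀ {a b} → a ∈ E M₁ → a ≢ p → b ∈ E M₂ → b ≢ p → CircuitsSpan M a b → CircuitsSpan M₂ p b
  circuitsSpan-splitʳ a∈ a≢ b∈ b≢ q = circuitsSpan-sym {M = M₂} (S′.circuitsSpan-split b∈ b≢ a∈ a≢ (circuitsSpan-sym {M = M} q))

  circuitsSpan-glue : ∀ {a b} → a ∈ E M₁ → b ∈ E M₂ → CircuitsSpan M₁ a p → CircuitsSpan M₂ p b → CircuitsSpan M a b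
  circuitsSpan-glue {a} {b} a∈ b∈ q₁ q₂ C cC a∈C b∈C with S.circuit-through₁ cC a∈C a∈
  ... | inj₁ (c₁ , p∉) = contradiction (subst (_∈ C) (S.meet (proj₁ c₁ b∈C) b∈) b∈C) p∉
  ... | inj₂ (C₁ , C₂ , c₁ , p₁ , c₂ , p₂ , refl , a∈C₁) = sp
    where
    b∈C₂ : b ∈ C₂
    b∈C₂ = S′.glue⁻ˡ {C₂} {C₁} (proj₁ c₁) (subst (b ∈_) (glue-comm C₁ C₂) b∈C) b∈
    sp : Spans M (S.glue C₁ C₂)
    sp x x∈ x∉ with S.ground⁻ x∈
    ... | inj₁ x∈₁ , x≢p = S.spans-glue-half p₁ c₂ p₂ (q₁ C₁ c₁ a∈C₁ p₁) x x∈₁ x≢p x∉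
    ... | inj₂ x∈₂ , x≢p = subst (λ G → ∃ λ D → IsCircuit M D × x ∈ D × D ⊆ G ∪ ⁅ x ⁆) (sym (glue-comm C₁ C₂))
      (S′.spans-glue-half p₂ c₁ p₁ (q₂ C₂ c₂ p₂ b∈C₂) x x∈₂ x≢p (x∉ ∘ subst (x ∈_) (sym (glue-comm C₁ C₂))))

-- Contractions

≈-sym : ∀ {M M′ : Matroid N} → M ≈ M′ → M′ ≈ M
≈-sym (e , i) = sym e , λ X → mk⇔ (Equivalence.from (i X)) (Equivalence.to (i X))

module _ {M M′ : Matroid N} (M≈M′ : M ≈ M′) where
  private
    e = proj₁ M≈M′
    i = proj₂ M≈M′

  circuit-≈ : ∀ {C} → IsCircuit M C → IsCircuit M′ C
  circuit-≈ {C} (C⊆ , d , min) =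
    (λ {x} → subst (C ⊆_) e C⊆ {x}) , (λ h → d (Equivalence.from (i C) h)) , λ D D⊂ → Equivalence.to (i D) (min D D⊂)

  spans-≈ : ∀ {C} → Spans M C → Spans M′ C
  spans-≈ sp x x∈ x∉ with sp x (subst (x ∈_) (sym e) x∈) x∉
  ... | D , cD , x∈D , D⊆ = D , circuit-≈ cD , x∈D , λ {z} → D⊆ {z}

  cycleSpace-≈ : CycleSpace M → CycleSpace M′
  cycleSpace-≈ B = record
    { Cyc = B.Cyc
    ; Cyc⇒⊆ = λ {X} c {x} → subst (X ⊆_) e (B.Cyc⇒⊆ c) {x}
    ; Cyc-⊕ = B.Cyc-⊕
    ; Cyc⇒dep = λ c ne h → B.Cyc⇒dep c ne (Equivalence.from (i _) h)
    ; dep⇒Cyc = λ {X} X⊆ d → B.dep⇒Cyc (subst (X ⊆_) (sym e) X⊆) (λ h → d (Equivalence.to (i X) h))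
    }
    where module B = CycleSpace B

module _ {M M′ : Matroid N} (M≈M′ : M ≈ M′) where
  private
    e = proj₁ M≈M′
    i = proj₂ M≈M′

  circuitsSpan-≈ : ∀ {a b} → CircuitsSpan M a b → CircuitsSpan M′ a b
  circuitsSpan-≈ q C c a∈ b∈ = spans-≈ {M = M} {M′} M≈M′ (q C (circuit-≈ {M = M′} {M} (≈-sym {M = M} {M′} M≈M′) c) a∈ b∈)

  badPair-≈ : ∀ {q} → BadPair M q → BadPair M′ q
  badPair-≈ {q} (a , b , a∈ , b∈ , a≢b , a≢q , b≢q , bad) =
    a , b , subst (a ∈_) e a∈ , subst (b ∈_) e b∈ , a≢b , a≢q , b≢q , λ C c x y →
      let (q∈ , sp) = bad C (circuit-≈ {M = M′} {M} (≈-sym {M = M} {M′} M≈M′) c) x y in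
      q∈ , spans-≈ {M = M} {M′} M≈M′ sp

-- The facts about names and ends that survive a contraction. They let adjacency be recovered from
-- elements shared by labels.
record WellFormed (G : LabelledGraph N k m) : Set where
  end₁ : Fin m → Fin k
  end₁ = λ ε → proj₁ (graph G ε)
  end₂ : Fin m → Fin k
  end₂ = λ ε → proj₂ (graph G ε)
  field
    name-injective : ∀ {ε ε′} → name G ε ≡ name G ε′ → ε ≡ ε′
    ends-distinct  : ∀ ε → end₁ ε ≢ end₂ ε
    name∈end₁      : ∀ ε → name G ε ∈ E (label G (end₁ ε))
    name∈end₂      : ∀ ε → name G ε ∈ E (label G (end₂ ε))
    name∈⇒end      : ∀ ε i → name G ε ∈ E (label G i) → i ≡ end₁ ε ⊎ i ≡ end₂ ε
    shared⇒name    : ∀ {i j a} → i ≢ j → a ∈ E (label G i) → a ∈ E (label G j) → ∃ λ ε → name G ε ≡ a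

NotName : LabelledGraph N k m → Fin N → Set
NotName G a = ∀ ε → name G ε ≢ a

-- A canonical decomposition has no such edge, and contractions do not create one.
NoBadCircuit : LabelledGraph N k m → Set
NoBadCircuit G = ∀ ε x u → Joins (graph G) ε x u → IsCircuit (label G x) (E (label G x)) → ¬ BadPair (label G u) (name G ε)

-- The trace of simplicity of `M` on the labels. It compares only elements that are not names, since
-- a basepoint may well be parallel to other elements, as in a label `U 1 3`.
NoParallelPair : LabelledGraph N k m → Set
NoParallelPair G = ∀ i x y → x ∈ E (label G i) → y ∈ E (label G i) → NotName G x → NotName G y → x ≢ y →
  Matroid.Indep (label G i) (pair x y)

module Contract {N k m} {G : LabelledGraph N (suc k) (suc m)} {H : LabelledGraph N k m}
                (con : Contraction G H) (wf : WellFormed G) where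
  open Contraction con public
  open WellFormed wf public

  p : Fin N
  p = name G edge
  w : Fin k
  w = π u

  module S = TwoSum composite
  module S′ = TwoSum (twoSum-sym composite)

  πv≡w : π v ≡ w
  πv≡w = Equivalence.from (π-identifies v u) (inj₂ (inj₂ (refl , refl)))

  π-fibre-w : ∀ {i} → π i ≡ w → i ≡ u ⊎ i ≡ v
  π-fibre-w {i} eq with Equivalence.to (π-identifies i u) eq
  ... | inj₁ i≡u = inj₁ i≡u
  ... | inj₂ (inj₁ (i≡u , _)) = inj₁ i≡u
  ... | inj₂ (inj₂ (i≡v , _)) = inj₂ i≡v

  π-injective-off : ∀ {i j} → i ≢ u → i ≢ v → π i ≡ π j → i ≡ j
  π-injective-off {i} {j} i≢u i≢v eq with Equivalence.to (π-identifies i j) eq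
  ... | inj₁ e = e
  ... | inj₂ (inj₁ (e , _)) = contradiction e i≢u
  ... | inj₂ (inj₂ (e , _)) = contradiction e i≢v

  σ : Fin k → Fin (suc k)
  σ j = proj₁ (π-surjective j)

  πσ : ∀ j → π (σ j) ≡ j
  πσ j = proj₂ (π-surjective j) refl

  data Position (i : Fin (suc k)) : Set where
    is-u  : i ≡ u → Position i
    is-v  : i ≡ v → Position i
    other : i ≢ u → i ≢ v → Position i

  position : ∀ i → Position i
  position i with i ≟ u | i ≟ v
  ... | yes a | _ = is-u a
  ... | no _ | yes b = is-v b
  ... | no a | no b = other a b

  p∈⇒end : ∀ {i} → p ∈ E (label G i) → i ≡ u ⊎ i ≡ v
  p∈⇒end = name∈⇒end edge _

  label-other : ∀ {i} → i ≢ u → i ≢ v → label H (π i) ≈ label G i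
  label-other = label-H _

  up : ∀ {i a} → a ∈ E (label G i) → a ≢ p → a ∈ E (label H (π i))
  up {i} {a} a∈ a≢p with position i
  ... | is-u refl = S.ground₁ a∈ a≢p
  ... | is-v refl = subst (λ j → a ∈ E (label H j)) (sym πv≡w) (S.ground₂ a∈ a≢p)
  ... | other i≢u i≢v = subst (a ∈_) (sym (proj₁ (label-other i≢u i≢v))) a∈

  down : ∀ {j a} → a ∈ E (label H j) → ∃ λ i → π i ≡ j × a ∈ E (label G i) × a ≢ p
  down {j} {a} a∈ with position (σ j)
  ... | other i≢u i≢v = σ j , πσ j , a∈′ , λ { refl → go (p∈⇒end a∈′) }
    where
    a∈′ : a ∈ E (label G (σ j))
    a∈′ = subst (a ∈_) (proj₁ (label-other i≢u i≢v)) (subst (λ j → a ∈ E (label H j)) (sym (πσ j)) a∈)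
    go : ¬ (σ j ≡ u ⊎ σ j ≡ v)
    go (inj₁ e) = i≢u e
    go (inj₂ e) = i≢v e
  ... | is-u e = lemma (trans (sym (πσ j)) (cong π e))
    where
    lemma : j ≡ w → _
    lemma refl with S.ground⁻ a∈
    ... | inj₁ h , a≢p = u , refl , h , a≢p
    ... | inj₂ h , a≢p = v , πv≡w , h , a≢p
  ... | is-v e = lemma (trans (sym (πσ j)) (trans (cong π e) πv≡w))
    where
    lemma : j ≡ w → _
    lemma refl with S.ground⁻ a∈
    ... | inj₁ h , a≢p = u , refl , h , a≢p
    ... | inj₂ h , a≢p = v , πv≡w , h , a≢p

  name-H≢p : ∀ ε → name H ε ≢ p
  name-H≢p ε eq = punchInᵢ≢i edge ε (name-injective (trans (sym (name-H ε)) eq))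

  name-lift : ∀ ε → name G ε ≢ p → ∃ λ ε′ → name H ε′ ≡ name G ε
  name-lift ε ε≢p = punchOut edge≢ε , trans (name-H _) (cong (name G) (punchIn-punchOut edge≢ε))
    where
    edge≢ε : edge ≢ ε
    edge≢ε refl = ε≢p refl

  notName⁺ : ∀ {a} → NotName G a → NotName H a
  notName⁺ nn ε eq = nn (punchIn edge ε) (trans (sym (name-H ε)) eq)

  private
    endᴴ₁ : ∀ ε → proj₁ (graph H ε) ≡ π (end₁ (punchIn edge ε))
    endᴴ₁ ε = cong proj₁ (graph-H ε)
    endᴴ₂ : ∀ ε → proj₂ (graph H ε) ≡ π (end₂ (punchIn edge ε))
    endᴴ₂ ε = cong proj₂ (graph-H ε)

  wellFormed-H : WellFormed H
  wellFormed-H = record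
    { name-injective = λ {ε} {ε′} eq → punchIn-injective edge ε ε′
        (name-injective (trans (sym (name-H ε)) (trans eq (name-H ε′))))
    ; ends-distinct = distinct
    ; name∈end₁ = λ ε → subst (λ j → name H ε ∈ E (label H j)) (sym (endᴴ₁ ε))
        (up (subst (λ a → a ∈ E (label G (end₁ (punchIn edge ε)))) (sym (name-H ε)) (name∈end₁ _)) (name-H≢p ε))
    ; name∈end₂ = λ ε → subst (λ j → name H ε ∈ E (label H j)) (sym (endᴴ₂ ε))
        (up (subst (λ a → a ∈ E (label G (end₂ (punchIn edge ε)))) (sym (name-H ε)) (name∈end₂ _)) (name-H≢p ε))
    ; name∈⇒end = ends
    ; shared⇒name = shared
    }
    where
    -- Parallel edges would both be named by the single common element of the two labels.
    distinct : ∀ ε → proj₁ (graph H ε) ≢ proj₂ (graph H ε)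
    distinct ε eq with Equivalence.to (π-identifies _ _) (trans (sym (endᴴ₁ ε)) (trans eq (endᴴ₂ ε)))
    ... | inj₁ e = ends-distinct _ e
    ... | inj₂ (inj₁ (e₁ , e₂)) = name-H≢p ε (trans (name-H ε) (S.meet
      (subst (λ i → name G (punchIn edge ε) ∈ E (label G i)) e₁ (name∈end₁ _))
      (subst (λ i → name G (punchIn edge ε) ∈ E (label G i)) e₂ (name∈end₂ _))))
    ... | inj₂ (inj₂ (e₁ , e₂)) = name-H≢p ε (trans (name-H ε) (S.meet
      (subst (λ i → name G (punchIn edge ε) ∈ E (label G i)) e₂ (name∈end₂ _))
      (subst (λ i → name G (punchIn edge ε) ∈ E (label G i)) e₁ (name∈end₁ _))))
    ends : ∀ ε j → name H ε ∈ E (label H j) → j ≡ proj₁ (graph H ε) ⊎ j ≡ proj₂ (graph H ε)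
    ends ε j h with down h
    ... | i , refl , h′ , _ with name∈⇒end (punchIn edge ε) i (subst (_∈ E (label G i)) (name-H ε) h′)
    ... | inj₁ e = inj₁ (trans (cong π e) (sym (endᴴ₁ ε)))
    ... | inj₂ e = inj₂ (trans (cong π e) (sym (endᴴ₂ ε)))
    shared : ∀ {i j a} → i ≢ j → a ∈ E (label H i) → a ∈ E (label H j) → ∃ λ ε → name H ε ≡ a
    shared i≢j a∈ a∈′ with down a∈ | down a∈′
    ... | i , refl , h , a≢p | j , refl , h′ , _ with shared⇒name (i≢j ∘ cong π) h h′
    ... | ε , refl = name-lift ε a≢p

  badPair-down : ∀ {i q} → q ∈ E (label G i) → q ≢ p → BadPair (label H (π i)) q → BadPair (label G i) q
  badPair-down {i} q∈ q≢p b with position i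
  ... | is-u refl = S.bad-inherit q∈ q≢p b
  ... | is-v refl = S′.bad-inherit q∈ q≢p (subst (λ j → BadPair (label H j) _) πv≡w b)
  ... | other i≢u i≢v = badPair-≈ {M = label H (π i)} {label G i} (label-other i≢u i≢v) b

  whole-circuit-down : ∀ {i} → IsCircuit (label H (π i)) (E (label H (π i))) → IsCircuit (label G i) (E (label G i))
  whole-circuit-down {i} c with position i
  ... | is-u refl = S.whole-circuit₁ c
  ... | is-v refl = S′.whole-circuit₁ (subst (λ j → IsCircuit (label H j) (E (label H j))) πv≡w c)
  ... | other i≢u i≢v = subst (IsCircuit (label G i)) (proj₁ (label-other i≢u i≢v))
                          (circuit-≈ {M = label H (π i)} {label G i} (label-other i≢u i≢v) c)

  cycleSpace-down : (∀ j → CycleSpace (label H j)) → ∀ i → CycleSpace (label G i)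
  cycleSpace-down B i with position i
  ... | is-u refl = S.cycleSpace₁ (B w)
  ... | is-v refl = S′.cycleSpace₁ (B w)
  ... | other i≢u i≢v = cycleSpace-≈ {M = label H (π i)} {label G i} (label-other i≢u i≢v) (B (π i))

  noParallelPair-down : NoParallelPair H → NoParallelPair G
  noParallelPair-down np i x y x∈ y∈ nx ny x≢y with position i
  ... | is-u refl = S.indep₁ (pair⊆ x∈ y∈) p∉ (np w x y (up x∈ x≢p) (up y∈ y≢p) (notName⁺ nx) (notName⁺ ny) x≢y)
    where
    x≢p = nx edge ∘ sym
    y≢p = ny edge ∘ sym
    p∉ : p ∉ pair x y
    p∉ h = [ nx edge , ny edge ]′ (pair⁻ h)
  ... | is-v refl = S′.indep₁ (pair⊆ x∈ y∈) p∉
      (np w x y (S.ground₂ x∈ x≢p) (S.ground₂ y∈ y≢p) (notName⁺ nx) (notName⁺ ny) x≢y)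
    where
    x≢p = nx edge ∘ sym
    y≢p = ny edge ∘ sym
    p∉ : p ∉ pair x y
    p∉ h = [ nx edge , ny edge ]′ (pair⁻ h)
  ... | other i≢u i≢v = Equivalence.to (proj₂ (label-other i≢u i≢v) (pair x y))
      (np (π i) x y (up x∈ (nx edge ∘ sym)) (up y∈ (ny edge ∘ sym)) (notName⁺ nx) (notName⁺ ny) x≢y)

  -- A violation in `H` descends to the same edge of `G`: a composite that is a whole circuit has
  -- whole circuits as parts, and a bad pair of a composite passes to the part containing the name.
  noBadCircuit-H : NoBadCircuit G → NoBadCircuit H
  noBadCircuit-H nb ε x y (inj₁ eq) c b =
    nb (punchIn edge ε) _ _ (inj₁ refl)
      (whole-circuit-down (subst (λ j → IsCircuit (label H j) (E (label H j))) (trans (sym (cong proj₁ eq)) (endᴴ₁ ε)) c))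
      (badPair-down (name∈end₂ _) (λ e → name-H≢p ε (trans (name-H ε) e))
        (subst (λ j → BadPair (label H j) (name G (punchIn edge ε))) (trans (sym (cong proj₂ eq)) (endᴴ₂ ε))
          (subst (BadPair (label H y)) (name-H ε) b)))
  noBadCircuit-H nb ε x y (inj₂ eq) c b =
    nb (punchIn edge ε) _ _ (inj₂ refl)
      (whole-circuit-down (subst (λ j → IsCircuit (label H j) (E (label H j))) (trans (sym (cong proj₂ eq)) (endᴴ₂ ε)) c))
      (badPair-down (name∈end₁ _) (λ e → name-H≢p ε (trans (name-H ε) e))
        (subst (λ j → BadPair (label H j) (name G (punchIn edge ε))) (trans (sym (cong proj₁ eq)) (endᴴ₁ ε))
          (subst (BadPair (label H y)) (name-H ε) b)))

-- Chains of vertices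

-- a and b are the terminals of v, through which a path of labels enters and leaves v.
record Link (G : LabelledGraph N k m) (v : Fin k) (a b : Fin N) : Set where
  field
    left∈  : a ∈ E (label G v)
    right∈ : b ∈ E (label G v)
    left≢right : a ≢ b
    spans : CircuitsSpan (label G v) a b
    names : ∀ ε → name G ε ∈ E (label G v) → name G ε ≡ a ⊎ name G ε ≡ b

data Chain (G : LabelledGraph N k m) : Fin N → List (Fin k) → Fin N → Set where
  []  : ∀ {a} → Chain G a [] a
  _∷_ : ∀ {a b c v vs} → Link G v a b → Chain G b vs c → Chain G a (v ∷ vs) c

-- `size` and `complete` together exclude repetitions, by the pigeonhole principle, so the list
-- enumerates the vertices.
record ChainOf (G : LabelledGraph N k m) (e f : Fin N) : Set where
  constructor chainOf
  field
    vertices : List (Fin k)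
    chain    : Chain G e vertices f
    size     : length vertices ≡ k
    complete : ∀ i → i ∈ₗ vertices

complete⇒≤ : ∀ {vs : List (Fin k)} → (∀ i → i ∈ₗ vs) → k ≤ length vs
complete⇒≤ {vs = vs} all = injective⇒≤ {f = λ i → index (all i)} λ {i} {j} eq →
  trans (lookup-index (all i)) (trans (cong (List.lookup vs) eq) (sym (lookup-index (all j))))

-- If `v` occurred again, dropping one occurrence would leave a complete list with fewer than `k`
-- entries.
no-repeat : ∀ xs {v : Fin k} {ys} → length (xs ++ v ∷ ys) ≡ k → (∀ i → i ∈ₗ xs ++ v ∷ ys) → v ∉ₗ xs ++ ys
no-repeat {k = k} xs {v} {ys} size all v∈ = ℕ.<-irrefl refl
  (ℕ.≤-trans (s≤s (complete⇒≤ all′)) (ℕ.≤-reflexive (trans (sym length-drop) size)))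
  where
  length-drop : length (xs ++ v ∷ ys) ≡ suc (length (xs ++ ys))
  length-drop = trans (length-++ xs) (trans (ℕ.+-suc _ _) (cong suc (sym (length-++ xs))))
  all′ : ∀ i → i ∈ₗ xs ++ ys
  all′ i with ∈-++⁻ xs (all i)
  ... | inj₁ h = ∈-++⁺ˡ h
  ... | inj₂ (here refl) = v∈
  ... | inj₂ (there h) = ∈-++⁺ʳ xs h

module _ {G : LabelledGraph N k m} where
  chain-split : ∀ {a c} xs {ys} → Chain G a (xs ++ ys) c → ∃ λ b → Chain G a xs b × Chain G b ys c
  chain-split [] ch = _ , [] , ch
  chain-split (x ∷ xs) (g ∷ ch) with chain-split xs ch
  ... | b , l , r = b , g ∷ l , r

  chain-join : ∀ {a b c xs ys} → Chain G a xs b → Chain G b ys c → Chain G a (xs ++ ys) c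
  chain-join [] r = r
  chain-join (g ∷ l) r = g ∷ chain-join l r

  -- Every name in a label of the chain is one of its two terminals, and a terminal other than the
  -- ends of the chain is shared by two consecutive vertices.
  chain-joint : ∀ {a c vs} ε → Chain G a vs c → name G ε ≢ a → name G ε ≢ c → ∀ {u} → u ∈ₗ vs →
    name G ε ∈ E (label G u) → ∃₂ λ xs ys → ∃₂ λ z z′ → ∃₂ λ a′ c′ → vs ≡ xs ++ z ∷ z′ ∷ ys ×
      Chain G a xs a′ × Link G z a′ (name G ε) × Link G z′ (name G ε) c′ × Chain G c′ ys c
  chain-joint ε (_∷_ {a} {b} {v = v} g ch) p≢a p≢c u∈ p∈ with name G ε ≟ b
  chain-joint ε (_∷_ {v = v} g []) p≢a p≢c u∈ p∈ | yes refl = contradiction refl p≢c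
  chain-joint ε (_∷_ {v = v} g (g′ ∷ ch)) p≢a p≢c u∈ p∈ | yes refl =
    [] , _ , _ , _ , _ , _ , refl , [] , g , g′ , ch
  chain-joint ε (_∷_ {v = v} g ch) p≢a p≢c (here refl) p∈ | no p≢b with Link.names g ε p∈
  ... | inj₁ e = contradiction e p≢a
  ... | inj₂ e = contradiction e p≢b
  chain-joint ε (_∷_ {v = v} g ch) p≢a p≢c (there u∈) p∈ | no p≢b
    with chain-joint ε ch p≢b p≢c u∈ p∈
  ... | xs , ys , z , z′ , a′ , c′ , refl , l , h , h′ , r =
    v ∷ xs , ys , z , z′ , a′ , c′ , refl , g ∷ l , h , h′ , r

module Refine {N k m} {G : LabelledGraph N (suc k) (suc m)} {H : LabelledGraph N k m}
              (con : Contraction G H) (wf : WellFormed G) where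
  open Contract con wf

  module Half {i j} (s : Is2Sum p (label G i) (label G j) (label H w)) where
    private module P = TwoSum s

    names₁ : ∀ {a b} → b ∈ E (label G j) → (∀ ε → name H ε ∈ E (label H w) → name H ε ≡ a ⊎ name H ε ≡ b) →
      ∀ ε → name G ε ∈ E (label G i) → name G ε ≡ a ⊎ name G ε ≡ p
    names₁ b∈ nm ε ε∈ with name G ε ≟ p
    ... | yes ε≡p = inj₂ ε≡p
    ... | no ε≢p with name-lift ε ε≢p
    ... | ε′ , eq with nm ε′ (subst (_∈ E (label H w)) (sym eq) (P.ground₁ ε∈ ε≢p))
    ... | inj₁ e = inj₁ (trans (sym eq) e)
    ... | inj₂ e = contradiction (P.meet ε∈ (subst (_∈ E (label G j)) (trans (sym e) eq) b∈)) ε≢p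

    -- All names in the label of w are terminals, hence lie on the other side.
    noParallel₂ : NoParallelPair G → ∀ {a b} → Link H w a b → a ∈ E (label G i) → b ∈ E (label G i) → NoParallel (label G j) p
    noParallel₂ np {a} {b} g a∈ b∈ x y x∈ y∈ x≢p y≢p = np j x y x∈ y∈ (notName x∈ x≢p) (notName y∈ y≢p)
      where
      notName : ∀ {x} → x ∈ E (label G j) → x ≢ p → NotName G x
      notName x∈ x≢p ε refl with name-lift ε x≢p
      ... | ε′ , eq with Link.names g ε′ (subst (_∈ E (label H w)) (sym eq) (P.ground₂ x∈ x≢p))
      ... | inj₁ e = x≢p (P.meet (subst (_∈ E (label G i)) (trans (sym e) eq) a∈) x∈)
      ... | inj₂ e = x≢p (P.meet (subst (_∈ E (label G i)) (trans (sym e) eq) b∈) x∈)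

  module _ {i j} (s : Is2Sum p (label G i) (label G j) (label H w)) where
    private
      module P = TwoSum s

      names₂ : ∀ {a b} → a ∈ E (label G i) → (∀ ε → name H ε ∈ E (label H w) → name H ε ≡ a ⊎ name H ε ≡ b) →
        ∀ ε → name G ε ∈ E (label G j) → name G ε ≡ p ⊎ name G ε ≡ b
      names₂ a∈ nm ε ε∈ = Sum.swap (Half.names₁ (twoSum-sym s) a∈ (λ ε ε∈ → Sum.swap (nm ε ε∈)) ε ε∈)

    link-cut : ∀ {a b} → Link H w a b → a ∈ E (label G i) → a ≢ p → b ∈ E (label G j) → b ≢ p → Link G i a p × Link G j p b
    link-cut g a∈ a≢p b∈ b≢p =
      record { left∈ = a∈ ; right∈ = P.p∈E₁ ; left≢right = a≢p ; spans = circuitsSpan-splitˡ s a∈ a≢p b∈ b≢p spans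
             ; names = Half.names₁ s b∈ names } ,
      record { left∈ = P.p∈E₂ ; right∈ = b∈ ; left≢right = b≢p ∘ sym ; spans = circuitsSpan-splitʳ s a∈ a≢p b∈ b≢p spans
             ; names = names₂ a∈ names }
      where open Link g

    link-paste : ∀ {a b} → Link G i a p → Link G j p b → Link H w a b
    link-paste {a} {b} g g′ = record
      { left∈ = P.ground₁ g.left∈ g.left≢right ; right∈ = P.ground₂ g′.right∈ (g′.left≢right ∘ sym)
      ; left≢right = λ { refl → g.left≢right (P.meet g.left∈ g′.right∈) }
      ; spans = circuitsSpan-glue s g.left∈ g′.right∈ g.spans g′.spans
      ; names = nm }
      where
      module g = Link g
      module g′ = Link g′
      nm : ∀ ε → name H ε ∈ E (label H w) → name H ε ≡ a ⊎ name H ε ≡ b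
      nm ε h with P.ground⁻ h
      ... | inj₁ h₁ , ≢p with g.names (punchIn edge ε) (subst (_∈ E (label G i)) (name-H ε) h₁)
      ... | inj₁ e = inj₁ (trans (name-H ε) e)
      ... | inj₂ e = contradiction (trans (name-H ε) e) ≢p
      nm ε h | inj₂ h₂ , ≢p with g′.names (punchIn edge ε) (subst (_∈ E (label G j)) (name-H ε) h₂)
      ... | inj₁ e = contradiction (trans (name-H ε) e) ≢p
      ... | inj₂ e = inj₂ (trans (name-H ε) e)

  link-other : ∀ {i a b} → i ≢ u → i ≢ v → Link H (π i) a b → Link G i a b
  link-other {i} i≢u i≢v g = record
    { left∈ = subst (_ ∈_) E≡ left∈ ; right∈ = subst (_ ∈_) E≡ right∈ ; left≢right = left≢right
    ; spans = circuitsSpan-≈ {M = label H (π i)} {label G i} (label-other i≢u i≢v) spans ; names = nm }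
    where
    open Link g
    E≡ = proj₁ (label-other i≢u i≢v)
    nm : ∀ ε → name G ε ∈ E (label G i) → _
    nm ε h with name G ε ≟ p
    ... | yes ε≡p with p∈⇒end (subst (_∈ E (label G i)) ε≡p h)
    ... | inj₁ e = contradiction e i≢u
    ... | inj₂ e = contradiction e i≢v
    nm ε h | no ε≢p with name-lift ε ε≢p
    ... | ε′ , eq = subst (λ x → x ≡ _ ⊎ x ≡ _) eq
        (names ε′ (subst (_∈ E (label H (π i))) (sym eq) (subst (_ ∈_) (sym E≡) h)))

  link-other⁻ : ∀ {i a b} → i ≢ u → i ≢ v → Link G i a b → Link H (π i) a b
  link-other⁻ {i} i≢u i≢v g = record
    { left∈ = subst (_ ∈_) (sym E≡) left∈ ; right∈ = subst (_ ∈_) (sym E≡) right∈ ; left≢right = left≢right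
    ; spans = circuitsSpan-≈ {M = label G i} {label H (π i)} (≈-sym {M = label H (π i)} {label G i} (label-other i≢u i≢v)) spans
    ; names = λ ε h → subst (λ x → x ≡ _ ⊎ x ≡ _) (sym (name-H ε))
        (names _ (subst (_∈ E (label G i)) (name-H ε) (subst (_ ∈_) E≡ h))) }
    where
    open Link g
    E≡ = proj₁ (label-other i≢u i≢v)

  module _ (B : ∀ i → CycleSpace (label G i)) (np : NoParallelPair G) (nb : NoBadCircuit G) where

    private
      one-side-absurd : ∀ {i j} (s : Is2Sum p (label G i) (label G j) (label H w)) → Joins (graph G) edge j i →
        ∀ {a b} → Link H w a b → a ∈ E (label G i) → a ≢ p → b ∈ E (label G i) → ¬ b ≢ p
      one-side-absurd {j = j} s joins {a} {b} g a∈ a≢p b∈ b≢p =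
        let (c , bad) = same-side s a∈ a≢p b∈ b≢p (Link.left≢right g) (Half.noParallel₂ s np g a∈ b∈) (B j) (Link.spans g)
        in nb edge _ _ joins c (a , b , a∈ , b∈ , Link.left≢right g , a≢p , b≢p , bad)

    -- `NoBadCircuit` excludes terminals on the same side, so the contracted edge separates them and
    -- its name becomes the joint between the two halves.
    link-split : ∀ {a b} → Link H w a b → ∃₂ λ z z′ →
      ((z ≡ u × z′ ≡ v) ⊎ (z ≡ v × z′ ≡ u)) × Link G z a p × Link G z′ p b
    link-split g with S.ground⁻ (Link.left∈ g) | S.ground⁻ (Link.right∈ g)
    ... | inj₁ a∈ , a≢p | inj₂ b∈ , b≢p = u , v , inj₁ (refl , refl) , link-cut composite g a∈ a≢p b∈ b≢p
    ... | inj₂ a∈ , a≢p | inj₁ b∈ , b≢p = v , u , inj₂ (refl , refl) , link-cut (twoSum-sym composite) g a∈ a≢p b∈ b≢p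
    ... | inj₁ a∈ , a≢p | inj₁ b∈ , b≢p = contradiction b≢p (one-side-absurd composite (inj₂ refl) g a∈ a≢p b∈)
    ... | inj₂ a∈ , a≢p | inj₂ b∈ , b≢p = contradiction b≢p (one-side-absurd (twoSum-sym composite) (inj₁ refl) g a∈ a≢p b∈)

    chain-σ : ∀ {a c vs} → w ∉ₗ vs → Chain H a vs c → Chain G a (List.map σ vs) c
    chain-σ w∉ [] = []
    chain-σ w∉ (_∷_ {v = j} g ch) = link-other (λ e → w∉ (here (sym (trans (sym (πσ j)) (cong π e)))))
      (λ e → w∉ (here (sym (trans (sym (πσ j)) (trans (cong π e) πv≡w)))))
      (subst (λ j → Link H j _ _) (sym (πσ j)) g) ∷ chain-σ (w∉ ∘ there) ch

    -- The vertex `w` occurs once. The rest of the chain lifts unchanged along the section `σ`, and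
    -- `w` is replaced by its two parts in the order in which the chain meets them.
    refine : ∀ {e f} → ChainOf H e f → ChainOf G e f
    refine (chainOf vs ch size complete) with ∈-∃++ (complete w)
    ... | xs , ys , refl with chain-split xs ch
    ... | a , l , (g ∷ r) with link-split g
    ... | z , z′ , zz′ , g₁ , g₂ = chainOf (List.map σ xs ++ z ∷ z′ ∷ List.map σ ys)
      (chain-join (chain-σ (w∉ ∘ ∈-++⁺ˡ) l) (g₁ ∷ g₂ ∷ chain-σ (w∉ ∘ ∈-++⁺ʳ xs) r)) size′ complete′
      where
      w∉ = no-repeat xs size complete
      size′ : length (List.map σ xs ++ z ∷ z′ ∷ List.map σ ys) ≡ suc k
      size′ = trans (length-++ (List.map σ xs)) (trans (cong₂ (λ s t → s + suc (suc t)) (length-map σ xs) (length-map σ ys))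
        (trans (ℕ.+-suc (length xs) _) (cong suc (trans (sym (length-++ xs)) size))))
      middle : ∀ {i} → i ≡ z ⊎ i ≡ z′ → i ∈ₗ List.map σ xs ++ z ∷ z′ ∷ List.map σ ys
      middle (inj₁ refl) = ∈-++⁺ʳ (List.map σ xs) (here refl)
      middle (inj₂ refl) = ∈-++⁺ʳ (List.map σ xs) (there (here refl))
      side : ∀ {z z′ i} → (z ≡ u × z′ ≡ v) ⊎ (z ≡ v × z′ ≡ u) → i ≡ u ⊎ i ≡ v → i ≡ z ⊎ i ≡ z′
      side (inj₁ (refl , refl)) h = h
      side (inj₂ (refl , refl)) (inj₁ e) = inj₂ e
      side (inj₂ (refl , refl)) (inj₂ e) = inj₁ e
      complete′ : ∀ i → i ∈ₗ List.map σ xs ++ z ∷ z′ ∷ List.map σ ys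
      complete′ i with position i
      ... | is-u e = middle (side zz′ (inj₁ e))
      ... | is-v e = middle (side zz′ (inj₂ e))
      ... | other i≢u i≢v with ∈-++⁻ xs (complete (π i))
      ... | inj₁ h = ∈-++⁺ˡ (subst (_∈ₗ List.map σ xs) (sym (π-injective-off i≢u i≢v (sym (πσ (π i))))) (∈-map⁺ σ h))
      ... | inj₂ (there h) = ∈-++⁺ʳ (List.map σ xs) (there (there
            (subst (_∈ₗ List.map σ ys) (sym (π-injective-off i≢u i≢v (sym (πσ (π i))))) (∈-map⁺ σ h))))
      ... | inj₂ (here e) with π-fibre-w e
      ... | inj₁ e′ = contradiction e′ i≢u
      ... | inj₂ e′ = contradiction e′ i≢v

  link-merge : ∀ {z z′ a b} → ((z ≡ u × z′ ≡ v) ⊎ (z ≡ v × z′ ≡ u)) → Link G z a p → Link G z′ p b → Link H w a b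
  link-merge (inj₁ (refl , refl)) = link-paste composite
  link-merge (inj₂ (refl , refl)) = link-paste (twoSum-sym composite)

  chain-π : ∀ {a c vs} → u ∉ₗ vs → v ∉ₗ vs → Chain G a vs c → Chain H a (List.map π vs) c
  chain-π u∉ v∉ [] = []
  chain-π u∉ v∉ (g ∷ ch) = link-other⁻ (λ e → u∉ (here (sym e))) (λ e → v∉ (here (sym e))) g ∷
    chain-π (u∉ ∘ there) (v∉ ∘ there) ch

  -- As `e` and `f` are not names, the contracted edge is a joint inside the chain. The two vertices
  -- around it are its ends and merge into `w`.
  coarsen : ∀ {e f} → NotName G e → NotName G f → ChainOf G e f → ChainOf H e f
  coarsen {e} {f} ne nf (chainOf vs ch size complete)
    with chain-joint edge ch (ne edge) (nf edge) (complete u) S.p∈E₁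
  ... | xs , ys , z , z′ , a′ , c′ , refl , l , g , g′ , r =
    chainOf (List.map π xs ++ w ∷ List.map π ys)
      (chain-join (chain-π (proj₁ outside-xs) (proj₂ outside-xs) l)
        (link-merge zz′ g g′ ∷ chain-π (proj₁ outside-ys) (proj₂ outside-ys) r)) size′ complete′
    where
    z∉ : z ∉ₗ xs ++ z′ ∷ ys
    z∉ = no-repeat xs size complete
    assoc : xs ++ z ∷ z′ ∷ ys ≡ (xs ++ z ∷ []) ++ z′ ∷ ys
    assoc = sym (++-assoc xs (z ∷ []) (z′ ∷ ys))
    z′∉ : z′ ∉ₗ (xs ++ z ∷ []) ++ ys
    z′∉ = no-repeat (xs ++ z ∷ []) (trans (cong length (sym assoc)) size) λ i → subst (i ∈ₗ_) assoc (complete i)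
    z≢z′ : z ≢ z′
    z≢z′ refl = z∉ (∈-++⁺ʳ xs (here refl))
    zz′ : (z ≡ u × z′ ≡ v) ⊎ (z ≡ v × z′ ≡ u)
    zz′ with p∈⇒end (Link.right∈ g) | p∈⇒end (Link.left∈ g′)
    ... | inj₁ a | inj₁ b = contradiction (trans a (sym b)) z≢z′
    ... | inj₁ a | inj₂ b = inj₁ (a , b)
    ... | inj₂ a | inj₁ b = inj₂ (a , b)
    ... | inj₂ a | inj₂ b = contradiction (trans a (sym b)) z≢z′
    avoid : ∀ {l} → z ∉ₗ l → z′ ∉ₗ l → u ∉ₗ l × v ∉ₗ l
    avoid h h′ with zz′
    ... | inj₁ (refl , refl) = h , h′
    ... | inj₂ (refl , refl) = h′ , h
    outside-xs = avoid (z∉ ∘ ∈-++⁺ˡ) (z′∉ ∘ ∈-++⁺ˡ ∘ ∈-++⁺ˡ)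
    outside-ys = avoid (z∉ ∘ ∈-++⁺ʳ xs ∘ there) (z′∉ ∘ ∈-++⁺ʳ (xs ++ z ∷ []))
    size′ : length (List.map π xs ++ w ∷ List.map π ys) ≡ k
    size′ = trans (length-++ (List.map π xs)) (trans (cong₂ (λ s t → s + suc t) (length-map π xs) (length-map π ys))
      (ℕ.suc-injective (trans (sym (ℕ.+-suc (length xs) _)) (trans (sym (length-++ xs)) size))))
    complete′ : ∀ j → j ∈ₗ List.map π xs ++ w ∷ List.map π ys
    complete′ j with ∈-++⁻ xs (complete (σ j))
    ... | inj₁ h = ∈-++⁺ˡ (subst (_∈ₗ List.map π xs) (πσ j) (∈-map⁺ π h))
    ... | inj₂ (there (there h)) = ∈-++⁺ʳ (List.map π xs) (there (subst (_∈ₗ List.map π ys) (πσ j) (∈-map⁺ π h)))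
    ... | inj₂ (here e) = ∈-++⁺ʳ (List.map π xs) (here (trans (sym (πσ j)) (trans (cong π e) (end-w zz′))))
      where
      end-w : _ → π z ≡ w
      end-w (inj₁ (refl , _)) = refl
      end-w (inj₂ (refl , _)) = πv≡w
    ... | inj₂ (there (here e)) = ∈-++⁺ʳ (List.map π xs) (here (trans (sym (πσ j)) (trans (cong π e) (end-w zz′))))
      where
      end-w : _ → π z′ ≡ w
      end-w (inj₁ (_ , refl)) = πv≡w
      end-w (inj₂ (_ , refl)) = refl

labels-inherit : ∀ {G : LabelledGraph N k m} {M} → G Yields M → WellFormed G → CycleSpace M →
  (∀ x y → x ∈ E M → y ∈ E M → x ≢ y → Matroid.Indep M (pair x y)) →
  (∀ i → CycleSpace (label G i)) × NoParallelPair G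
labels-inherit {G = G} {M} (single G≈M) wf B np = B′ , np′
  where
  B′ : ∀ i → CycleSpace (label G i)
  B′ zero = cycleSpace-≈ {M = M} {label G zero} (≈-sym {M = label G zero} {M} G≈M) B
  np′ : NoParallelPair G
  np′ zero x y x∈ y∈ _ _ x≢y = Equivalence.from (proj₂ G≈M (pair x y))
    (np x y (subst (x ∈_) (proj₁ G≈M) x∈) (subst (y ∈_) (proj₁ G≈M) y∈) x≢y)
labels-inherit {G = G} (contract con y) wf B np with labels-inherit y (Contract.wellFormed-H con wf) B np
... | B′ , np′ = Contract.cycleSpace-down con wf B′ , Contract.noParallelPair-down con wf np′

-- Two flows meet in the recursion: `NoBadCircuit` is carried forward to the contracted tree, and
-- the chain comes back from the single vertex labelled by `M`.
circuitsSpan⇒chain : ∀ {G : LabelledGraph N k m} {M e f} → G Yields M → WellFormed G → CycleSpace M →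
  (∀ x y → x ∈ E M → y ∈ E M → x ≢ y → Matroid.Indep M (pair x y)) → NoBadCircuit G →
  e ∈ E M → f ∈ E M → e ≢ f → CircuitsSpan M e f → ChainOf G e f
circuitsSpan⇒chain {G = G} {M} {e} {f} (single G≈M) wf B np nb e∈ f∈ e≢f q = chainOf (zero ∷ []) (g ∷ []) refl λ { zero → here refl }
  where
  M≈G = ≈-sym {M = label G zero} {M} G≈M
  g : Link G zero e f
  g = record { left∈ = subst (e ∈_) (proj₁ M≈G) e∈ ; right∈ = subst (f ∈_) (proj₁ M≈G) f∈ ; left≢right = e≢f
             ; spans = circuitsSpan-≈ {M = M} {label G zero} M≈G q ; names = λ () }
circuitsSpan⇒chain (contract con y) wf B np nb e∈ f∈ e≢f q =
  Refine.refine con wf (proj₁ lab) (proj₂ lab) nb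
    (circuitsSpan⇒chain y (Contract.wellFormed-H con wf) B np (Contract.noBadCircuit-H con wf nb) e∈ f∈ e≢f q)
  where lab = labels-inherit (contract con y) wf B np

chain⇒circuitsSpan : ∀ {G : LabelledGraph N k m} {M e f} → G Yields M → WellFormed G → NotName G e → NotName G f →
  ChainOf G e f → CircuitsSpan M e f
chain⇒circuitsSpan {G = G} {M} (single G≈M) wf ne nf (chainOf (zero ∷ []) (g ∷ []) _ _) =
  circuitsSpan-≈ {M = label G zero} {M} G≈M (Link.spans g)
chain⇒circuitsSpan (contract con y) wf ne nf ch = chain⇒circuitsSpan y (Contract.wellFormed-H con wf)
  (Contract.notName⁺ con wf ne) (Contract.notName⁺ con wf nf) (Refine.coarsen con wf ne nf ch)

-- Sides of a circuit in a 3-connected matroid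

∣─pair∣ : ∀ (S : Subset N) → 4 ≤ ∣ S ∣ → ∀ x y → 2 ≤ ∣ S ─ pair x y ∣
∣─pair∣ S 4≤ x y = ℕ.+-cancelˡ-≤ 2 2 _ (ℕ.≤-trans 4≤ (ℕ.≤-trans
  (ℕ.≤-reflexive (sym (∣p∩q∣+∣p─q∣ S (pair x y))))
  (ℕ.+-monoˡ-≤ ∣ S ─ pair x y ∣ (ℕ.≤-trans (∣p∩q∣≤∣q∣ S (pair x y)) (∣pair∣≤2 x y)))))

module _ (M : Matroid N) (3c : ThreeConnected M) where
  open Matroid M renaming (Indep to Ind) using (hereditary)

  no-2-separation : ∀ {X a b} → X ⊆ E M → 2 ≤ ∣ X ∣ → 2 ≤ ∣ E M ─ X ∣ → rank M X ≤ a → rank M (E M ─ X) ≤ b →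
    ¬ a + b ≤ suc (rank M (E M))
  no-2-separation {X} X⊆ 2≤ 2≤′ ra rb le = 3c 2 (s≤s z≤n) (s≤s (s≤s (s≤s z≤n))) X
    ((λ {x} → X⊆ {x}) , 2≤ , 2≤′ , ℕ.≤-trans (s≤s (ℕ.≤-trans (ℕ.+-mono-≤ ra rb) le)) (ℕ.≤-reflexive (ℕ.+-comm 2 _)))

  -- A dependent pair has rank at most one and its complement rank at most that of `M`, so it would
  -- be one part of a 2-separation. Four elements guarantee that the other part is large enough.
  no-parallel : 4 ≤ ∣ E M ∣ → ∀ x y → x ∈ E M → y ∈ E M → x ≢ y → Ind (pair x y)
  no-parallel 4≤ x y x∈ y∈ x≢y = decidable-stable (Matroid.Indep? M (pair x y)) λ d →
    no-2-separation {pair x y} (pair⊆ x∈ y∈) (ℕ.≤-reflexive (sym (∣pair∣ x≢y))) (∣─pair∣ (E M) 4≤ x y)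
      (rank-≤ M (small d)) (rank-mono M (p─q⊆p (E M) (pair x y))) ℕ.≤-refl
    where
    small : ¬ Ind (pair x y) → ∀ I → I ⊆ pair x y → Ind I → ∣ I ∣ ≤ 1
    small d I I⊆ i with ⊆⊎∃ (pair x y) I
    ... | inj₁ sub = contradiction (hereditary sub i) d
    ... | inj₂ e = s≤s⁻¹ (ℕ.≤-trans (p⊂q⇒∣p∣<∣q∣ {p = I} {q = pair x y} (I⊆ , e)) (∣pair∣≤2 x y))

  module _ {C} (cC : IsCircuit M C) where

    -- If `C ∩ X` spans `X` and `C ─ X` spans the complement, the two ranks add up to at most
    -- `∣ C ∣`. As `C` is a circuit, this exceeds the rank of `M` by at most one, which is the bound
    -- for a 2-separation.
    no-separation-along : ∀ {X} → X ⊆ E M → 2 ≤ ∣ X ∣ → 2 ≤ ∣ E M ─ X ∣ →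
      Ind (C ∩ X) → (∀ {z} → z ∈ X → z ∉ C → ¬ Ind ((C ∩ X) ∪ ⁅ z ⁆)) →
      ¬ (Ind (C ─ X) × (∀ {z} → z ∈ E M → z ∉ X → z ∉ C → ¬ Ind ((C ─ X) ∪ ⁅ z ⁆)))
    no-separation-along {X} X⊆ 2≤ 2≤′ i₁ s₁ (i₂ , s₂) = no-2-separation {X} X⊆ 2≤ 2≤′
      (rank-≤-spanned M i₁ λ z∈ z∉ → s₁ z∈ λ z∈C → z∉ (∩⁺ z∈C z∈))
      (rank-≤-spanned M i₂ λ z∈ z∉ → s₂ (proj₁ (─⁻ z∈)) (proj₂ (─⁻ {p = E M} z∈))
        λ z∈C → z∉ (x∈p∧x∉q⇒x∈p─q z∈C (proj₂ (─⁻ {p = E M} z∈))))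
      (ℕ.≤-trans (ℕ.≤-reflexive (∣p∩q∣+∣p─q∣ C X)) (circuit-rank M cC))

-- A transversal circuit C through the tip t and the cotip s, whose remaining elements c are the legs.
record SpikeStructure (M : Matroid N) (B : CycleSpace M) (t s : Fin N) : Set where
  field
    C : Subset N
    circuit : IsCircuit M C
    t∈C : t ∈ C
    s∈C : s ∈ C
    t≢s : t ≢ s
  Leg : Fin N → Set
  Leg c = c ∈ C × c ≢ t × c ≢ s
  field
    partner : Fin N → Fin N
    partner∈ : ∀ {c} → Leg c → partner c ∈ E M × partner c ∉ C
    partner-injective : ∀ {c d} → Leg c → Leg d → partner c ≡ partner d → c ≡ d
    partner-surjective : ∀ {x} → x ∈ E M → x ∉ C → ∃ λ c → Leg c × partner c ≡ x
    triangle : ∀ {c} → Leg c → CycleSpace.Cyc B (pair t c ∪ ⁅ partner c ⁆)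
    two-legs : ∃₂ λ c d → Leg c × Leg d × c ≢ d

module Sides (M : Matroid N) (B : CycleSpace M) (3c : ThreeConnected M) (4≤ : 4 ≤ ∣ E M ∣)
             {C} (cC : IsCircuit M C) where
  open CycleSpace B
  open Matroid M renaming (Indep to Ind) using (hereditary)

  Out : Fin N → Set
  Out x = x ∈ E M × x ∉ C

  out? : ∀ x → Dec (Out x)
  out? x = (x ∈? E M) ×-dec ¬? (x ∈? C)

  np : ∀ {x y} → x ∈ E M → y ∈ E M → x ≢ y → Ind (pair x y)
  np = no-parallel M 3c 4≤ _ _

  no-short-cycle : ∀ {X x y} → Cyc X → Nonempty X → x ∈ E M → y ∈ E M → x ≢ y → ¬ (X ⊆ pair x y)
  no-short-cycle cX ne x∈ y∈ x≢y sub = Cyc⇒dep cX ne (hereditary sub (np x∈ y∈ x≢y))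

  -- T x ∖ {x} is the side containing e of the bipartition of C induced by x.
  record IsSide (e f x : Fin N) (T : Subset N) : Set where
    field
      cycle : Cyc T
      x∈T : x ∈ T
      T⊆ : T ⊆ C ∪ ⁅ x ⁆
      e∈T : e ∈ T
      f∉T : f ∉ T

  -- The other part of the bipartition of `C` serves `f` in the same way, so every result about
  -- sides holds with `e` and `f` exchanged.
  side-swap : ∀ {e f x T} → e ∈ C → f ∈ C → x ∉ C → IsSide e f x T → IsSide f e x (T ⊕ C)
  side-swap e∈C f∈C x∉C s = record
    { cycle = Cyc-⊕ cycle (circuit⇒Cyc cC) ; x∈T = ⊕⁺ˡ x∈T x∉C ; T⊆ = ⊕⊆ T⊆ ∈∪ˡ ; e∈T = ⊕⁺ʳ f∉T f∈C ; f∉T = ⊕∉₂ e∈T e∈C }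
    where open IsSide s

  -- One of the two cycles through `x` contains `e`. If it also contained `f`, it would span
  -- whenever it is a circuit, and `theta-short` would produce a cycle inside a pair. So `x`
  -- separates `e` from `f`.
  ∃side : ∀ {e f} → e ∈ C → f ∈ C → CircuitsSpan M e f → ∀ {x} → Out x → ∃ (IsSide e f x)
  ∃side {e} {f} e∈C f∈C q {x} (x∈E , x∉C) with candidate
    where
    candidate : ∃ λ T → Cyc T × x ∈ T × T ⊆ C ∪ ⁅ x ⁆ × e ∈ T
    candidate with q C cC e∈C f∈C x x∈E x∉C
    ... | D , cD , x∈D , D⊆ with e ∈? D
    ... | yes e∈D = D , circuit⇒Cyc cD , x∈D , (λ {z} → D⊆ {z}) , e∈D
    ... | no e∉D = D ⊕ C , Cyc-⊕ (circuit⇒Cyc cD) (circuit⇒Cyc cC) , ⊕⁺ˡ x∈D x∉C ,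
                   (λ {z} → ⊕⊆ D⊆ ∈∪ˡ {z}) , ⊕⁺ʳ e∉D e∈C
  ... | T , cT , x∈T , T⊆ , e∈T = T , record { cycle = cT ; x∈T = x∈T ; T⊆ = T⊆ ; e∈T = e∈T ; f∉T = f∉T }
    where
    cTC = Cyc-⊕ cT (circuit⇒Cyc cC)
    f∉T : f ∉ T
    f∉T f∈T with theta-short cC x∉C cT x∈T T⊆ (λ c → q T c e∈T f∈T)
    ... | inj₂ (c , c∈C , c∉T , sub) =
      no-short-cycle cTC (x , ⊕⁺ˡ x∈T x∉C) x∈E (proj₁ cC c∈C) (λ { refl → x∉C c∈C }) sub
    ... | inj₁ C⊆T = no-short-cycle cTC (x , ⊕⁺ˡ x∈T x∉C) x∈E (proj₁ cC e∈C) (λ { refl → x∉C e∈C }) sub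
      where
      sub : T ⊕ C ⊆ pair x e
      sub z∈ with ⊕⁻ z∈
      ... | inj₂ (z∉T , z∈C) = contradiction (C⊆T z∈C) z∉T
      ... | inj₁ (z∈T , z∉C) with insert⁻ (T⊆ z∈T)
      ... | inj₁ z∈C = contradiction z∈C z∉C
      ... | inj₂ refl = pairˡ

  module Family {e f} (e∈C : e ∈ C) (f∈C : f ∈ C) (e≢f : e ≢ f) (q : CircuitsSpan M e f)
                (T : Fin N → Subset N) (isSide : ∀ {x} → Out x → IsSide e f x (T x)) where

    T-self : ∀ {x z} → Out x → z ∈ T x → z ∉ C → z ≡ x
    T-self ox z∈ z∉ with insert⁻ (IsSide.T⊆ (isSide ox) z∈)
    ... | inj₁ h = contradiction h z∉
    ... | inj₂ h = h

    -- The witnesses `c` and `d` make the two sides incomparable. The sum `D` of both cycles and `C`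
    -- is then a new circuit through `e` and `f`, and the hypothesis that it spans limits how far
    -- the sides can differ.
    module Exchange {x y} (ox : Out x) (oy : Out y) {c d} (c∈C : c ∈ C) (d∈C : d ∈ C)
                    (c∈x : c ∈ T x) (c∉y : c ∉ T y) (d∉x : d ∉ T x) (d∈y : d ∈ T y) where
      private
        module X = IsSide (isSide ox)
        module Y = IsSide (isSide oy)
        x≢y : x ≢ y
        x≢y refl = c∉y c∈x
        x∉Ty : x ∉ T y
        x∉Ty h = x≢y (T-self oy h (proj₂ ox))
        y∉Tx : y ∉ T x
        y∉Tx h = x≢y (sym (T-self ox h (proj₂ oy)))

      D : Subset N
      D = (T x ⊕ T y) ⊕ C

      cD : Cyc D
      cD = Cyc-⊕ (Cyc-⊕ X.cycle Y.cycle) (circuit⇒Cyc cC)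

      x∈D : x ∈ D
      x∈D = ⊕⁺ˡ (⊕⁺ˡ X.x∈T x∉Ty) (proj₂ ox)
      y∈D : y ∈ D
      y∈D = ⊕⁺ˡ (⊕⁺ʳ y∉Tx Y.x∈T) (proj₂ oy)
      e∈D : e ∈ D
      e∈D = ⊕⁺ʳ (⊕∉₂ X.e∈T Y.e∈T) e∈C
      f∈D : f ∈ D
      f∈D = ⊕⁺ʳ (⊕∉₀ X.f∉T Y.f∉T) f∈C
      D-out : ∀ {z} → z ∈ C → z ∈ T x → z ∉ T y → z ∉ D
      D-out z∈C a b = ⊕∉₂ (⊕⁺ˡ a b) z∈C
      c∉D : c ∉ D
      c∉D = D-out c∈C c∈x c∉y
      d∉D : d ∉ D
      d∉D = ⊕∉₂ (⊕⁺ʳ d∉x d∈y) d∈C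

      within : ∀ {D′} → D′ ⊆ C ∪ pair x y → x ∉ D′ → y ∉ D′ → D′ ⊆ C
      within sub x∉ y∉ z∈ with ∪⁻ (sub z∈)
      ... | inj₁ h = h
      ... | inj₂ h with pair⁻ h
      ... | inj₁ refl = contradiction z∈ x∉
      ... | inj₂ refl = contradiction z∈ y∉

      Tx⊆ : T x ⊆ C ∪ pair x y
      Tx⊆ h = insert⊆ ∈∪ˡ (∈∪ʳ pairˡ) (X.T⊆ h)
      Ty⊆ : T y ⊆ C ∪ pair x y
      Ty⊆ h = insert⊆ ∈∪ˡ (∈∪ʳ pairʳ) (Y.T⊆ h)
      D⊆ : D ⊆ C ∪ pair x y
      D⊆ = ⊕⊆ (⊕⊆ Tx⊆ Ty⊆) ∈∪ˡ

      -- According to which of `x` and `y` it contains, `D′` is compared with ∅, `D`, `T x` or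
      -- `T y`; the sum is a cycle properly inside `C`, hence empty. `T x` and `T y` are excluded,
      -- since `T x` contains `c` and `T y` contains `d`.
      rigid : ∀ {D′} → Cyc D′ → D′ ⊆ C ∪ pair x y → c ∉ D′ → d ∉ D′ → Empty D′ ⊎ D′ ≡ D
      rigid {D′} cD′ sub c∉ d∉ with x ∈? D′ | y ∈? D′
      ... | no x∉ | no y∉ = inj₁ (within-circuit cC cD′ (within sub x∉ y∉) c∈C c∉)
      ... | yes x∈ | yes y∈ = inj₂ (⊕-empty⇒≡ (within-circuit cC (Cyc-⊕ cD′ cD)
              (within (⊕⊆ sub D⊆) (⊕∉₂ x∈ x∈D) (⊕∉₂ y∈ y∈D)) c∈C (⊕∉₀ c∉ c∉D)))
      ... | yes x∈ | no y∉ = contradiction (c , ⊕⁺ʳ c∉ c∈x) (within-circuit cC (Cyc-⊕ cD′ X.cycle)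
              (within (⊕⊆ sub Tx⊆) (⊕∉₂ x∈ X.x∈T) (⊕∉₀ y∉ y∉Tx)) d∈C (⊕∉₀ d∉ d∉x))
      ... | no x∉ | yes y∈ = contradiction (d , ⊕⁺ʳ d∉ d∈y) (within-circuit cC (Cyc-⊕ cD′ Y.cycle)
              (within (⊕⊆ sub Ty⊆) (⊕∉₀ x∉ x∉Ty) (⊕∉₂ y∈ Y.x∈T)) c∈C (⊕∉₀ c∉ c∉y))

      circuit-D : IsCircuit M D
      circuit-D = minimal⇒circuit cD (x , x∈D) min
        where
        min : ∀ {Y} → Cyc Y → Y ⊆ D → Nonempty Y → D ⊆ Y
        min cY Y⊆ ne with rigid cY (λ h → D⊆ (Y⊆ h)) (λ h → c∉D (Y⊆ h)) (λ h → d∉D (Y⊆ h))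
        ... | inj₁ emp = contradiction ne emp
        ... | inj₂ refl = id

      -- As `D` spans, a circuit in `D ∪ ⁅ c′ ⁆` runs through `c′`. For `c′ ≢ c` it misses both `c`
      -- and `d`, so by `rigid` it is `D`, which does not contain `c′`.
      unique : ∀ {c′} → c′ ∈ C → c′ ∈ T x → c′ ∉ T y → c′ ≡ c
      unique {c′} c′∈C c′∈x c′∉y = decidable-stable (c′ ≟ c) λ c′≢c → go c′≢c
          (q D circuit-D e∈D f∈D c′ (proj₁ cC c′∈C) c′∉D)
        where
        c′∉D : c′ ∉ D
        c′∉D = D-out c′∈C c′∈x c′∉y
        go : c′ ≢ c → ¬ (∃ λ D′ → IsCircuit M D′ × c′ ∈ D′ × D′ ⊆ D ∪ ⁅ c′ ⁆)
        go c′≢c (D′ , cD′ , c′∈ , D′⊆) with rigid (circuit⇒Cyc cD′) (λ h → insert⊆ D⊆ (∈∪ˡ c′∈C) (D′⊆ h)) c∉D′ d∉D′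
          where
          c∉D′ : c ∉ D′
          c∉D′ h with insert⁻ (D′⊆ h)
          ... | inj₁ a = c∉D a
          ... | inj₂ b = c′≢c (sym b)
          d∉D′ : d ∉ D′
          d∉D′ h with insert⁻ (D′⊆ h)
          ... | inj₁ a = d∉D a
          ... | inj₂ refl = d∉x c′∈x
        ... | inj₁ emp = emp (c′ , c′∈)
        ... | inj₂ refl = c′∉D c′∈

    A : Fin N → Subset N
    A x = T x - x

    A⊆C : ∀ {x z} → Out x → z ∈ A x → z ∈ C
    A⊆C {x} {z} ox z∈ with -⁻ z∈
    ... | z∈T , z≢x with insert⁻ (IsSide.T⊆ (isSide ox) z∈T)
    ... | inj₁ h = h
    ... | inj₂ h = contradiction h z≢x

    A⁺ : ∀ {x z} → Out x → z ∈ C → z ∈ T x → z ∈ A x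
    A⁺ ox z∈C z∈T = -⁺ z∈T λ { refl → proj₂ ox z∈C }

    A⁻ : ∀ {x z} → z ∈ A x → z ∈ T x
    A⁻ h = proj₁ (-⁻ h)

    exchange⇒equal-size : ∀ {x y} → Out x → Out y → ∀ {c d} → c ∈ C → d ∈ C →
      c ∈ T x → c ∉ T y → d ∉ T x → d ∈ T y → ∣ A x ∣ ≡ ∣ A y ∣
    exchange⇒equal-size {x} {y} ox oy {c} {d} c∈C d∈C c∈x c∉y d∉x d∈y =
      trans (∣p-x∣ (A x) (A⁺ ox c∈C c∈x)) (trans (cong (suc ∘ ∣_∣) (⊆-antisym sub sup)) (sym (∣p-x∣ (A y) (A⁺ oy d∈C d∈y))))
      where
      sub : A x - c ⊆ A y - d
      sub {z} h with -⁻ h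
      ... | z∈ , z≢c = -⁺ (A⁺ oy (A⊆C ox z∈) (decidable-stable (z ∈? T y) λ z∉ →
            z≢c (Exchange.unique ox oy c∈C d∈C c∈x c∉y d∉x d∈y (A⊆C ox z∈) (A⁻ z∈) z∉)))
            λ { refl → d∉x (A⁻ z∈) }
      sup : A y - d ⊆ A x - c
      sup {z} h with -⁻ h
      ... | z∈ , z≢d = -⁺ (A⁺ ox (A⊆C oy z∈) (decidable-stable (z ∈? T x) λ z∉ →
            z≢d (Exchange.unique oy ox d∈C c∈C d∈y d∉x c∉y c∈x (A⊆C oy z∈) (A⁻ z∈) z∉)))
            λ { refl → c∉y (A⁻ z∈) }

    -- Incomparable sides differ by a single exchange and so have equal size. Sides of different
    -- size are therefore nested.
    smaller⇒⊆ : ∀ {x y} → Out x → Out y → ∣ A x ∣ < ∣ A y ∣ → ∀ {c} → c ∈ C → c ∈ T x → c ∈ T y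
    smaller⇒⊆ {x} {y} ox oy lt {c} c∈C c∈x = decidable-stable (c ∈? T y) λ c∉y → go c∉y (⊆⊎∃ (A y) (A x))
      where
      go : c ∉ T y → ¬ (A y ⊆ A x ⊎ ∃ λ d → d ∈ A y × d ∉ A x)
      go c∉y (inj₁ sub) = ℕ.<⇒≱ lt (p⊆q⇒∣p∣≤∣q∣ {p = A y} {q = A x} sub)
      go c∉y (inj₂ (d , d∈ , d∉)) = ℕ.<-irrefl (exchange⇒equal-size ox oy c∈C (A⊆C oy d∈) c∈x c∉y
        (λ h → d∉ (A⁺ ox (A⊆C oy d∈) h)) (A⁻ d∈)) lt

    -- The union of the smaller sides and the elements inducing them would be one part of a 2-separation.
    not-smaller : ∀ {x y} → Out x → Out y → ¬ ∣ A x ∣ < ∣ A y ∣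
    not-smaller {x} {y} ox oy lt = no-separation-along M 3c cC {X} X⊆E
      (2≤∣p∣ {p = X} (set⁺ inX? (inj₂ (e∈C , x , small-x , IsSide.e∈T (isSide ox)))) (set⁺ inX? (inj₁ small-x))
        λ { refl → proj₂ ox e∈C })
      (2≤∣p∣ {p = E M ─ X} (x∈p∧x∉q⇒x∈p─q (proj₁ cC f∈C) f∉X) (x∈p∧x∉q⇒x∈p─q (proj₁ oy) y∉X) λ { refl → proj₂ oy f∈C })
      (circuit-indep M cC (λ h → proj₁ (∩⁻ h)) f∈C (λ h → f∉X (proj₂ (∩⁻ h)))) inner
      (circuit-indep M cC (λ h → proj₁ (─⁻ h)) e∈C (λ h → proj₂ (─⁻ {p = C} h) (set⁺ inX? (inj₂ (e∈C , x , small-x , IsSide.e∈T (isSide ox))))) ,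
       outer)
      where
      Small : Fin N → Set
      Small z = Out z × ∣ A z ∣ ≤ ∣ A x ∣
      small? : ∀ z → Dec (Small z)
      small? z = out? z ×-dec (∣ A z ∣ ℕ.≤? ∣ A x ∣)
      InX : Fin N → Set
      InX z = Small z ⊎ (z ∈ C × ∃ λ z′ → Small z′ × z ∈ T z′)
      inX? : ∀ z → Dec (InX z)
      inX? z = small? z ⊎-dec ((z ∈? C) ×-dec any? λ z′ → small? z′ ×-dec (z ∈? T z′))
      X = set inX?
      small-x : Small x
      small-x = ox , ℕ.≤-refl
      X⊆E : X ⊆ E M
      X⊆E h with set⁻ inX? h
      ... | inj₁ ((z∈ , _) , _) = z∈
      ... | inj₂ (z∈C , _) = proj₁ cC z∈C
      f∉X : f ∉ X
      f∉X h with set⁻ inX? h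
      ... | inj₁ ((_ , f∉C) , _) = f∉C f∈C
      ... | inj₂ (_ , z′ , (oz , _) , f∈) = IsSide.f∉T (isSide oz) f∈
      y∉X : y ∉ X
      y∉X h with set⁻ inX? h
      ... | inj₁ (_ , le) = ℕ.<⇒≱ lt le
      ... | inj₂ (y∈C , _) = proj₂ oy y∈C
      inner : ∀ {z} → z ∈ X → z ∉ C → ¬ Ind ((C ∩ X) ∪ ⁅ z ⁆)
      inner {z} z∈X z∉C i with set⁻ inX? z∈X
      ... | inj₂ (z∈C , _) = z∉C z∈C
      ... | inj₁ sz@(oz , _) = Cyc⇒dep cycle (z , x∈T) (hereditary sub i)
        where
        open IsSide (isSide oz)
        sub : T z ⊆ (C ∩ X) ∪ ⁅ z ⁆
        sub h with insert⁻ (T⊆ h)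
        ... | inj₁ h∈C = ∈∪ˡ (∩⁺ h∈C (set⁺ inX? (inj₂ (h∈C , z , sz , h))))
        ... | inj₂ refl = insert-new
      outer : ∀ {z} → z ∈ E M → z ∉ X → z ∉ C → ¬ Ind ((C ─ X) ∪ ⁅ z ⁆)
      outer {z} z∈E z∉X z∉C i = Cyc⇒dep (Cyc-⊕ cycle (circuit⇒Cyc cC)) (z , ⊕⁺ˡ x∈T z∉C) (hereditary sub i)
        where
        oz : Out z
        oz = z∈E , z∉C
        open IsSide (isSide oz)
        larger : ∣ A x ∣ < ∣ A z ∣
        larger = ℕ.≰⇒> λ le → z∉X (set⁺ inX? (inj₁ (oz , le)))
        -- The side of `z` is larger than all the small ones, so it contains them. What it leaves of
        -- `C` avoids `X`.
        sub : T z ⊕ C ⊆ (C ─ X) ∪ ⁅ z ⁆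
        sub h with ⊕⁻ h
        ... | inj₁ (h∈T , h∉C) with T-self oz h∈T h∉C
        ... | refl = insert-new
        sub h | inj₂ (h∉T , h∈C) = ∈∪ˡ (x∈p∧x∉q⇒x∈p─q h∈C h∉X)
          where
          h∉X : _ ∉ X
          h∉X h∈X with set⁻ inX? h∈X
          ... | inj₁ ((_ , h∉C) , _) = h∉C h∈C
          ... | inj₂ (_ , z′ , (oz′ , le) , h∈z′) = h∉T (smaller⇒⊆ oz′ oz (ℕ.≤-<-trans le larger) h∈C h∈z′)

    equal-size : ∀ {x y} → Out x → Out y → ∣ A x ∣ ≡ ∣ A y ∣
    equal-size ox oy = ℕ.≤-antisym (ℕ.≮⇒≥ (not-smaller oy ox)) (ℕ.≮⇒≥ (not-smaller ox oy))

    -- Nested sides of equal size coincide, and then `T x ⊕ T y` is a cycle inside the pair of `x`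
    -- and `y`.
    incomparable : ∀ {x y} → Out x → Out y → x ≢ y → ∃ λ c → c ∈ C × c ∈ T x × c ∉ T y
    incomparable {x} {y} ox oy x≢y with ⊆⊎∃ (A x) (A y)
    ... | inj₂ (c , c∈ , c∉) = c , A⊆C ox c∈ , A⁻ c∈ , λ h → c∉ (A⁺ oy (A⊆C ox c∈) h)
    ... | inj₁ sub = ⊥-elim (no-short-cycle (Cyc-⊕ (IsSide.cycle (isSide ox)) (IsSide.cycle (isSide oy)))
            (x , ⊕⁺ˡ (IsSide.x∈T (isSide ox)) (λ h → x≢y (T-self oy h (proj₂ ox)))) (proj₁ ox) (proj₁ oy) x≢y short)
      where
      sup : A y ⊆ A x
      sup = ⊆-∣∣⇒≡ sub (ℕ.≤-reflexive (equal-size oy ox))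
      short : T x ⊕ T y ⊆ pair x y
      short {z} h with ⊕⁻ h | z ∈? C
      ... | inj₁ (a , b) | yes z∈C = contradiction (A⁻ (sub (A⁺ ox z∈C a))) b
      ... | inj₁ (a , b) | no z∉C with T-self ox a z∉C
      ... | refl = pairˡ
      short {z} h | inj₂ (a , b) | yes z∈C = contradiction (A⁻ (sup (A⁺ oy z∈C b))) a
      short {z} h | inj₂ (a , b) | no z∉C with T-self oy b z∉C
      ... | refl = pairʳ

    difference-unique : ∀ {x y} → Out x → Out y → ∀ {c c′} → c ∈ C → c′ ∈ C →
      c ∈ T x → c ∉ T y → c′ ∈ T x → c′ ∉ T y → c′ ≡ c
    difference-unique {x} {y} ox oy c∈C c′∈C c∈x c∉y c′∈x c′∉y with incomparable oy ox (λ { refl → c∉y c∈x })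
    ... | d , d∈C , d∈y , d∉x = Exchange.unique ox oy c∈C d∈C c∈x c∉y d∉x d∈y c′∈C c′∈x c′∉y

    -- If no side told `c` from `c′`, every element outside `C` would be spanned by `C ─ pair c c′`,
    -- through its side or the complementary one. The pair would then be one part of a 2-separation.
    separated : ∀ {c c′} → c ∈ C → c′ ∈ C → c ≢ c′ →
      ∃ λ x → Out x × ((c ∈ T x × c′ ∉ T x) ⊎ (c ∉ T x × c′ ∈ T x))
    separated {c} {c′} c∈C c′∈C c≢c′ with any? (λ x → out? x ×-dec
      (((c ∈? T x) ×-dec ¬? (c′ ∈? T x)) ⊎-dec (¬? (c ∈? T x) ×-dec (c′ ∈? T x))))
    ... | yes h = h
    ... | no none = ⊥-elim (no-separation-along M 3c cC {pair c c′} P⊆E (ℕ.≤-reflexive (sym (∣pair∣ c≢c′)))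
            (∣─pair∣ (E M) 4≤ c c′) (hereditary (λ h → proj₂ (∩⁻ {p = C} h)) (np (proj₁ cC c∈C) (proj₁ cC c′∈C) c≢c′))
            (λ h z∉C → contradiction (pair⊆ c∈C c′∈C h) z∉C)
            (circuit-indep M cC (λ h → proj₁ (─⁻ h)) c∈C (λ h → proj₂ (─⁻ {p = C} h) pairˡ) , outer))
      where
      P⊆E : pair c c′ ⊆ E M
      P⊆E = pair⊆ (proj₁ cC c∈C) (proj₁ cC c′∈C)
      outer : ∀ {z} → z ∈ E M → z ∉ pair c c′ → z ∉ C → ¬ Ind ((C ─ pair c c′) ∪ ⁅ z ⁆)
      outer {z} z∈E z∉P z∉C i with c ∈? T z | c′ ∈? T z
      ... | yes a | no b = none (z , (z∈E , z∉C) , inj₁ (a , b))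
      ... | no a | yes b = none (z , (z∈E , z∉C) , inj₂ (a , b))
      ... | yes a | yes b = Cyc⇒dep (Cyc-⊕ cycle (circuit⇒Cyc cC)) (z , ⊕⁺ˡ x∈T z∉C) (hereditary sub i)
        where
        open IsSide (isSide (z∈E , z∉C))
        sub : T z ⊕ C ⊆ (C ─ pair c c′) ∪ ⁅ z ⁆
        sub h with ⊕⁻ h
        ... | inj₁ (h∈T , h∉C) with T-self (z∈E , z∉C) h∈T h∉C
        ... | refl = insert-new
        sub h | inj₂ (h∉T , h∈C) = ∈∪ˡ (x∈p∧x∉q⇒x∈p─q h∈C λ hp → h∉T (pair⊆ a b hp))
      ... | no a | no b = Cyc⇒dep cycle (z , x∈T) (hereditary sub i)
        where
        open IsSide (isSide (z∈E , z∉C))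
        sub : T z ⊆ (C ─ pair c c′) ∪ ⁅ z ⁆
        sub {y} h with insert⁻ (T⊆ h)
        ... | inj₂ refl = insert-new
        ... | inj₁ h∈C = ∈∪ˡ (x∈p∧x∉q⇒x∈p─q h∈C λ hp → no-pair hp h)
          where
          no-pair : y ∈ pair c c′ → y ∉ T z
          no-pair hp with pair⁻ hp
          ... | inj₁ refl = a
          ... | inj₂ refl = b

    excluded : ∀ {c} → c ∈ C → c ≢ e → ∃ λ x → Out x × c ∉ T x
    excluded c∈C c≢e with separated c∈C e∈C c≢e
    ... | x , ox , inj₁ (_ , e∉) = contradiction (IsSide.e∈T (isSide ox)) e∉
    ... | x , ox , inj₂ (c∉ , _) = x , ox , c∉

    included : ∀ {c} → c ∈ C → c ≢ f → ∃ λ x → Out x × c ∈ T x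
    included c∈C c≢f with separated c∈C f∈C c≢f
    ... | x , ox , inj₁ (c∈ , _) = x , ox , c∈
    ... | x , ox , inj₂ (_ , f∈) = contradiction f∈ (IsSide.f∉T (isSide ox))

    -- Some side contains `c` and another does not; exchanging between them gives a circuit that
    -- drops `c`. This is what excludes bad pairs in 3-connected labels.
    circuit-avoiding : ∀ {c} → c ∈ C → c ≢ e → c ≢ f → ∃ λ D → IsCircuit M D × e ∈ D × f ∈ D × c ∉ D
    circuit-avoiding {c} c∈C c≢e c≢f with excluded c∈C c≢e | included c∈C c≢f
    ... | y , oy , c∉y | x , ox , c∈x with incomparable oy ox (λ { refl → c∉y c∈x })
    ... | d , d∈C , d∈y , d∉x = X.D , X.circuit-D , X.e∈D , X.f∈D , X.c∉D
      where module X = Exchange ox oy c∈C d∈C c∈x c∉y d∉x d∈y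

    AtMostOneLeg : Fin N → Set
    AtMostOneLeg x = ∀ {c d} → c ∈ C → d ∈ C → c ≢ e → d ≢ e → c ∈ T x → d ∈ T x → c ≡ d

    -- The single leg `b` of the side of `x` is missing from the side of `y`. Hence all legs of `y`
    -- lie in the difference of the two sides, which has one element.
    atMostOneLeg-all : ∀ {x y} → Out x → Out y → AtMostOneLeg x → AtMostOneLeg y
    atMostOneLeg-all {x} {y} ox oy one {c} {d} c∈C d∈C c≢e d≢e c∈y d∈y with x ≟ y
    ... | yes refl = one c∈C d∈C c≢e d≢e c∈y d∈y
    ... | no x≢y with incomparable ox oy x≢y
    ... | b , b∈C , b∈x , b∉y = difference-unique oy ox d∈C c∈C d∈y (new d∈C d≢e d∈y) c∈y (new c∈C c≢e c∈y)
      where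
      new : ∀ {c} → c ∈ C → c ≢ e → c ∈ T y → c ∉ T x
      new c∈C c≢e c∈y c∈x = b∉y (subst (_∈ T y) (one c∈C b∈C c≢e (λ { refl → b∉y (IsSide.e∈T (isSide oy)) }) c∈x b∈x) c∈y)

    -- Sets of one size that pairwise differ by an exchange form a clique of a Johnson graph: they
    -- share all but one of their elements, or they lie in a set with one element more. Here `e` is
    -- the only element of `C` in all sides and `f` the only one in none, so sides or complements
    -- have two elements. The module refutes a side failing both.
    module TwoTwo {x} (ox : Out x) {c₁ c₂ d₁ d₂}
      (c₁∈C : c₁ ∈ C) (c₂∈C : c₂ ∈ C) (c₁≢e : c₁ ≢ e) (c₂≢e : c₂ ≢ e) (c₁∈x : c₁ ∈ T x) (c₂∈x : c₂ ∈ T x) (c₁≢c₂ : c₁ ≢ c₂)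
      (d₁∈C : d₁ ∈ C) (d₂∈C : d₂ ∈ C) (d₁≢f : d₁ ≢ f) (d₂≢f : d₂ ≢ f) (d₁∉x : d₁ ∉ T x) (d₂∉x : d₂ ∉ T x) (d₁≢d₂ : d₁ ≢ d₂) where

      -- The sides T y₁ and T y₂ gain the same element d over T x, as otherwise they would differ in two elements.
      absurd : False
      absurd with excluded c₁∈C c₁≢e | excluded c₂∈C c₂≢e
      ... | y₁ , oy₁ , c₁∉y₁ | y₂ , oy₂ , c₂∉y₂
        with incomparable oy₁ ox (λ { refl → c₁∉y₁ c₁∈x }) | incomparable oy₂ ox (λ { refl → c₂∉y₂ c₂∈x })
      ... | g₁ , g₁∈C , g₁∈y₁ , g₁∉x | g₂ , g₂∈C , g₂∈y₂ , g₂∉x with g₁ ≟ g₂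
      ... | no g₁≢g₂ = g₁∉x (subst (_∈ T x) (sym (difference-unique oy₁ oy₂ c₂∈C g₁∈C c₂∈y₁ c₂∉y₂ g₁∈y₁ g₁∉y₂)) c₂∈x)
        where
        c₂∈y₁ : c₂ ∈ T y₁
        c₂∈y₁ = decidable-stable (c₂ ∈? T y₁) λ h → c₁≢c₂ (sym (difference-unique ox oy₁ c₁∈C c₂∈C c₁∈x c₁∉y₁ c₂∈x h))
        g₁∉y₂ : g₁ ∉ T y₂
        g₁∉y₂ h = g₁≢g₂ (difference-unique oy₂ ox g₂∈C g₁∈C g₂∈y₂ g₂∉x h g₁∉x)
      ... | yes refl = pick-d
        where
        -- The side of `y` arises from that of `x` by trading `c` for `g₁`, and that of `z` by
        -- trading `b` for `d`. As `c ≢ b` and `d ≢ g₁`, both `c` and `d` lie in `T z` and not in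
        -- `T y`, one element too many.
        clash : ∀ {y c d} → Out y → c ∈ C → c ∈ T x → c ∉ T y → g₁ ∈ T y → d ∈ C → d ∉ T x → d ≢ g₁ →
          ∀ {z} → Out z → d ∈ T z → ∀ {b} → b ∈ C → b ∈ T x → b ∉ T z → c ≢ b → False
        clash {y} {c} {d} oy c∈C c∈x c∉y g∈y d∈C d∉x d≢g {z} oz d∈z {b} b∈C b∈x b∉z c≢b =
          d∉x (subst (_∈ T x) (sym (difference-unique oz oy c∈C d∈C c∈z c∉y d∈z d∉y)) c∈x)
          where
          c∈z : c ∈ T z
          c∈z = decidable-stable (c ∈? T z) λ h → c≢b (difference-unique ox oz b∈C c∈C b∈x b∉z c∈x h)
          d∉y : d ∉ T y
          d∉y h = d≢g (difference-unique oy ox g₁∈C d∈C g∈y g₁∉x h d∉x)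
        pick-c : ∀ {d} → d ∈ C → d ∉ T x → d ≢ g₁ → d ≢ f → False
        pick-c d∈C d∉x d≢g d≢f with included d∈C d≢f
        ... | z , oz , d∈z with incomparable ox oz (λ { refl → d∉x d∈z })
        ... | b , b∈C , b∈x , b∉z with c₁ ≟ b
        ... | no c₁≢b = clash oy₁ c₁∈C c₁∈x c₁∉y₁ g₁∈y₁ d∈C d∉x d≢g oz d∈z b∈C b∈x b∉z c₁≢b
        ... | yes refl = clash oy₂ c₂∈C c₂∈x c₂∉y₂ g₂∈y₂ d∈C d∉x d≢g oz d∈z b∈C b∈x b∉z (c₁≢c₂ ∘ sym)
        pick-d : False
        pick-d with d₁ ≟ g₁
        ... | no d₁≢g = pick-c d₁∈C d₁∉x d₁≢g d₁≢f
        ... | yes refl = pick-c d₂∈C d₂∉x (d₁≢d₂ ∘ sym) d₂≢f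

    spikeStructure : (∀ {x} → Out x → AtMostOneLeg x) → SpikeStructure M B e f
    spikeStructure one = record
      { C = C ; circuit = cC ; t∈C = e∈C ; s∈C = f∈C ; t≢s = e≢f
      ; partner = partner
      ; partner∈ = λ l → proj₁ (partner-spec l)
      ; partner-injective = λ {c} {d} lc ld eq → one (proj₁ (partner-spec lc)) (proj₁ lc) (proj₁ ld) (proj₁ (proj₂ lc)) (proj₁ (proj₂ ld))
          (proj₂ (partner-spec lc)) (subst (λ x → d ∈ T x) (sym eq) (proj₂ (partner-spec ld)))
      ; partner-surjective = λ x∈ x∉ → surj (x∈ , x∉)
      ; triangle = λ l → subst Cyc (T≡ (proj₁ (partner-spec l)) (proj₁ l) (proj₁ (proj₂ l)) (proj₂ (partner-spec l)))
                           (IsSide.cycle (isSide (proj₁ (partner-spec l))))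
      ; two-legs = two
      }
      where
      Leg : Fin N → Set
      Leg c = c ∈ C × c ≢ e × c ≢ f
      Partner : Fin N → Fin N → Set
      Partner c x = Out x × c ∈ T x
      partner? : ∀ c → Dec (∃ (Partner c))
      partner? c = any? λ x → out? x ×-dec (c ∈? T x)
      partner : Fin N → Fin N
      partner c with partner? c
      ... | yes (x , _) = x
      -- A junk value: a leg always lies in some side, by `included`.
      ... | no _ = c
      partner-spec : ∀ {c} → Leg c → Partner c (partner c)
      partner-spec {c} (c∈C , _ , c≢f) with partner? c
      ... | yes (_ , h) = h
      ... | no none = contradiction (included c∈C c≢f) none
      T≡ : ∀ {x c} → Out x → c ∈ C → c ≢ e → c ∈ T x → T x ≡ pair e c ∪ ⁅ x ⁆
      T≡ {x} {c} ox c∈C c≢e c∈x = ⊆-antisym sub (insert⊆ (pair⊆ (IsSide.e∈T (isSide ox)) c∈x) (IsSide.x∈T (isSide ox)))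
        where
        sub : T x ⊆ pair e c ∪ ⁅ x ⁆
        sub {z} h with insert⁻ (IsSide.T⊆ (isSide ox) h)
        ... | inj₂ refl = insert-new
        ... | inj₁ z∈C with z ≟ e
        ... | yes refl = ∈∪ˡ pairˡ
        ... | no z≢e with one ox z∈C c∈C z≢e c≢e h c∈x
        ... | refl = ∈∪ˡ pairʳ
      leg-of : ∀ {x} → Out x → ∃ λ c → Leg c × c ∈ T x
      leg-of {x} ox with ⊆⊎∃ (T x) (pair x e)
      ... | inj₁ sub = ⊥-elim (no-short-cycle (IsSide.cycle (isSide ox)) (x , IsSide.x∈T (isSide ox)) (proj₁ ox) (proj₁ cC e∈C)
                        (λ { refl → proj₂ ox e∈C }) sub)
      ... | inj₂ (c , c∈x , c∉) with insert⁻ (IsSide.T⊆ (isSide ox) c∈x)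
      ... | inj₂ refl = contradiction pairˡ c∉
      ... | inj₁ c∈C = c , (c∈C , (λ { refl → c∉ pairʳ }) , λ { refl → IsSide.f∉T (isSide ox) c∈x }) , c∈x
      surj : ∀ {x} → Out x → ∃ λ c → Leg c × partner c ≡ x
      surj {x} ox with leg-of ox
      ... | c , lc , c∈x = c , lc , decidable-stable (partner c ≟ x) λ ≢x → go ≢x
        where
        y = partner c
        oy = proj₁ (partner-spec lc)
        c∈y = proj₂ (partner-spec lc)
        go : y ≢ x → False
        go y≢x with incomparable oy ox y≢x
        ... | b , b∈C , b∈y , b∉x with one oy b∈C (proj₁ lc) (λ { refl → b∉x (IsSide.e∈T (isSide ox)) }) (proj₁ (proj₂ lc)) b∈y c∈y
        ... | refl = b∉x c∈x
      two : ∃₂ λ c d → Leg c × Leg d × c ≢ d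
      two with included e∈C e≢f
      ... | x , ox , _ with leg-of ox
      ... | c , lc , c∈x with ⊆⊎∃ (T x ⊕ C) (pair x f)
      ... | inj₁ sub = ⊥-elim (no-short-cycle (Cyc-⊕ (IsSide.cycle (isSide ox)) (circuit⇒Cyc cC))
                        (x , ⊕⁺ˡ (IsSide.x∈T (isSide ox)) (proj₂ ox)) (proj₁ ox) (proj₁ cC f∈C) (λ { refl → proj₂ ox f∈C }) sub)
      ... | inj₂ (d , d∈ , d∉) with ⊕⁻ d∈
      ... | inj₁ (d∈x , d∉C) with T-self ox d∈x d∉C
      ... | refl = contradiction pairˡ d∉
      two | x , ox , _ | c , lc , c∈x | inj₂ (d , d∈ , d∉) | inj₂ (d∉x , d∈C) =
        c , d , lc , (d∈C , (λ { refl → d∉x (IsSide.e∈T (isSide ox)) }) , λ { refl → d∉ pairʳ }) , λ { refl → d∉x c∈x }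

  module _ {e f} (e∈C : e ∈ C) (f∈C : f ∈ C) (e≢f : e ≢ f) (q : CircuitsSpan M e f) where
    private
      T : Fin N → Subset N
      T x with out? x
      ... | yes ox = proj₁ (∃side e∈C f∈C q ox)
      ... | no _ = ⊥
      isSide : ∀ {x} → Out x → IsSide e f x (T x)
      isSide {x} ox with out? x
      ... | yes ox′ = proj₂ (∃side e∈C f∈C q ox′)
      ... | no no′ = contradiction ox no′
      module F = Family e∈C f∈C e≢f q T isSide
      module F′ = Family f∈C e∈C (e≢f ∘ sym) (circuitsSpan-sym {M = M} q) (λ x → T x ⊕ C) (λ ox → side-swap e∈C f∈C (proj₂ ox) (isSide ox))

    circuit-avoiding : ∀ {c} → c ∈ C → c ≢ e → c ≢ f → ∃ λ D → IsCircuit M D × e ∈ D × f ∈ D × c ∉ D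
    circuit-avoiding = F.circuit-avoiding

    -- Two sides differ by an exchange, so all of them have two elements or all of their complements do.
    ∃spikeStructure : SpikeStructure M B e f ⊎ SpikeStructure M B f e
    ∃spikeStructure with F.included e∈C e≢f
    ... | x , ox , _ with any? (λ c → any? λ d →
      (c ∈? C) ×-dec (d ∈? C) ×-dec ¬? (c ≟ e) ×-dec ¬? (d ≟ e) ×-dec (c ∈? T x) ×-dec (d ∈? T x) ×-dec ¬? (c ≟ d))
    ... | no none = inj₁ (F.spikeStructure λ oy → F.atMostOneLeg-all ox oy λ {c} {d} a b a′ b′ a″ b″ →
          decidable-stable (c ≟ d) λ c≢d → none (c , d , a , b , a′ , b′ , a″ , b″ , c≢d))
    ... | yes (c , d , c∈C , d∈C , c≢e , d≢e , c∈x , d∈x , c≢d) =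
      inj₂ (F′.spikeStructure λ oy → F′.atMostOneLeg-all ox oy λ {c′} {d′} c′∈C d′∈C c′≢f d′≢f c′∈ d′∈ →
          decidable-stable (c′ ≟ d′) λ c′≢d′ → F.TwoTwo.absurd ox c∈C d∈C c≢e d≢e c∈x d∈x c≢d
            c′∈C d′∈C c′≢f d′≢f (λ h → ⊕∉₂ h c′∈C c′∈) (λ h → ⊕∉₂ h d′∈C d′∈) c′≢d′)

-- Isomorphisms, circuit labels and cocircuit labels

∈-≡ : ∀ {S : Subset K} {s t : ∃ (_∈ S)} → proj₁ s ≡ proj₁ t → s ≡ t
∈-≡ {s = _ , p} {_ , q} refl = cong (_ ,_) ([]=-irrelevant p q)

enum : ∀ (S : Subset K) → Fin ∣ S ∣ ↔ ∃ (_∈ S)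
enum [] = mk↔ₛ′ (λ ()) (λ { (() , _) }) (λ { (() , _) }) λ ()
enum {K = suc K} (inside ∷ S) = mk↔ₛ′ to from to∘from from∘to
  where
  module I = Inverse (enum S)
  to : Fin (suc ∣ S ∣) → ∃ (_∈ (inside ∷ S))
  to zero = zero , here
  to (suc i) = suc (proj₁ (I.to i)) , there (proj₂ (I.to i))
  from : ∃ (_∈ (inside ∷ S)) → Fin (suc ∣ S ∣)
  from (zero , _) = zero
  from (suc x , there p) = suc (I.from (x , p))
  to∘from : ∀ s → to (from s) ≡ s
  to∘from (zero , here) = refl
  to∘from (suc x , there p) = ∈-≡ (cong (suc ∘ proj₁) (I.strictlyInverseˡ (x , p)))
  from∘to : ∀ i → from (to i) ≡ i
  from∘to zero = refl
  from∘to (suc i) = cong suc (I.strictlyInverseʳ i)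
enum {K = suc K} (outside ∷ S) = mk↔ₛ′ to from to∘from from∘to
  where
  module I = Inverse (enum S)
  to : Fin ∣ S ∣ → ∃ (_∈ (outside ∷ S))
  to i = suc (proj₁ (I.to i)) , there (proj₂ (I.to i))
  from : ∃ (_∈ (outside ∷ S)) → Fin ∣ S ∣
  from (suc x , there p) = I.from (x , p)
  to∘from : ∀ s → to (from s) ≡ s
  to∘from (suc x , there p) = ∈-≡ (cong (suc ∘ proj₁) (I.strictlyInverseˡ (x , p)))
  from∘to : ∀ i → from (to i) ≡ i
  from∘to i = I.strictlyInverseʳ i

enum-⊤ : Fin K ↔ ∃ (_∈ ⊤ {K})
enum-⊤ = mk↔ₛ′ (λ x → x , ∈⊤) proj₁ (λ _ → ∈-≡ refl) (λ _ → refl)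

-- An isomorphism given by maps on the whole universes, with junk values off the ground sets.
record Iso (S : SetSystem N) (S′ : SetSystem K) : Set where
  field
    h : Fin N → Fin K
    g : Fin K → Fin N
    h∈ : ∀ {a} → a ∈ ground S → h a ∈ ground S′
    g∈ : ∀ {b} → b ∈ ground S′ → g b ∈ ground S
    gh : ∀ {a} → a ∈ ground S → g (h a) ≡ a
    hg : ∀ {b} → b ∈ ground S′ → h (g b) ≡ b
    indep : ∀ X Y → X ⊆ ground S → Y ⊆ ground S′ → (∀ a → a ∈ ground S → a ∈ X ⇔ h a ∈ Y) →
            Indep S X ⇔ Indep S′ Y

  preimage : Subset K → Subset N
  preimage Y = set λ x → (x ∈? ground S) ×-dec (h x ∈? Y)

  preimage⁺ : ∀ {Y x} → x ∈ ground S → h x ∈ Y → x ∈ preimage Y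
  preimage⁺ {Y} x∈ hx∈ = set⁺ (λ x → (x ∈? ground S) ×-dec (h x ∈? Y)) (x∈ , hx∈)

  preimage⁻ : ∀ {Y x} → x ∈ preimage Y → x ∈ ground S × h x ∈ Y
  preimage⁻ {Y} = set⁻ (λ x → (x ∈? ground S) ×-dec (h x ∈? Y))

  image : Subset N → Subset K
  image X = set λ y → (y ∈? ground S′) ×-dec (g y ∈? X)

  image⁺ : ∀ {X y} → y ∈ ground S′ → g y ∈ X → y ∈ image X
  image⁺ {X} y∈ gy∈ = set⁺ (λ y → (y ∈? ground S′) ×-dec (g y ∈? X)) (y∈ , gy∈)

  image⁻ : ∀ {X y} → y ∈ image X → y ∈ ground S′ × g y ∈ X
  image⁻ {X} = set⁻ (λ y → (y ∈? ground S′) ×-dec (g y ∈? X))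

  h∈image : ∀ {X x} → X ⊆ ground S → x ∈ X → h x ∈ image X
  h∈image X⊆ x∈ = image⁺ (h∈ (X⊆ x∈)) (subst (_∈ _) (sym (gh (X⊆ x∈))) x∈)

  indep-image : ∀ {X} → X ⊆ ground S → Indep S X ⇔ Indep S′ (image X)
  indep-image {X} X⊆ = indep X (image X) X⊆ (proj₁ ∘ image⁻) λ a a∈ →
    mk⇔ (h∈image X⊆) λ ha → subst (_∈ X) (gh a∈) (proj₂ (image⁻ ha))

  indep-preimage : ∀ {Y} → Y ⊆ ground S′ → Indep S (preimage Y) ⇔ Indep S′ Y
  indep-preimage {Y} Y⊆ = indep (preimage Y) Y (proj₁ ∘ preimage⁻) Y⊆ λ a a∈ → mk⇔ (proj₂ ∘ preimage⁻) (preimage⁺ a∈)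

module _ {S : SetSystem N} {S′ : SetSystem K} where

  Iso⇒≅ : Iso S S′ → S ≅ S′
  Iso⇒≅ I = record
    { bijection = mk↔ₛ′ (λ (a , a∈) → h a , h∈ a∈) (λ (b , b∈) → g b , g∈ b∈)
        (λ (b , b∈) → ∈-≡ (hg b∈)) (λ (a , a∈) → ∈-≡ (gh a∈))
    ; preserves = λ X Y X⊆ Y⊆ c → indep X Y X⊆ Y⊆ c }
    where open Iso I

  module _ (φ : S ≅ S′) (a₀ : Fin N) (b₀ : Fin K) where
    private
      module φ = Inverse (_≅_.bijection φ)
      h : Fin N → Fin K
      h a with a ∈? ground S
      ... | yes a∈ = proj₁ (φ.to (a , a∈))
      ... | no _ = b₀
      g : Fin K → Fin N
      g b with b ∈? ground S′
      ... | yes b∈ = proj₁ (φ.from (b , b∈))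
      ... | no _ = a₀
      h≡ : ∀ {a} (a∈ : a ∈ ground S) → h a ≡ proj₁ (φ.to (a , a∈))
      h≡ {a} a∈ with a ∈? ground S
      ... | yes a∈′ = cong (proj₁ ∘ φ.to) (∈-≡ refl)
      ... | no a∉ = contradiction a∈ a∉
      g≡ : ∀ {b} (b∈ : b ∈ ground S′) → g b ≡ proj₁ (φ.from (b , b∈))
      g≡ {b} b∈ with b ∈? ground S′
      ... | yes b∈′ = cong (proj₁ ∘ φ.from) (∈-≡ refl)
      ... | no b∉ = contradiction b∈ b∉

    ≅⇒Iso : Iso S S′
    ≅⇒Iso = record
      { h = h ; g = g
      ; h∈ = λ a∈ → subst (_∈ ground S′) (sym (h≡ a∈)) (proj₂ (φ.to (_ , a∈)))
      ; g∈ = λ b∈ → subst (_∈ ground S) (sym (g≡ b∈)) (proj₂ (φ.from (_ , b∈)))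
      ; gh = λ {a} a∈ → trans (cong g (h≡ a∈)) (trans (g≡ (proj₂ (φ.to (a , a∈)))) (cong proj₁ (φ.strictlyInverseʳ (a , a∈))))
      ; hg = λ {b} b∈ → trans (cong h (g≡ b∈)) (trans (h≡ (proj₂ (φ.from (b , b∈)))) (cong proj₁ (φ.strictlyInverseˡ (b , b∈))))
      ; indep = λ X Y X⊆ Y⊆ c → _≅_.preserves φ X Y X⊆ Y⊆ λ a a∈ →
          mk⇔ (λ x → subst (_∈ Y) (h≡ a∈) (Equivalence.to (c a a∈) x))
              (λ y → Equivalence.from (c a a∈) (subst (_∈ Y) (sym (h≡ a∈)) y))
      }

    ≅⇒Iso-h : ∀ {a} (a∈ : a ∈ ground S) → Iso.h ≅⇒Iso a ≡ _≅_.to φ (a , a∈)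
    ≅⇒Iso-h = h≡

≅U⇒size : ∀ {M : Matroid N} {j k} → system M ≅ U j k → ∣ E M ∣ ≡ k
≅U⇒size {M = M} φ = ↔⇒≡ (↔-trans (enum (E M)) (↔-trans (_≅_.bijection φ) (↔-sym enum-⊤)))

circuitOfSize⇒whole : ∀ (M : Matroid N) {k} → Nonempty (E M) → IsCircuitOfSize k M → IsCircuit M (E M)
circuitOfSize⇒whole M {suc k} (a₀ , _) (_ , φ) = (λ z → z) , dep , min
  where
  open Iso (≅⇒Iso φ a₀ zero)
  dep : ¬ Matroid.Indep M (E M)
  dep i = ℕ.<-irrefl refl (ℕ.≤-trans (ℕ.≤-reflexive (sym (∣⊤∣≡n (suc k))))
    (Equivalence.to (indep (E M) ⊤ id id λ a a∈ → mk⇔ (λ _ → ∈⊤) (λ _ → a∈)) i))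
  min : ∀ D → D ⊂ E M → Matroid.Indep M D
  min D (D⊆ , x , x∈ , x∉) = Equivalence.from (indep-image D⊆) (s≤s⁻¹ (ℕ.≤-trans
    (p⊂q⇒∣p∣<∣q∣ {p = image D} {q = ⊤} ((λ _ → ∈⊤) , h x , ∈⊤ , λ hx → x∉ (subst (_∈ D) (gh x∈) (proj₂ (image⁻ hx)))))
    (ℕ.≤-reflexive (∣⊤∣≡n (suc k)))))

whole⇒circuitMatroid : ∀ (M : Matroid N) → IsCircuit M (E M) → IsCircuitMatroid M
whole⇒circuitMatroid M cE with circuit-nonempty M cE
... | a₀ , a₀∈ = ∣ E M ∣ , size , Iso⇒≅ iso
  where
  module e = Inverse (enum (E M))
  size : 1 ≤ ∣ E M ∣
  size = ℕ.≤-trans (s≤s z≤n) (ℕ.≤-reflexive (sym (∣p-x∣ (E M) a₀∈)))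
  h : Fin _ → Fin ∣ E M ∣
  h a with a ∈? E M
  ... | yes a∈ = e.from (a , a∈)
  ... | no _ = e.from (a₀ , a₀∈)
  h≡ : ∀ {a} (a∈ : a ∈ E M) → h a ≡ e.from (a , a∈)
  h≡ {a} a∈ with a ∈? E M
  ... | yes a∈′ = cong e.from (∈-≡ refl)
  ... | no a∉ = contradiction a∈ a∉
  g : Fin ∣ E M ∣ → Fin _
  g = proj₁ ∘ e.to
  gh : ∀ {a} → a ∈ E M → g (h a) ≡ a
  gh {a} a∈ = trans (cong g (h≡ a∈)) (cong proj₁ (e.strictlyInverseˡ (a , a∈)))
  hg : ∀ b → h (g b) ≡ b
  hg b = trans (h≡ (proj₂ (e.to b))) (e.strictlyInverseʳ b)
  iso : Iso (system M) (U (∣ E M ∣ ∸ 1) ∣ E M ∣)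
  iso = record
    { h = h ; g = g ; h∈ = λ _ → ∈⊤ ; g∈ = λ {b} _ → proj₂ (e.to b) ; gh = gh ; hg = λ {b} _ → hg b ; indep = ind }
    where
    ind : ∀ X Y → X ⊆ E M → Y ⊆ ⊤ → (∀ a → a ∈ E M → a ∈ X ⇔ h a ∈ Y) → Matroid.Indep M X ⇔ ∣ Y ∣ ≤ ∣ E M ∣ ∸ 1
    ind X Y X⊆ _ c = mk⇔ to from
      where
      to : Matroid.Indep M X → ∣ Y ∣ ≤ ∣ E M ∣ ∸ 1
      to i with ⊆⊎∃ (E M) X
      ... | inj₁ E⊆ = contradiction (Matroid.hereditary M E⊆ i) (proj₁ (proj₂ cE))
      ... | inj₂ (x , x∈ , x∉) = ℕ.∸-monoˡ-≤ 1 (ℕ.≤-trans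
        (p⊂q⇒∣p∣<∣q∣ {p = Y} {q = ⊤} ((λ _ → ∈⊤) , h x , ∈⊤ , λ hx → x∉ (Equivalence.from (c x x∈) hx)))
        (ℕ.≤-reflexive (∣⊤∣≡n ∣ E M ∣)))
      from : ∣ Y ∣ ≤ ∣ E M ∣ ∸ 1 → Matroid.Indep M X
      from le with ⊆⊎∃ (E M) X
      ... | inj₂ e = proj₂ (proj₂ cE) X (X⊆ , e)
      ... | inj₁ E⊆ = contradiction (ℕ.≤-trans (ℕ.≤-reflexive (trans (ℕ.m+[n∸m]≡n size)
              (sym (∣⊤∣≡n ∣ E M ∣)))) (ℕ.≤-trans (p⊆q⇒∣p∣≤∣q∣ {p = ⊤} {q = Y} all) le)) (ℕ.<-irrefl refl)
        where
        all : ⊤ ⊆ Y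
        all {b} _ = subst (_∈ Y) (hg b) (Equivalence.to (c (g b) (proj₂ (e.to b))) (E⊆ (proj₂ (e.to b))))

module _ (M : Matroid N) {k} (φ : system M ≅ U 1 (suc k)) where

  cocircuit-pair : ∀ {a b} → a ∈ E M → b ∈ E M → a ≢ b → ¬ Matroid.Indep M (pair a b)
  cocircuit-pair {a} {b} a∈ b∈ a≢b i = ℕ.<⇒≱ (2≤∣p∣ {p = image (pair a b)} (h∈image sub pairˡ) (h∈image sub pairʳ) ha≢hb)
      (Equivalence.to (indep-image sub) i)
    where
    open Iso (≅⇒Iso φ a zero)
    sub : pair a b ⊆ E M
    sub = pair⊆ a∈ b∈
    ha≢hb : h a ≢ h b
    ha≢hb eq = a≢b (trans (sym (gh a∈)) (trans (cong g eq) (gh b∈)))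

  cocircuit-single : ∀ {a} → a ∈ E M → Matroid.Indep M ⁅ a ⁆
  cocircuit-single {a} a∈ = Equivalence.from (indep-image sub) (ℕ.≤-trans (p⊆q⇒∣p∣≤∣q∣ {p = image ⁅ a ⁆} {q = ⁅ h a ⁆} sub′)
      (ℕ.≤-reflexive (∣⁅x⁆∣≡1 (h a))))
    where
    open Iso (≅⇒Iso φ a zero)
    sub : ⁅ a ⁆ ⊆ E M
    sub x∈ = subst (_∈ E M) (sym (x∈⁅y⁆⇒x≡y a x∈)) a∈
    sub′ : image ⁅ a ⁆ ⊆ ⁅ h a ⁆
    sub′ {y} y∈ with image⁻ y∈
    ... | y∈′ , gy∈ = subst (_∈ ⁅ h a ⁆) (trans (cong h (sym (x∈⁅y⁆⇒x≡y a gy∈))) (hg y∈′)) (x∈⁅x⁆ (h a))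

  cocircuit-circuit : ∀ {a b} → a ∈ E M → b ∈ E M → a ≢ b → IsCircuit M (pair a b)
  cocircuit-circuit {a} {b} a∈ b∈ a≢b = (λ {x} → pair⊆ a∈ b∈ {x}) , cocircuit-pair a∈ b∈ a≢b , min
    where
    min : ∀ D → D ⊂ pair a b → Matroid.Indep M D
    min D (D⊆ , x , x∈ , x∉) with pair⁻ x∈
    ... | inj₁ refl = Matroid.hereditary M sub (cocircuit-single b∈)
      where
      sub : D ⊆ ⁅ b ⁆
      sub y∈ with pair⁻ (D⊆ y∈)
      ... | inj₁ refl = contradiction y∈ x∉
      ... | inj₂ refl = x∈⁅x⁆ b
    ... | inj₂ refl = Matroid.hereditary M sub (cocircuit-single a∈)
      where
      sub : D ⊆ ⁅ a ⁆
      sub y∈ with pair⁻ (D⊆ y∈)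
      ... | inj₂ refl = contradiction y∈ x∉
      ... | inj₁ refl = x∈⁅x⁆ a

  cocircuit⇒circuitsSpan : ∀ {a b} → a ≢ b → CircuitsSpan M a b
  cocircuit⇒circuitsSpan {a} {b} a≢b C cC a∈ b∈ x x∈E x∉ = pair a x , cocircuit-circuit (proj₁ cC a∈) x∈E (λ { refl → x∉ a∈ }) ,
    pairʳ , pair⊆ (∈∪ˡ a∈) insert-new

whole⇒circuitsSpan : ∀ (M : Matroid N) → IsCircuit M (E M) → ∀ {a b} → CircuitsSpan M a b
whole⇒circuitsSpan M cE C cC _ _ x x∈ x∉ = contradiction (circuit-⊆ M cE (proj₁ (proj₂ cC)) (proj₁ cC) x∈) x∉

-- Spikes

sum-split : ∀ a {b} (t : Fin (a + b) → Bool) → sum t ≡ sum (t ∘ (_↑ˡ b)) xor sum (t ∘ (a ↑ʳ_))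
sum-split zero t = refl
sum-split (suc a) t = trans (cong (t zero xor_) (sum-split a (t ∘ suc))) (sym (xor-assoc (t zero) _ _))

sum-cong : (s t : Fin k → Bool) → (∀ i → s i ≡ t i) → sum s ≡ sum t
sum-cong _ _ h = sum-cong-≗ h

sum-false : (t : Fin k → Bool) → (∀ i → t i ≡ false) → sum t ≡ false
sum-false {zero} t h = refl
sum-false {suc k} t h = cong₂ _xor_ (h zero) (sum-false (t ∘ suc) (h ∘ suc))

sum-single : (t : Fin k → Bool) (j : Fin k) → sum (λ i → t i ∧ does (i ≟ j)) ≡ t j
sum-single t zero = trans (cong₂ _xor_ (∧-identityʳ (t zero)) (sum-false (λ i → t (suc i) ∧ false) λ i → ∧-zeroʳ (t (suc i)))) (xor-identityʳ (t zero))
sum-single t (suc j) = trans (cong (_xor sum (λ i → t (suc i) ∧ does (i ≟ j))) (∧-zeroʳ (t zero))) (sum-single (t ∘ suc) j)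

-- Since `yᵢ` is `xᵢ` plus the all-ones vector, the y's contribute this common bit to every
-- coordinate, besides an entry of their own.
parity : ∀ r → Subset (suc (r + r)) → Bool
parity r c = sum {r} (λ i → lookup c (yᵢ i))

spike-combination : ∀ r (c : Subset (suc (r + r))) j → linearCombination c (spikeVector r) j ≡
  lookup c (tip r) xor (lookup c (xᵢ j) xor (lookup c (yᵢ j) xor parity r c))
spike-combination r c j = cong₂ _xor_ (∧-identityʳ (lookup c zero)) (trans (sum-split r F) (cong₂ _xor_ xs ys))
  where
  x y : Fin r → Bool
  x i = lookup c (xᵢ i)
  y i = lookup c (yᵢ i)
  entry : Fin r ⊎ Fin r → Bool
  entry s = [ standardBasis , (λ i j → standardBasis i j xor true) ]′ s j
  F : Fin (r + r) → Bool
  F a = lookup c (suc a) ∧ entry (splitAt r a)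
  xs : sum (F ∘ (_↑ˡ r)) ≡ x j
  xs = trans (sum-cong (F ∘ (_↑ˡ r)) (λ i → x i ∧ does (i ≟ j)) λ i → cong (λ s → x i ∧ entry s) (splitAt-↑ˡ r i r))
             (sum-single x j)
  ys : sum (F ∘ (r ↑ʳ_)) ≡ y j xor parity r c
  ys = trans (sum-cong (F ∘ (r ↑ʳ_)) (λ i → (y i ∧ does (i ≟ j)) xor y i) λ i →
               trans (cong (λ s → y i ∧ entry s) (splitAt-↑ʳ r r i))
                 (trans (∧-distribˡ-xor (y i) (does (i ≟ j)) true) (cong ((y i ∧ does (i ≟ j)) xor_) (∧-identityʳ (y i)))))
         (trans (∑-distrib-+ (λ i → y i ∧ does (i ≟ j)) y) (cong (_xor sum y) (sum-single y j)))

data SpikeElement r : Fin (suc (r + r)) → Set where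
  is-tip : SpikeElement r (tip r)
  is-x : ∀ (i : Fin r) → SpikeElement r (xᵢ i)
  is-y : ∀ (i : Fin r) → SpikeElement r (yᵢ i)

spikeElement : ∀ r (b : Fin (suc (r + r))) → SpikeElement r b
spikeElement r zero = is-tip
spikeElement r (suc a) with splitAt r a in eq
... | inj₁ i = subst (SpikeElement r) (cong suc (splitAt⁻¹-↑ˡ eq)) (is-x i)
... | inj₂ i = subst (SpikeElement r) (cong suc (splitAt⁻¹-↑ʳ eq)) (is-y i)

xᵢ-injective : ∀ {r} (i j : Fin r) → xᵢ i ≡ xᵢ j → i ≡ j
xᵢ-injective {r} i j eq = ↑ˡ-injective r i j (suc-injective eq)

yᵢ-injective : ∀ {r} (i j : Fin r) → yᵢ i ≡ yᵢ j → i ≡ j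
yᵢ-injective {r} i j eq = ↑ʳ-injective r i j (suc-injective eq)

xᵢ≢yᵢ : ∀ {r} (i j : Fin r) → xᵢ i ≢ yᵢ j
xᵢ≢yᵢ {r} i j eq with trans (sym (splitAt-↑ˡ r i r)) (trans (cong (splitAt r) (suc-injective eq)) (splitAt-↑ʳ r r j))
... | ()

lookup-≡ : ∀ {c d : Subset k} {a b} → (a ∈ c → b ∈ d) → (b ∈ d → a ∈ c) → lookup c a ≡ lookup d b
lookup-≡ {c = c} {d} {a} {b} f g with a ∈? c
... | yes a∈ = trans ([]=⇒lookup a∈) (sym ([]=⇒lookup (f a∈)))
... | no a∉ = trans (∉⇒lookup a∉) (sym (∉⇒lookup (a∉ ∘ g)))

no-y⇒parity-false : ∀ r (c : Subset (suc (r + r))) → (∀ i → yᵢ {r} i ∉ c) → parity r c ≡ false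
no-y⇒parity-false r c h = sum-false (λ i → lookup c (yᵢ {r} i)) λ i → ∉⇒lookup (h i)

-- The set is described by membership rather than by an equation, so that the lemma applies both to
-- `legTriangle` and to triangles pulled back from a matroid.
triangle-kernel : ∀ r (c : Subset (suc (r + r))) (i : Fin r) → tip r ∈ c → (∀ j → xᵢ j ∈ c → i ≡ j) → xᵢ i ∈ c →
  (∀ j → yᵢ j ∈ c → i ≡ j) → yᵢ i ∈ c → InKernel (spikeVector r) c
triangle-kernel r c i t∈ x⇒ x∈ y⇒ y∈ j = trans (spike-combination r c j)
    (trans (cong₂ _xor_ ([]=⇒lookup t∈) (cong₂ _xor_ x≡y (cong (lookup c (yᵢ j) xor_) parity-true))) (final (lookup c (yᵢ j))))
  where
  x≡y : lookup c (xᵢ j) ≡ lookup c (yᵢ j)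
  x≡y = lookup-≡ {c = c} {c} {xᵢ j} {yᵢ j} (λ h → subst (λ k → yᵢ k ∈ c) (x⇒ j h) y∈) (λ h → subst (λ k → xᵢ k ∈ c) (y⇒ j h) x∈)
  parity-true : parity r c ≡ true
  parity-true = trans (sum-cong (λ k → lookup c (yᵢ k)) (λ k → true ∧ does (k ≟ i)) indicator) (sum-single (λ _ → true) i)
    where
    indicator : ∀ k → lookup c (yᵢ k) ≡ does (k ≟ i)
    indicator k with k ≟ i
    ... | yes refl = []=⇒lookup y∈
    ... | no k≢i = ∉⇒lookup λ h → k≢i (sym (y⇒ k h))
  final : ∀ b → true xor (b xor (b xor true)) ≡ false
  final true = refl
  final false = refl

xor-solve₃ : ∀ {a b c} → a ≡ true → b ≡ false → true xor (a xor (b xor c)) ≡ false → c ≡ false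
xor-solve₃ {c = false} refl refl _ = refl

xor-solve₂ : ∀ {a b} → a ≡ false → true xor (a xor (b xor false)) ≡ false → b ≡ true
xor-solve₂ {b = true} refl _ = refl

xor-solve₁ : ∀ {a b} → b ≡ false → true xor (a xor (b xor false)) ≡ false → a ≡ true
xor-solve₁ {a = true} refl _ = refl

xor-solve-tip : ∀ {a b} → b ≡ false → a xor (b xor false) ≡ false → a ≡ false
xor-solve-tip {a = false} refl _ = refl

xor-solve-x : ∀ {a b} → a ≡ true → a xor (b xor false) ≡ false → b ≡ true
xor-solve-x {b = true} refl _ = refl

xor-solve-cotip : ∀ {a b} → a ≡ false → a xor (b xor false) ≡ false → b ≡ false
xor-solve-cotip {b = false} refl _ = refl

lookup-false⇒∉ : ∀ {c : Subset k} {b} → lookup c b ≡ false → b ∉ c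
lookup-false⇒∉ eq b∈ with () ← trans (sym eq) ([]=⇒lookup b∈)

module _ {m : ℕ} where
  private
    last : Fin (suc m)
    last = fromℕ m

  ∈ground : ∀ {b} → b ≢ yᵢ last → b ∈ ground (Z∖y m)
  ∈ground b≢ = -⁺ ∈⊤ b≢

  ground⇒≢ : ∀ {b} → b ∈ ground (Z∖y m) → b ≢ yᵢ last
  ground⇒≢ b∈ = proj₂ (-⁻ b∈)

  tip∈ground : tip (suc m) ∈ ground (Z∖y m)
  tip∈ground = ∈ground λ ()

  x∈ground : ∀ i → xᵢ i ∈ ground (Z∖y m)
  x∈ground i = ∈ground (xᵢ≢yᵢ i last)

  cotip∈ground : cotip m ∈ ground (Z∖y m)
  cotip∈ground = x∈ground last

  abstract
    legTriangle : Fin (suc m) → Subset (suc (suc m + suc m))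
    legTriangle i = pair (tip (suc m)) (xᵢ i) ∪ ⁅ yᵢ i ⁆

    tip∈legTriangle : ∀ i → tip (suc m) ∈ legTriangle i
    tip∈legTriangle i = ∈∪ˡ {q = ⁅ yᵢ i ⁆} (pairˡ {x = zero} {y = xᵢ i})

    x∈legTriangle : ∀ i → xᵢ i ∈ legTriangle i
    x∈legTriangle i = ∈∪ˡ {q = ⁅ yᵢ i ⁆} (pairʳ {y = xᵢ i} {x = zero})

    y∈legTriangle : ∀ i → yᵢ i ∈ legTriangle i
    y∈legTriangle i = insert-new {x = yᵢ i} {p = pair zero (xᵢ i)}

    legTriangle⁻ : ∀ i {b} → b ∈ legTriangle i → b ≡ tip (suc m) ⊎ b ≡ xᵢ i ⊎ b ≡ yᵢ i
    legTriangle⁻ i b∈ with insert⁻ {p = pair (tip (suc m)) (xᵢ i)} {y = yᵢ i} b∈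
    ... | inj₂ e = inj₂ (inj₂ e)
    ... | inj₁ h with pair⁻ {x = tip (suc m)} {y = xᵢ i} h
    ... | inj₁ e = inj₁ e
    ... | inj₂ e = inj₂ (inj₁ e)

  legTriangle⊆ : ∀ i → i ≢ last → legTriangle i ⊆ ground (Z∖y m)
  legTriangle⊆ i i≢ b∈ with legTriangle⁻ i b∈
  ... | inj₁ refl = ∈ground λ ()
  ... | inj₂ (inj₁ refl) = ∈ground (xᵢ≢yᵢ i last)
  ... | inj₂ (inj₂ refl) = ∈ground (i≢ ∘ yᵢ-injective i last)

  legTriangle-kernel : ∀ i → InKernel (spikeVector (suc m)) (legTriangle i)
  legTriangle-kernel i = triangle-kernel (suc m) (legTriangle i) i (tip∈legTriangle i) fx (x∈legTriangle i) fy (y∈legTriangle i)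
    where
    fx : ∀ (j : Fin (suc m)) → xᵢ j ∈ legTriangle i → i ≡ j
    fx j h with legTriangle⁻ i h
    ... | inj₂ (inj₁ e) = sym (xᵢ-injective j i e)
    ... | inj₂ (inj₂ e) = contradiction e (xᵢ≢yᵢ j i)
    fy : ∀ (j : Fin (suc m)) → yᵢ j ∈ legTriangle i → i ≡ j
    fy j h with legTriangle⁻ i h
    ... | inj₂ (inj₁ e) = contradiction (sym e) (xᵢ≢yᵢ i j)
    ... | inj₂ (inj₂ e) = sym (yᵢ-injective j i e)

  cotip∉legTriangle : ∀ i → i ≢ last → cotip m ∉ legTriangle i
  cotip∉legTriangle i i≢ h with legTriangle⁻ i h
  ... | inj₂ (inj₁ e) = i≢ (sym (xᵢ-injective last i e))
  ... | inj₂ (inj₂ e) = xᵢ≢yᵢ last i e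

  kernel⇒¬indep : ∀ {c} → Nonempty c → InKernel (spikeVector (suc m)) c → ¬ Indep (Z∖y m) c
  kernel⇒¬indep {c} (b , b∈) ker (_ , li) = ∉⊥ (subst (b ∈_) (li c id ker) b∈)

  module _ (c : Subset (suc (suc m + suc m))) (ker : InKernel (spikeVector (suc m)) c)
           (tip∈ : tip (suc m) ∈ c) (cotip∈ : cotip m ∈ c) (y∉ : yᵢ last ∉ c) where
    private
      equation : ∀ (j : Fin (suc m)) → true xor (lookup c (xᵢ j) xor (lookup c (yᵢ j) xor parity (suc m) c)) ≡ false
      equation j = trans (cong (_xor (lookup c (xᵢ j) xor (lookup c (yᵢ j) xor parity (suc m) c)))
        (sym ([]=⇒lookup tip∈))) (trans (sym (spike-combination (suc m) c j)) (ker j))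
      -- In the last coordinate the tip and the cotip cancel and the deleted element is absent, so
      -- only the parity remains. Every other coordinate then says that exactly one of `xᵢ j` and
      -- `yᵢ j` is present.
      even : parity (suc m) c ≡ false
      even = xor-solve₃ ([]=⇒lookup cotip∈) (∉⇒lookup y∉) (equation last)
      one-of : ∀ (j : Fin (suc m)) → true xor (lookup c (xᵢ j) xor (lookup c (yᵢ j) xor false)) ≡ false
      one-of j = subst (λ s → true xor (lookup c (xᵢ j) xor (lookup c (yᵢ j) xor s)) ≡ false) even (equation j)

    kernel-x∉⇒y∈ : ∀ (j : Fin (suc m)) → xᵢ j ∉ c → yᵢ j ∈ c
    kernel-x∉⇒y∈ j x∉ = lookup⇒[]= _ c (xor-solve₂ (∉⇒lookup x∉) (one-of j))
    kernel-y∉⇒x∈ : ∀ (j : Fin (suc m)) → yᵢ j ∉ c → xᵢ j ∈ c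
    kernel-y∉⇒x∈ j y∉ = lookup⇒[]= _ c (xor-solve₁ (∉⇒lookup y∉) (one-of j))

  module _ (M : Matroid N) (I : Iso (system M) (Z∖y m)) where
    open Iso I

    legTriangle-dependent : ∀ i → i ≢ last → ¬ Matroid.Indep M (preimage (legTriangle i))
    legTriangle-dependent i i≢ ind = kernel⇒¬indep (tip (suc m) , tip∈legTriangle i) (legTriangle-kernel i)
      (Equivalence.to (indep-preimage (legTriangle⊆ i i≢)) ind)

    h-injective : ∀ {x y} → x ∈ E M → y ∈ E M → h x ≡ h y → x ≡ y
    h-injective x∈ y∈ eq = trans (sym (gh x∈)) (trans (cong g eq) (gh y∈))

    -- Here `c` stands for the image of `C`. An element outside closes a triangle with the tip and
    -- its own mate, both in the transversal. The triangle misses the cotip, which is the element of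
    -- `C` that `dep⇒circuit-through` needs off the dependent set.
    module Transversal {b} (hb : h b ≡ cotip m) {C} (cC : IsCircuit M C) (b∈C : b ∈ C)
                       (c : Subset (suc (suc m + suc m))) (tip∈c : tip (suc m) ∈ c) (cotip∈c : cotip m ∈ c)
                       (h∈c⇒∈C : ∀ {x} → x ∈ E M → h x ∈ c → x ∈ C)
                       (x∉⇒y∈ : ∀ (j : Fin (suc m)) → xᵢ j ∉ c → yᵢ j ∈ c)
                       (y∉⇒x∈ : ∀ (j : Fin (suc m)) → yᵢ j ∉ c → xᵢ j ∈ c) where
      by-triangle : ∀ {x} i → x ∈ E M → i ≢ last → (∀ {b} → b ∈ legTriangle i → b ≡ h x ⊎ b ∈ c) →
        ∃ λ D → IsCircuit M D × x ∈ D × D ⊆ C ∪ ⁅ x ⁆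
      by-triangle {x} i x∈ i≢ rest = proj₁ D , proj₁ (proj₂ D) , proj₁ (proj₂ (proj₂ D)) , λ z → sub (proj₂ (proj₂ (proj₂ D)) z)
        where
        place : ∀ {z} → z ∈ E M → h z ≡ h x ⊎ h z ∈ c → z ∈ C ∪ ⁅ x ⁆
        place z∈ (inj₁ e) = subst (_∈ C ∪ ⁅ x ⁆) (sym (h-injective z∈ x∈ e)) (insert-new {x = x} {p = C})
        place z∈ (inj₂ hz∈) = ∈∪ˡ (h∈c⇒∈C z∈ hz∈)
        sub : preimage (legTriangle i) ⊆ C ∪ ⁅ x ⁆
        sub z = place (proj₁ (preimage⁻ z)) (rest (proj₂ (preimage⁻ z)))
        D = dep⇒circuit-through M cC x∈ (legTriangle-dependent i i≢) sub b∈C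
          (λ z → cotip∉legTriangle i i≢ (subst (_∈ legTriangle i) hb (proj₂ (preimage⁻ z))))

      spans : Spans M C
      spans x x∈ x∉ = go (spikeElement (suc m) (h x)) refl
        where
        go : ∀ {b} → SpikeElement (suc m) b → b ≡ h x → ∃ λ D → IsCircuit M D × x ∈ D × D ⊆ C ∪ ⁅ x ⁆
        go is-tip e = contradiction (h∈c⇒∈C x∈ (subst (_∈ c) e tip∈c)) x∉
        go (is-x i) e = by-triangle i x∈ i≢ rest
          where
          i≢ : i ≢ last
          i≢ refl = x∉ (h∈c⇒∈C x∈ (subst (_∈ c) e cotip∈c))
          rest : ∀ {b} → b ∈ legTriangle i → b ≡ h x ⊎ b ∈ c
          rest b∈ with legTriangle⁻ i b∈
          ... | inj₁ refl = inj₂ tip∈c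
          ... | inj₂ (inj₁ e′) = inj₁ (trans e′ e)
          ... | inj₂ (inj₂ refl) = inj₂ (x∉⇒y∈ i λ z → x∉ (h∈c⇒∈C x∈ (subst (_∈ c) e z)))
        go (is-y i) e = by-triangle i x∈ i≢ rest
          where
          i≢ : i ≢ last
          i≢ refl = ground⇒≢ (h∈ x∈) (sym e)
          rest : ∀ {b} → b ∈ legTriangle i → b ≡ h x ⊎ b ∈ c
          rest b∈ with legTriangle⁻ i b∈
          ... | inj₁ refl = inj₂ tip∈c
          ... | inj₂ (inj₂ e′) = inj₁ (trans e′ e)
          ... | inj₂ (inj₁ refl) = inj₂ (y∉⇒x∈ i λ z → x∉ (h∈c⇒∈C x∈ (subst (_∈ c) e z)))

    -- The dependent image of `C` contains a nonempty kernel vector, which by minimality of `C` is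
    -- the whole image. It contains the tip and the cotip and so meets every leg in one element.
    tip-cotip⇒circuitsSpan : ∀ {a b} → a ∈ E M → b ∈ E M → h a ≡ tip (suc m) → h b ≡ cotip m → CircuitsSpan M a b
    tip-cotip⇒circuitsSpan {a} {b} a∈E b∈E ha hb C cC a∈C b∈C = from-kernel (dependent⇒kernel (spikeVector (suc m)) (image C) dep)
      where
      dep : ¬ LinearlyIndependent (spikeVector (suc m)) (image C)
      dep li = proj₁ (proj₂ cC) (Equivalence.from (indep-image (proj₁ cC)) ((λ h → ground⇒≢ (proj₁ (image⁻ h)) refl) , li))
      from-kernel : (∃ λ c → c ⊆ image C × Nonempty c × InKernel (spikeVector (suc m)) c) → Spans M C
      from-kernel (c , c⊆ , ne , ker) = Transversal.spans hb cC b∈C c tip∈c cotip∈c h∈c⇒∈C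
          (kernel-x∉⇒y∈ c ker tip∈c cotip∈c y∉c) (kernel-y∉⇒x∈ c ker tip∈c cotip∈c y∉c)
        where
        c⊆ground : c ⊆ ground (Z∖y m)
        c⊆ground z = proj₁ (image⁻ (c⊆ z))
        h∈c⇒∈C : ∀ {x} → x ∈ E M → h x ∈ c → x ∈ C
        h∈c⇒∈C x∈ hx = subst (_∈ C) (gh x∈) (proj₂ (image⁻ (c⊆ hx)))
        ∈C⇒h∈c : ∀ {x} → x ∈ C → h x ∈ c
        ∈C⇒h∈c x∈ = proj₂ (preimage⁻ (circuit-⊆ M cC
          (λ i → kernel⇒¬indep ne ker (Equivalence.to (indep-preimage c⊆ground) i))
          (λ z → h∈c⇒∈C (proj₁ (preimage⁻ z)) (proj₂ (preimage⁻ z))) x∈))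
        tip∈c : tip (suc m) ∈ c
        tip∈c = subst (_∈ c) ha (∈C⇒h∈c a∈C)
        cotip∈c : cotip m ∈ c
        cotip∈c = subst (_∈ c) hb (∈C⇒h∈c b∈C)
        y∉c : yᵢ last ∉ c
        y∉c z = ground⇒≢ (c⊆ground z) refl

    private
      t s : Fin (suc (suc m + suc m))
      t = tip (suc m)
      s = cotip m
      t∈ : t ∈ ground (Z∖y m)
      t∈ = tip∈ground
      s∈ : s ∈ ground (Z∖y m)
      s∈ = cotip∈ground

    not-circuit : ∀ i → i ≢ last → ¬ IsCircuit M (E M)
    not-circuit i i≢ cE = legTriangle-dependent i i≢
      (proj₂ (proj₂ cE) _ ((λ z → proj₁ (preimage⁻ z)) , g s , g∈ s∈ , λ z →
        cotip∉legTriangle i i≢ (subst (_∈ legTriangle i) (hg s∈) (proj₂ (preimage⁻ z)))))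

    -- The tip and the cotip are independent: a coordinate other than the last sees only the tip and
    -- forces its coefficient to vanish, after which the last coordinate does the same for the
    -- cotip.
    not-cocircuit : ∀ i → i ≢ last → ∀ {k} → ¬ (system M ≅ U 1 (suc k))
    not-cocircuit i i≢ ψ = cocircuit-pair M ψ (g∈ t∈) (g∈ s∈) gt≢gs
        (Equivalence.from (indep-image (pair⊆ (g∈ t∈) (g∈ s∈))) ((λ z → ground⇒≢ (proj₁ (image⁻ z)) refl) , independent))
      where
      gt≢gs : g t ≢ g s
      gt≢gs e with () ← trans (sym (hg t∈)) (trans (cong h e) (hg s∈))
      only : ∀ {b} → b ∈ image (pair (g t) (g s)) → b ≡ t ⊎ b ≡ s
      only b∈ with image⁻ b∈
      ... | b∈′ , gb∈ with pair⁻ gb∈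
      ... | inj₁ e = inj₁ (trans (sym (hg b∈′)) (trans (cong h e) (hg t∈)))
      ... | inj₂ e = inj₂ (trans (sym (hg b∈′)) (trans (cong h e) (hg s∈)))
      independent : LinearlyIndependent (spikeVector (suc m)) (image (pair (g t) (g s)))
      independent c c⊆ ker = Empty-unique empty
        where
        y∉ : ∀ (j : Fin (suc m)) → yᵢ j ∉ c
        y∉ j z with only (c⊆ z)
        ... | inj₂ e = xᵢ≢yᵢ last j (sym e)
        equation : ∀ (j : Fin (suc m)) → lookup c t xor (lookup c (xᵢ j) xor false) ≡ false
        equation j = trans (cong (λ b → lookup c t xor (lookup c (xᵢ j) xor b))
          (sym (cong₂ _xor_ (∉⇒lookup (y∉ j)) (no-y⇒parity-false (suc m) c y∉)))) (trans (sym (spike-combination (suc m) c j)) (ker j))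
        xᵢ∉ : xᵢ i ∉ c
        xᵢ∉ z with only (c⊆ z)
        ... | inj₂ e = i≢ (xᵢ-injective i last e)
        t∉ : t ∉ c
        t∉ = lookup-false⇒∉ (xor-solve-tip (∉⇒lookup xᵢ∉) (equation i))
        s∉ : s ∉ c
        s∉ = lookup-false⇒∉ (xor-solve-cotip (∉⇒lookup t∉) (equation last))
        empty : Empty c
        empty (b , b∈) with only (c⊆ b∈)
        ... | inj₁ refl = t∉ b∈
        ... | inj₂ refl = s∉ b∈

IsTipCotipPair⇒circuitsSpan : ∀ {M : Matroid N} {a b} → IsTipCotipPair M a b → CircuitsSpan M a b
IsTipCotipPair⇒circuitsSpan {M = M} {a} {b} (m , _ , φ , a∈ , b∈ , inj₁ (ha , hb)) =
  tip-cotip⇒circuitsSpan M I a∈ b∈ (trans (≅⇒Iso-h φ a zero a∈) ha) (trans (≅⇒Iso-h φ a zero b∈) hb)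
  where I = ≅⇒Iso φ a zero
IsTipCotipPair⇒circuitsSpan {M = M} {a} {b} (m , _ , φ , a∈ , b∈ , inj₂ (ha , hb)) = circuitsSpan-sym {M = M}
  (tip-cotip⇒circuitsSpan M I b∈ a∈ (trans (≅⇒Iso-h φ a zero b∈) hb) (trans (≅⇒Iso-h φ a zero a∈) ha))
  where I = ≅⇒Iso φ a zero

spike-not-circuit : ∀ (M : Matroid N) → Nonempty (E M) → IsSpike M → ¬ IsCircuit M (E M)
spike-not-circuit M (a₀ , _) (suc m , s≤s (s≤s _) , φ) = not-circuit M (≅⇒Iso φ a₀ zero) zero λ ()

spike-not-cocircuit : ∀ (M : Matroid N) → Nonempty (E M) → IsSpike M → ∀ {k} → ¬ (system M ≅ U 1 (suc k))
spike-not-cocircuit M (a₀ , _) (suc m , s≤s (s≤s _) , φ) = not-cocircuit M (≅⇒Iso φ a₀ zero) zero λ ()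

-- From a spike structure to an isomorphism with a spike

module Coordinates (M : Matroid N) (B : CycleSpace M) {t s : Fin N} (S : SpikeStructure M B t s)
  (m : ℕ) (leg : Fin m → Fin N) (leg-Leg : ∀ i → SpikeStructure.Leg S (leg i))
  (leg-injective : ∀ {i j} → leg i ≡ leg j → i ≡ j)
  (leg-surjective : ∀ {c} → SpikeStructure.Leg S c → ∃ λ i → leg i ≡ c) where
  open CycleSpace B
  open SpikeStructure S
  open Matroid M renaming (Indep to Ind) using (hereditary)

  -- yElement is junk at the top index, which belongs to the deleted element.
  xElement yElement : ∀ {i : Fin (suc m)} → View i → Fin N
  xElement ‵fromℕ = s
  xElement (‵inject₁ i) = leg i
  yElement ‵fromℕ = t
  yElement (‵inject₁ i) = partner (leg i)

  entry : Fin (suc m) ⊎ Fin (suc m) → Fin N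
  entry = [ xElement ∘ view , yElement ∘ view ]′

  -- The `m` legs and, in the last place, `s` take the places of the basis vectors. The rank is thus
  -- `suc m`, and `C` becomes the circuit expressing the all-ones tip as the sum of the basis.
  g : Fin (suc (suc m + suc m)) → Fin N
  g zero = t
  g (suc a) = entry (splitAt (suc m) a)

  g-x : ∀ i → g (xᵢ i) ≡ xElement (view i)
  g-x i = cong entry (splitAt-↑ˡ (suc m) i (suc m))

  g-y : ∀ i → g (yᵢ i) ≡ yElement (view i)
  g-y i = cong entry (splitAt-↑ʳ (suc m) (suc m) i)

  g-leg : ∀ i → g (xᵢ (inject₁ i)) ≡ leg i
  g-leg i = trans (g-x (inject₁ i)) (cong xElement (view-inject₁ i))

  g-partner : ∀ i → g (yᵢ (inject₁ i)) ≡ partner (leg i)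
  g-partner i = trans (g-y (inject₁ i)) (cong yElement (view-inject₁ i))

  g-cotip : g (cotip m) ≡ s
  g-cotip = trans (g-x (fromℕ m)) (cong xElement (view-fromℕ m))

  xElement∈C : ∀ {i} (v : View i) → xElement v ∈ C
  xElement∈C ‵fromℕ = s∈C
  xElement∈C (‵inject₁ i) = proj₁ (leg-Leg i)

  xElement≢t : ∀ {i} (v : View i) → xElement v ≢ t
  xElement≢t ‵fromℕ = t≢s ∘ sym
  xElement≢t (‵inject₁ i) = proj₁ (proj₂ (leg-Leg i))

  xElement-injective : ∀ {i j} (v : View i) (w : View j) → xElement v ≡ xElement w → i ≡ j
  xElement-injective ‵fromℕ ‵fromℕ _ = refl
  xElement-injective ‵fromℕ (‵inject₁ j) eq = contradiction (sym eq) (proj₂ (proj₂ (leg-Leg j)))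
  xElement-injective (‵inject₁ i) ‵fromℕ eq = contradiction eq (proj₂ (proj₂ (leg-Leg i)))
  xElement-injective (‵inject₁ i) (‵inject₁ j) eq = cong inject₁ (leg-injective eq)

  yElement∉C : ∀ {i} (v : View i) → i ≢ fromℕ m → yElement v ∈ E M × yElement v ∉ C
  yElement∉C ‵fromℕ i≢ = contradiction refl i≢
  yElement∉C (‵inject₁ i) _ = partner∈ (leg-Leg i)

  yElement-injective : ∀ {i j} (v : View i) (w : View j) → i ≢ fromℕ m → j ≢ fromℕ m → yElement v ≡ yElement w → i ≡ j
  yElement-injective ‵fromℕ _ i≢ _ _ = contradiction refl i≢
  yElement-injective (‵inject₁ i) ‵fromℕ _ j≢ _ = contradiction refl j≢
  yElement-injective (‵inject₁ i) (‵inject₁ j) _ _ eq =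
    cong inject₁ (leg-injective (partner-injective (leg-Leg i) (leg-Leg j) eq))

  G : Subset (suc (suc m + suc m))
  G = ground (Z∖y m)

  y≢ : ∀ {i} → yᵢ i ∈ G → i ≢ fromℕ m
  y≢ h refl = ground⇒≢ {m} h refl

  g-x∈C : ∀ i → g (xᵢ i) ∈ C
  g-x∈C i = subst (_∈ C) (sym (g-x i)) (xElement∈C (view i))

  g-y∉C : ∀ {i} → yᵢ i ∈ G → g (yᵢ i) ∈ E M × g (yᵢ i) ∉ C
  g-y∉C {i} h = subst (λ x → x ∈ E M × x ∉ C) (sym (g-y i)) (yElement∉C (view i) (y≢ h))

  g-x≢t : ∀ i → g (xᵢ i) ≢ t
  g-x≢t i eq = xElement≢t (view i) (trans (sym (g-x i)) eq)

  g∈ : ∀ {b} → b ∈ G → g b ∈ E M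
  g∈ {b} b∈ = go (spikeElement (suc m) b) b∈
    where
    go : ∀ {b} → SpikeElement (suc m) b → b ∈ G → g b ∈ E M
    go is-tip _ = proj₁ circuit t∈C
    go (is-x i) _ = proj₁ circuit (g-x∈C i)
    go (is-y i) h = proj₁ (g-y∉C h)

  g-injective : ∀ {b c} → b ∈ G → c ∈ G → g b ≡ g c → b ≡ c
  g-injective {b} {c} = go (spikeElement (suc m) b) (spikeElement (suc m) c)
    where
    go : ∀ {b c} → SpikeElement (suc m) b → SpikeElement (suc m) c → b ∈ G → c ∈ G → g b ≡ g c → b ≡ c
    go is-tip is-tip _ _ _ = refl
    go is-tip (is-x j) _ _ eq = contradiction (sym eq) (g-x≢t j)
    go is-tip (is-y j) _ h eq = contradiction (subst (_∈ C) eq t∈C) (proj₂ (g-y∉C h))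
    go (is-x i) is-tip _ _ eq = contradiction eq (g-x≢t i)
    go (is-x i) (is-x j) _ _ eq = cong xᵢ (xElement-injective (view i) (view j) (trans (sym (g-x i)) (trans eq (g-x j))))
    go (is-x i) (is-y j) _ h eq = contradiction (subst (_∈ C) eq (g-x∈C i)) (proj₂ (g-y∉C h))
    go (is-y i) is-tip h _ eq = contradiction (subst (_∈ C) (sym eq) t∈C) (proj₂ (g-y∉C h))
    go (is-y i) (is-x j) h _ eq = contradiction (subst (_∈ C) (sym eq) (g-x∈C j)) (proj₂ (g-y∉C h))
    go (is-y i) (is-y j) h h′ eq = cong yᵢ (yElement-injective (view i) (view j) (y≢ h) (y≢ h′)
      (trans (sym (g-y i)) (trans eq (g-y j))))

  tip∈ : tip (suc m) ∈ G
  tip∈ = tip∈ground {m}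

  x∈ : ∀ i → xᵢ i ∈ G
  x∈ i = x∈ground {m} i

  inject-y∈ : ∀ i → yᵢ (inject₁ i) ∈ G
  inject-y∈ i = ∈ground {m} λ eq → fromℕ≢inject₁ (sym (yᵢ-injective (inject₁ i) (fromℕ m) eq))

  C-cover : ∀ {c} → c ∈ C → c ≡ t ⊎ ∃ λ i → g (xᵢ i) ≡ c
  C-cover {c} c∈ with c ≟ t | c ≟ s
  ... | yes c≡t | _ = inj₁ c≡t
  ... | no _ | yes refl = inj₂ (fromℕ m , g-cotip)
  ... | no c≢t | no c≢s with leg-surjective (c∈ , c≢t , c≢s)
  ... | i , eq = inj₂ (inject₁ i , trans (g-leg i) eq)

  g-surjective : ∀ {a} → a ∈ E M → ∃ λ b → b ∈ G × g b ≡ a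
  g-surjective {a} a∈ with a ∈? C
  g-surjective {a} a∈ | yes a∈C with C-cover a∈C
  ... | inj₁ refl = zero , tip∈ , refl
  ... | inj₂ (i , eq) = xᵢ i , x∈ i , eq
  g-surjective {a} a∈ | no a∉C with partner-surjective a∈ a∉C
  ... | c , l , refl with leg-surjective l
  ... | i , refl = yᵢ (inject₁ i) , inject-y∈ i , g-partner i

  private
    search : ∀ a → Dec (∃ λ b → b ∈ G × g b ≡ a)
    search a = any? λ b → (b ∈? G) ×-dec (g b ≟ a)

  h : Fin N → Fin (suc (suc m + suc m))
  h a with search a
  ... | yes (b , _) = b
  ... | no _ = zero

  h-spec : ∀ {a} → a ∈ E M → h a ∈ G × g (h a) ≡ a
  h-spec {a} a∈ with search a
  ... | yes (b , sp) = sp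
  ... | no none = contradiction (g-surjective a∈) none

  hg : ∀ {b} → b ∈ G → h (g b) ≡ b
  hg b∈ = g-injective (proj₁ (h-spec (g∈ b∈))) b∈ (proj₂ (h-spec (g∈ b∈)))

  abstract
    pull : Subset N → Subset (suc (suc m + suc m))
    pull Z = set λ b → (b ∈? G) ×-dec (g b ∈? Z)

    pull⁺ : ∀ {Z b} → b ∈ G → g b ∈ Z → b ∈ pull Z
    pull⁺ {Z} b∈ gb∈ = set⁺ (λ b → (b ∈? G) ×-dec (g b ∈? Z)) (b∈ , gb∈)

    pull⁻ : ∀ {Z b} → b ∈ pull Z → b ∈ G × g b ∈ Z
    pull⁻ {Z} = set⁻ (λ b → (b ∈? G) ×-dec (g b ∈? Z))

  pull-⊕ : ∀ Z W → pull (Z ⊕ W) ≡ pull Z ⊕ pull W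
  pull-⊕ Z W = ⊆-antisym sub sup
    where
    sub : pull (Z ⊕ W) ⊆ pull Z ⊕ pull W
    sub z with pull⁻ {Z ⊕ W} z
    ... | b∈ , gb∈ with ⊕⁻ gb∈
    ... | inj₁ (i , o) = ⊕⁺ˡ (pull⁺ b∈ i) (o ∘ proj₂ ∘ pull⁻)
    ... | inj₂ (o , i) = ⊕⁺ʳ (o ∘ proj₂ ∘ pull⁻) (pull⁺ b∈ i)
    sup : pull Z ⊕ pull W ⊆ pull (Z ⊕ W)
    sup z with ⊕⁻ z
    ... | inj₁ (i , o) = pull⁺ (proj₁ (pull⁻ i)) (⊕⁺ˡ (proj₂ (pull⁻ i)) (o ∘ pull⁺ (proj₁ (pull⁻ i))))
    ... | inj₂ (o , i) = pull⁺ (proj₁ (pull⁻ i)) (⊕⁺ʳ (o ∘ pull⁺ (proj₁ (pull⁻ i))) (proj₂ (pull⁻ i)))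

  abstract
    Kernel : Subset N → Set
    Kernel Z = InKernel (spikeVector (suc m)) (pull Z)

    ⇒kernel : ∀ {Z} → InKernel (spikeVector (suc m)) (pull Z) → Kernel Z
    ⇒kernel = id

    kernel⇒ : ∀ {Z} → Kernel Z → InKernel (spikeVector (suc m)) (pull Z)
    kernel⇒ = id

  kernel-⊕ : ∀ Z W → Kernel Z → Kernel W → Kernel (Z ⊕ W)
  kernel-⊕ Z W kZ kW = ⇒kernel (subst (InKernel (spikeVector (suc m))) (sym (pull-⊕ Z W))
    (inKernel-⊕ (spikeVector (suc m)) (pull Z) (pull W) (kernel⇒ kZ) (kernel⇒ kW)))

  T : Fin N → Subset N
  T c = pair t c ∪ ⁅ partner c ⁆

  T⁻ : ∀ {c z} → z ∈ T c → z ≡ t ⊎ z ≡ c ⊎ z ≡ partner c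
  T⁻ h with insert⁻ h
  ... | inj₂ e = inj₂ (inj₂ e)
  ... | inj₁ h′ with pair⁻ h′
  ... | inj₁ e = inj₁ e
  ... | inj₂ e = inj₂ (inj₁ e)

  kernel-T : ∀ {c} → Leg c → Kernel (T c)
  kernel-T l with leg-surjective l
  ... | i , refl = ⇒kernel (triangle-kernel (suc m) (pull (T (leg i))) (inject₁ i)
      (pull⁺ tip∈ (∈∪ˡ pairˡ)) (λ j → fx j) (pull⁺ (x∈ _) (subst (_∈ T (leg i)) (sym (g-leg i)) (∈∪ˡ pairʳ)))
      (λ j → fy j) (pull⁺ (inject-y∈ i) (subst (_∈ T (leg i)) (sym (g-partner i)) insert-new)))
    where
    fx : ∀ j → xᵢ j ∈ pull (T (leg i)) → inject₁ i ≡ j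
    fx j h with T⁻ (proj₂ (pull⁻ {T (leg i)} h))
    ... | inj₁ e = contradiction e (g-x≢t j)
    ... | inj₂ (inj₁ e) = xᵢ-injective (inject₁ i) j (g-injective (x∈ _) (x∈ j) (trans (g-leg i) (sym e)))
    ... | inj₂ (inj₂ e) = contradiction (subst (_∈ C) e (g-x∈C j)) (proj₂ (partner∈ (leg-Leg i)))
    fy : ∀ j → yᵢ j ∈ pull (T (leg i)) → inject₁ i ≡ j
    fy j h with pull⁻ {T (leg i)} h
    ... | y∈ , gy∈ with T⁻ gy∈
    ... | inj₁ e = contradiction (subst (_∈ C) (sym e) t∈C) (proj₂ (g-y∉C y∈))
    ... | inj₂ (inj₁ e) = contradiction (subst (_∈ C) (sym e) (proj₁ (leg-Leg i))) (proj₂ (g-y∉C y∈))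
    ... | inj₂ (inj₂ e) = yᵢ-injective (inject₁ i) j (g-injective (inject-y∈ i) y∈ (trans (g-partner i) (sym e)))

  private
    -- Inside `C` only ∅ and `C` qualify on either side: the proper subsets of a circuit are
    -- independent, and each coordinate equates the tip bit with one x bit.
    module Base {Z : Subset N} (Z⊆C : Z ⊆ C) where
      y∉ : ∀ (j : Fin (suc m)) → yᵢ j ∉ pull Z
      y∉ j h = proj₂ (g-y∉C (proj₁ (pull⁻ {Z} h))) (Z⊆C (proj₂ (pull⁻ {Z} h)))

      tipBit : Bool
      tipBit = lookup (pull Z) (tip (suc m))
      xBit : Fin (suc m) → Bool
      xBit j = lookup (pull Z) (xᵢ j)

      combination : ∀ j → linearCombination (pull Z) (spikeVector (suc m)) j ≡ tipBit xor (xBit j xor false)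
      combination j = trans (spike-combination (suc m) (pull Z) j)
        (cong (λ b → tipBit xor (xBit j xor b)) (cong₂ _xor_ (∉⇒lookup (y∉ j)) (no-y⇒parity-false (suc m) (pull Z) y∉)))

      tip≡x⇒kernel : (∀ j → tipBit xor (xBit j xor false) ≡ false) → Kernel Z
      tip≡x⇒kernel h = ⇒kernel λ j → trans (combination j) (h j)

      cycle⇒kernel : Cyc Z → Kernel Z
      cycle⇒kernel cZ = tip≡x⇒kernel (by-cases (⊆⊎∃ C Z))
        where
        by-cases : C ⊆ Z ⊎ (∃ λ c → c ∈ C × c ∉ Z) → ∀ j → tipBit xor (xBit j xor false) ≡ false
        by-cases (inj₁ C⊆Z) j = cong₂ _xor_ ([]=⇒lookup (pull⁺ {Z} tip∈ (C⊆Z t∈C)))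
          (cong (_xor false) ([]=⇒lookup (pull⁺ {Z} (x∈ j) (C⊆Z (g-x∈C j)))))
        by-cases (inj₂ (c , c∈ , c∉)) j = cong₂ _xor_ (∉⇒lookup none) (cong (_xor false) (∉⇒lookup none))
          where
          none : ∀ {b} → b ∉ pull Z
          none h = within-circuit circuit cZ Z⊆C c∈ c∉ (_ , proj₂ (pull⁻ {Z} h))

      kernel⇒cycle : Kernel Z → Cyc Z
      kernel⇒cycle k = by-cases (t ∈? Z)
        where
        equation : ∀ j → tipBit xor (xBit j xor false) ≡ false
        equation j = trans (sym (combination j)) (kernel⇒ k j)
        by-cases : Dec (t ∈ Z) → Cyc Z
        by-cases (yes t∈Z) = subst Cyc (⊆-antisym C⊆Z Z⊆C) (circuit⇒Cyc circuit)
          where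
          x∈Z : ∀ j → g (xᵢ j) ∈ Z
          x∈Z j = proj₂ (pull⁻ {Z} (lookup⇒[]= _ (pull Z) (xor-solve-x ([]=⇒lookup (pull⁺ {Z} tip∈ t∈Z)) (equation j))))
          C⊆Z : C ⊆ Z
          C⊆Z c∈ with C-cover c∈
          ... | inj₁ refl = t∈Z
          ... | inj₂ (j , refl) = x∈Z j
        by-cases (no t∉Z) = subst Cyc (⊆-antisym (λ {z} h → contradiction h (⊕∉ z)) λ h → contradiction h empty) (Cyc-⊕ cC cC)
          where
          cC = circuit⇒Cyc circuit
          ⊕∉ : ∀ z → z ∉ C ⊕ C
          ⊕∉ z h with ⊕⁻ h
          ... | inj₁ (a , b) = b a
          ... | inj₂ (a , b) = a b
          x∉Z : ∀ j → g (xᵢ j) ∉ Z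
          x∉Z j h = lookup-false⇒∉ (xor-solve-cotip (∉⇒lookup (t∉Z ∘ proj₂ ∘ pull⁻ {Z} {tip (suc m)})) (equation j)) (pull⁺ {Z} (x∈ j) h)
          empty : ∀ {z} → z ∉ Z
          empty h with C-cover (Z⊆C h)
          ... | inj₁ refl = t∉Z h
          ... | inj₂ (j , refl) = x∉Z j h

  -- Adding triangles moves a set into C without affecting either side.
  cycle⇔kernel : ∀ Z → Z ⊆ E M → Cyc Z ⇔ Kernel Z
  cycle⇔kernel Z = go Z (<-wellFounded ∣ Z ─ C ∣)
    where
    go : ∀ Z → Acc _<_ ∣ Z ─ C ∣ → Z ⊆ E M → Cyc Z ⇔ Kernel Z
    go Z (acc rec) Z⊆ with ⊆⊎∃ Z C
    ... | inj₁ Z⊆C = mk⇔ (Base.cycle⇒kernel Z⊆C) (Base.kernel⇒cycle Z⊆C)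
    ... | inj₂ (x , x∈Z , x∉C) with partner-surjective (Z⊆ x∈Z) x∉C
    ... | c , l , refl = mk⇔
        (λ cZ → subst Kernel (⊕-cancelʳ Z (T c)) (kernel-⊕ (Z ⊕ T c) (T c) (Equivalence.to ih (Cyc-⊕ cZ (triangle l))) (kernel-T l)))
        (λ kZ → subst Cyc (⊕-cancelʳ Z (T c)) (Cyc-⊕ (Equivalence.from ih (kernel-⊕ Z (T c) kZ (kernel-T l))) (triangle l)))
      where
      smaller : (Z ⊕ T c) ─ C ⊂ Z ─ C
      smaller = sub , partner c , x∈p∧x∉q⇒x∈p─q x∈Z x∉C , λ h → ⊕∉₂ x∈Z insert-new (proj₁ (─⁻ {p = Z ⊕ T c} h))
        where
        sub : (Z ⊕ T c) ─ C ⊆ Z ─ C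
        sub h with ─⁻ {p = Z ⊕ T c} h
        ... | h′ , z∉C with ⊕⁻ h′
        ... | inj₁ (z∈Z , _) = x∈p∧x∉q⇒x∈p─q z∈Z z∉C
        ... | inj₂ (z∉Z , z∈T) with T⁻ z∈T
        ... | inj₁ refl = contradiction t∈C z∉C
        ... | inj₂ (inj₁ refl) = contradiction (proj₁ l) z∉C
        ... | inj₂ (inj₂ refl) = contradiction x∈Z z∉Z
      ih = go (Z ⊕ T c) (rec (p⊂q⇒∣p∣<∣q∣ smaller)) (⊕⊆ Z⊆ (Cyc⇒⊆ (triangle l)))

  iso : Iso (system M) (Z∖y m)
  iso = record
    { h = h ; g = g ; h∈ = λ a∈ → proj₁ (h-spec a∈) ; g∈ = g∈ ; gh = λ a∈ → proj₂ (h-spec a∈) ; hg = hg ; indep = ind }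
    where
    ind : ∀ X Y → X ⊆ E M → Y ⊆ G → (∀ a → a ∈ E M → a ∈ X ⇔ h a ∈ Y) → Ind X ⇔ Indep (Z∖y m) Y
    ind X Y X⊆ Y⊆ corr = mk⇔ to from
      where
      to : Ind X → Indep (Z∖y m) Y
      to i = (λ y∈ → ground⇒≢ {m} (Y⊆ y∈) refl) , independent
        where
        independent : LinearlyIndependent (spikeVector (suc m)) Y
        independent c c⊆ ker = Empty-unique empty
          where
          push? : ∀ a → Dec (∃ λ b → b ∈ c × g b ≡ a)
          push? a = any? λ b → (b ∈? c) ×-dec (g b ≟ a)
          W = set push?
          W⊆X : W ⊆ X
          W⊆X z with set⁻ push? z
          ... | b , b∈ , refl = Equivalence.from (corr (g b) (g∈ (Y⊆ (c⊆ b∈)))) (subst (_∈ Y) (sym (hg (Y⊆ (c⊆ b∈)))) (c⊆ b∈))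
          pull-W : pull W ≡ c
          pull-W = ⊆-antisym sub (λ {b} b∈ → pull⁺ {W} (Y⊆ (c⊆ b∈)) (set⁺ push? (b , b∈ , refl)))
            where
            sub : pull W ⊆ c
            sub z with pull⁻ {W} z
            ... | b∈G , gb∈ with set⁻ push? gb∈
            ... | b′ , b′∈ , eq = subst (_∈ c) (g-injective (Y⊆ (c⊆ b′∈)) b∈G eq) b′∈
          empty : Empty c
          empty (b , b∈) = Cyc⇒dep (Equivalence.from (cycle⇔kernel W (λ z → X⊆ (W⊆X z)))
              (⇒kernel (subst (InKernel (spikeVector (suc m))) (sym pull-W) ker)))
            (g b , set⁺ push? (b , b∈ , refl)) (hereditary W⊆X i)
      from : Indep (Z∖y m) Y → Ind X
      from (_ , li) = decidable-stable (Matroid.Indep? M X) λ d → dependent (dep⇒Cyc X⊆ d)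
        where
        dependent : ¬ (∃ λ Z → Z ⊆ X × Nonempty Z × Cyc Z)
        dependent (Z , Z⊆X , (a , a∈) , cZ) = ∉⊥ (subst (h a ∈_) (li (pull Z) sub
            (kernel⇒ (Equivalence.to (cycle⇔kernel Z (λ z → X⊆ (Z⊆X z))) cZ))) ha∈)
          where
          ha∈ : h a ∈ pull Z
          ha∈ = pull⁺ {Z} (proj₁ (h-spec (X⊆ (Z⊆X a∈)))) (subst (_∈ Z) (sym (proj₂ (h-spec (X⊆ (Z⊆X a∈))))) a∈)
          sub : pull Z ⊆ Y
          sub z with pull⁻ {Z} z
          ... | b∈ , gb∈ = subst (_∈ Y) (hg b∈) (Equivalence.to (corr _ (X⊆ (Z⊆X gb∈))) (Z⊆X gb∈))

  tipCotipPair : 2 ≤ m → IsTipCotipPair M t s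
  tipCotipPair 2≤m = m , s≤s 2≤m , Iso⇒≅ iso , proj₁ circuit t∈C , proj₁ circuit s∈C ,
    inj₁ (hg tip∈ , trans (cong h (sym g-cotip)) (hg (x∈ (fromℕ m))))

spikeStructure⇒tipCotipPair : ∀ (M : Matroid N) (B : CycleSpace M) {t s} → SpikeStructure M B t s → IsTipCotipPair M t s
spikeStructure⇒tipCotipPair {N} M B {t} {s} S = Coordinates.tipCotipPair M B S ∣ L ∣ (λ i → proj₁ (e.to i)) (λ i → L⁻ (proj₂ (e.to i)))
    (λ {i} {j} eq → trans (sym (e.strictlyInverseʳ i)) (trans (cong e.from (∈-≡ eq)) (e.strictlyInverseʳ j)))
    (λ l → e.from (_ , L⁺ l) , cong proj₁ (e.strictlyInverseˡ (_ , L⁺ l))) 2≤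
  where
  open SpikeStructure S
  L : Subset N
  L = (C - t) - s
  module e = Inverse (enum L)
  L⁻ : ∀ {c} → c ∈ L → Leg c
  L⁻ c∈ with -⁻ c∈
  ... | c∈′ , c≢s with -⁻ c∈′
  ... | c∈C , c≢t = c∈C , c≢t , c≢s
  L⁺ : ∀ {c} → Leg c → c ∈ L
  L⁺ (c∈C , c≢t , c≢s) = -⁺ (-⁺ c∈C c≢t) c≢s
  2≤ : 2 ≤ ∣ L ∣
  2≤ with two-legs
  ... | c , d , lc , ld , c≢d = 2≤∣p∣ {p = L} (L⁺ lc) (L⁺ ld) c≢d

IsTipCotipPair-sym : ∀ (M : Matroid N) {a b} → IsTipCotipPair M a b → IsTipCotipPair M b a
IsTipCotipPair-sym M (m , 3≤ , φ , a∈ , b∈ , inj₁ (x , y)) = m , 3≤ , φ , b∈ , a∈ , inj₂ (y , x)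
IsTipCotipPair-sym M (m , 3≤ , φ , a∈ , b∈ , inj₂ (x , y)) = m , 3≤ , φ , b∈ , a∈ , inj₁ (y , x)

threeConnected⇒tipCotipPair : ∀ (M : Matroid N) → CycleSpace M → Connected M → ThreeConnected M → 4 ≤ ∣ E M ∣ →
  ∀ {a b} → a ∈ E M → b ∈ E M → a ≢ b → CircuitsSpan M a b → IsTipCotipPair M a b
threeConnected⇒tipCotipPair M B con 3c 4≤ {a} {b} a∈ b∈ a≢b q =
  let (_ , cC , a∈C , b∈C) = con a b a∈ b∈ a≢b in
  [ spikeStructure⇒tipCotipPair M B , IsTipCotipPair-sym M ∘ spikeStructure⇒tipCotipPair M B ]′
    (Sides.∃spikeStructure M B 3c 4≤ cC a∈C b∈C a≢b q)

-- A circuit through `a` and `b` contains `q` by hypothesis, and an exchange of sides turns it into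
-- one that does not.
threeConnected⇒¬badPair : ∀ (M : Matroid N) → CycleSpace M → Connected M → ThreeConnected M → 4 ≤ ∣ E M ∣ →
  ∀ {q} → ¬ BadPair M q
threeConnected⇒¬badPair M B con 3c 4≤ (a , b , a∈ , b∈ , a≢b , a≢q , b≢q , bad) =
  let (_ , cC , a∈C , b∈C) = con a b a∈ b∈ a≢b
      (D , cD , a∈D , b∈D , q∉D) = Sides.circuit-avoiding M B 3c 4≤ cC a∈C b∈C a≢b (λ C c x y → proj₂ (bad C c x y))
                                     (proj₁ (bad _ cC a∈C b∈C)) (a≢q ∘ sym) (b≢q ∘ sym)
  in q∉D (proj₁ (bad D cD a∈D b∈D))

-- Canonical tree decompositions

simple⇒no-parallel : ∀ (M : Matroid N) → Simple M → ∀ x y → x ∈ E M → y ∈ E M → x ≢ y → Matroid.Indep M (pair x y)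
simple⇒no-parallel M simple x y x∈ y∈ _ = decidable-stable (Matroid.Indep? M (pair x y)) λ d → go (dep⇒circuit M (pair⊆ x∈ y∈) d)
  where
  go : ¬ (∃ λ C → IsCircuit M C × C ⊆ pair x y)
  go (C , cC , C⊆) = ℕ.<-irrefl refl (ℕ.≤-trans (simple C cC)
    (ℕ.≤-trans (p⊆q⇒∣p∣≤∣q∣ {p = C} {q = pair x y} C⊆) (∣pair∣≤2 x y)))

joins-ends : ∀ {G : LabelledGraph N k m} {ε i j} → i ≢ j →
  i ≡ proj₁ (graph G ε) ⊎ i ≡ proj₂ (graph G ε) → j ≡ proj₁ (graph G ε) ⊎ j ≡ proj₂ (graph G ε) → Joins (graph G) ε i j
joins-ends i≢j (inj₁ refl) (inj₁ refl) = contradiction refl i≢j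
joins-ends i≢j (inj₁ refl) (inj₂ refl) = inj₁ refl
joins-ends i≢j (inj₂ refl) (inj₁ refl) = inj₂ refl
joins-ends i≢j (inj₂ refl) (inj₂ refl) = contradiction refl i≢j

-- A loop is impossible because a label would meet itself in one element only. A third vertex
-- containing the name of `ε` would be adjacent to an end of `ε`, along an edge of the same name,
-- hence along `ε` itself.
treeDecomposition⇒wellFormed : ∀ {T : LabelledGraph N k m} {M} → IsTreeDecomposition T M → 3 ≤ ∣ E M ∣ → WellFormed T
treeDecomposition⇒wellFormed {T = T} {M} d size = record
  { name-injective = namesDistinct
  ; ends-distinct = distinct
  ; name∈end₁ = λ ε → proj₁ (∩⁻ {q = E (label T _)} (name∈∩ ε _ _ (inj₁ refl)))
  ; name∈end₂ = λ ε → proj₂ (∩⁻ {p = E (label T _)} (name∈∩ ε _ _ (inj₁ refl)))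
  ; name∈⇒end = name-end
  ; shared⇒name = λ {i} {j} {a} i≢j a∈ a∈′ → decidable-stable (any? λ ε → name T ε ≟ a) λ none →
      ∉⊥ (subst (a ∈_) (notJoined i j i≢j λ (ε , js) → none (ε , sym (only ε i j js a∈ a∈′))) (∩⁺ a∈ a∈′))
  }
  where
  open IsTreeDecomposition d
  name∈∩ : ∀ ε i j → Joins (graph T) ε i j → name T ε ∈ E (label T i) ∩ E (label T j)
  name∈∩ ε i j js = subst (name T ε ∈_) (sym (joined ε i j js)) (x∈⁅x⁆ _)
  only : ∀ ε i j → Joins (graph T) ε i j → ∀ {a} → a ∈ E (label T i) → a ∈ E (label T j) → a ≡ name T ε
  only ε i j js a∈ a∈′ = x∈⁅y⁆⇒x≡y _ (subst (_ ∈_) (joined ε i j js) (∩⁺ a∈ a∈′))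
  distinct : ∀ ε → proj₁ (graph T ε) ≢ proj₂ (graph T ε)
  distinct ε eq with ∃-third {p = E (label T (proj₁ (graph T ε)))} (large size _) (name T ε) (name T ε)
  ... | z , z∈ , z≢ , _ = z≢ (only ε _ _ (inj₁ refl) z∈ (subst (λ i → z ∈ E (label T i)) eq z∈))
  name-end : ∀ ε i → name T ε ∈ E (label T i) → i ≡ proj₁ (graph T ε) ⊎ i ≡ proj₂ (graph T ε)
  name-end ε i h with i ≟ proj₁ (graph T ε)
  ... | yes e = inj₁ e
  ... | no i≢u = inj₂ (decidable-stable (i ≟ proj₂ (graph T ε)) λ i≢v →
    ∉⊥ (subst (name T ε ∈_) (notJoined _ i (i≢u ∘ sym) (not-adjacent i≢v)) (∩⁺ u∈ h)))
    where
    u∈ : name T ε ∈ E (label T (proj₁ (graph T ε)))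
    u∈ = proj₁ (∩⁻ {q = E (label T (proj₂ (graph T ε)))} (name∈∩ ε _ _ (inj₁ refl)))
    not-adjacent : i ≢ proj₂ (graph T ε) → ¬ Adjacent (graph T) (proj₁ (graph T ε)) i
    not-adjacent i≢v (ε′ , js) with namesDistinct (only ε′ _ i js u∈ h)
    not-adjacent i≢v (ε′ , inj₁ e) | refl = i≢v (sym (cong proj₂ e))
    not-adjacent i≢v (ε′ , inj₂ e) | refl = i≢u (sym (cong proj₁ e))

-- A circuit label would be adjacent to another circuit; in a cocircuit the pair of `a` and `b` is a
-- circuit missing the basepoint; a 3-connected label admits no bad pair.
canonical⇒noBadCircuit : ∀ {T : LabelledGraph N k m} {M} → IsCanonicalTreeDecomposition T M → 3 ≤ ∣ E M ∣ →
  (∀ i → CycleSpace (label T i)) → NoBadCircuit T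
canonical⇒noBadCircuit {T = T} c size B ε x u js cx bad@(a , b , a∈ , b∈ , a≢b , a≢q , b≢q , h) with labels u
  where open IsCanonicalTreeDecomposition c
... | inj₁ cu = IsCanonicalTreeDecomposition.noAdjacentCircuits c x u (ε , js) (whole⇒circuitMatroid (label T x) cx , cu)
... | inj₂ (inj₂ (3c , 4≤)) = threeConnected⇒¬badPair (label T u) (B u)
        (IsTreeDecomposition.labelsConnected (IsCanonicalTreeDecomposition.isTreeDecomposition c) u) 3c 4≤ bad
... | inj₂ (inj₁ (suc _ , _ , φ)) with pair⁻ (proj₁ (h (pair a b) (cocircuit-circuit (label T u) φ a∈ b∈ a≢b) pairˡ pairʳ))
... | inj₁ e = a≢q (sym e)
... | inj₂ e = b≢q (sym e)

-- Terminals along a chain and positions along a path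

module _ {G : LabelledGraph N k m} where

  left right : ∀ {a vs c} → Chain G a vs c → Fin (length vs) → Fin N
  left (_∷_ {a = a} g ch) zero = a
  left (g ∷ ch) (suc i) = left ch i
  right (_∷_ {b = b} g ch) zero = b
  right (g ∷ ch) (suc i) = right ch i

  chain-link : ∀ {a vs c} (ch : Chain G a vs c) i → Link G (List.lookup vs i) (left ch i) (right ch i)
  chain-link (g ∷ ch) zero = g
  chain-link (g ∷ ch) (suc i) = chain-link ch i

  left-first : ∀ {a v vs c} (ch : Chain G a (v ∷ vs) c) → left ch zero ≡ a
  left-first (g ∷ ch) = refl

  right-last : ∀ {a v vs c} (ch : Chain G a (v ∷ vs) c) → right ch (fromℕ (length vs)) ≡ c
  right-last (g ∷ []) = refl
  right-last (g ∷ ch@(_ ∷ _)) = right-last ch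

  right≡left : ∀ {a v vs c} (ch : Chain G a (v ∷ vs) c) (i : Fin (length vs)) → right ch (inject₁ i) ≡ left ch (suc i)
  right≡left (g ∷ ch@(_ ∷ _)) zero = sym (left-first ch)
  right≡left (g ∷ ch@(_ ∷ _)) (suc i) = right≡left ch i

  tabulate-chain : ∀ n (v : Fin (suc n) → Fin k) (l r : Fin (suc n) → Fin N) → (∀ i → Link G (v i) (l i) (r i)) →
    (∀ (i : Fin n) → r (inject₁ i) ≡ l (suc i)) → Chain G (l zero) (List.tabulate v) (r (fromℕ n))
  tabulate-chain zero v l r g j = g zero ∷ []
  tabulate-chain (suc n) v l r g j = subst (Link G (v zero) (l zero)) (j zero) (g zero) ∷
    tabulate-chain n (v ∘ suc) (l ∘ suc) (r ∘ suc) (g ∘ suc) (j ∘ suc)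

-- If `index` did not return `i`, it would never take the value `i`, since looking up determines the
-- vertex. It would then inject the `k` vertices into fewer than `k` positions.
index-lookup : ∀ {vs : List (Fin k)} → length vs ≡ k → (complete : ∀ i → i ∈ₗ vs) → ∀ i → index (complete (List.lookup vs i)) ≡ i
index-lookup {k} {vs@(_ ∷ _)} size complete i with index (complete (List.lookup vs i)) ≟ i
... | yes e = e
... | no ≢i = contradiction (ℕ.≤-trans (ℕ.≤-reflexive size) (injective⇒≤ {f = f} f-injective)) (ℕ.<⇒≱ ℕ.≤-refl)
  where
  miss : ∀ j → i ≢ index (complete j)
  miss j e = ≢i (trans (cong (λ v → index (complete v)) (trans (cong (List.lookup vs) e) (sym (lookup-index (complete j))))) (sym e))
  f : Fin k → Fin _
  f j = punchOut (miss j)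
  f-injective : ∀ {j j′} → f j ≡ f j′ → j ≡ j′
  f-injective {j} {j′} e = trans (lookup-index (complete j))
    (trans (cong (List.lookup vs) (punchOut-injective (miss j) (miss j′) e)) (sym (lookup-index (complete j′))))

predecessor : ∀ {n} (i : Fin (suc n)) → 0 < toℕ i → ∃ λ (j : Fin n) → i ≡ suc j
predecessor (suc j) _ = j , refl

successor : ∀ {n} (i : Fin (suc n)) → toℕ i < n → ∃ λ (j : Fin n) → i ≡ inject₁ j
successor i lt = fromℕ< lt , toℕ-injective (sym (trans (toℕ-inject₁ (fromℕ< lt)) (toℕ-fromℕ< lt)))

first-or-later : ∀ {n} (i : Fin (suc n)) → i ≡ zero ⊎ ∃ λ (j : Fin n) → i ≡ suc j
first-or-later zero = inj₁ refl
first-or-later (suc j) = inj₂ (j , refl)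

last-or-earlier : ∀ {n} (i : Fin (suc n)) → i ≡ fromℕ n ⊎ ∃ λ (j : Fin n) → i ≡ inject₁ j
last-or-earlier i with view i
... | ‵fromℕ = inj₁ refl
... | ‵inject₁ j = inj₂ (j , refl)

module Canonical {T : LabelledGraph N k m} {M} (c : IsCanonicalTreeDecomposition T M) (size : 3 ≤ ∣ E M ∣)
                 {e f : Fin N} (e∈ : e ∈ E M) (f∈ : f ∈ E M) (e≢f : e ≢ f) where
  open IsCanonicalTreeDecomposition c
  open IsTreeDecomposition isTreeDecomposition hiding (groundSet)
  wf : WellFormed T
  wf = treeDecomposition⇒wellFormed isTreeDecomposition size
  open WellFormed wf

  notName : ∀ {a} → a ∈ E M → NotName T a
  notName a∈ = proj₂ (Equivalence.to (IsTreeDecomposition.groundSet isTreeDecomposition _) a∈)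

  3≤ : ∀ i → 3 ≤ ∣ E (label T i) ∣
  3≤ = large size

  nonempty : ∀ i → Nonempty (E (label T i))
  nonempty i with ∃-third {p = E (label T i)} (3≤ i) e e
  ... | z , z∈ , _ = z , z∈

  shared⇒joins : ∀ {i j a} → i ≢ j → a ∈ E (label T i) → a ∈ E (label T j) → ∃ λ ε → name T ε ≡ a × Joins (graph T) ε i j
  shared⇒joins i≢j a∈ a∈′ with shared⇒name i≢j a∈ a∈′
  ... | ε , refl = ε , refl , joins-ends {G = T} i≢j (name∈⇒end ε _ a∈) (name∈⇒end ε _ a∈′)

  joins⇒name∈ : ∀ {ε i j} → Joins (graph T) ε i j → name T ε ∈ E (label T i) × name T ε ∈ E (label T j)
  joins⇒name∈ {ε} {i} {j} js = ∩⁻ (subst (name T ε ∈_) (sym (joined ε i j js)) (x∈⁅x⁆ _))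

  joins⇒ends : ∀ {ε i j l} → Joins (graph T) ε i j → name T ε ∈ E (label T l) → l ≡ i ⊎ l ≡ j
  joins⇒ends {ε} (inj₁ eq) h with name∈⇒end ε _ h
  ... | inj₁ x = inj₁ (trans x (cong proj₁ eq))
  ... | inj₂ x = inj₂ (trans x (cong proj₂ eq))
  joins⇒ends {ε} (inj₂ eq) h with name∈⇒end ε _ h
  ... | inj₁ x = inj₂ (trans x (cong proj₁ eq))
  ... | inj₂ x = inj₁ (trans x (cong proj₂ eq))

  module _ (B : ∀ i → CycleSpace (label T i)) (np : NoParallelPair T) where

    -- Being a spike only identifies the label as the 3-connected kind. The isomorphism is built
    -- anew from the spanning property, because one matching the terminals is required and in rank 3
    -- several pairs can be tip and cotip.
    link⇒spike-pair : ∀ {v a b} → Link T v a b → IsSpike (label T v) → IsTipCotipPair (label T v) a b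
    link⇒spike-pair {v} g sp with labels v
    ... | inj₁ (k , ck) = contradiction (circuitOfSize⇒whole (label T v) (nonempty v) ck) (spike-not-circuit (label T v) (nonempty v) sp)
    ... | inj₂ (inj₁ (suc k , _ , φ)) = contradiction φ (spike-not-cocircuit (label T v) (nonempty v) sp)
    ... | inj₂ (inj₂ (3c , 4≤)) = threeConnected⇒tipCotipPair (label T v) (B v) (labelsConnected v) 3c 4≤
            (Link.left∈ g) (Link.right∈ g) (Link.left≢right g) (Link.spans g)

    off-terminals⇒notName : ∀ {v a b z} → Link T v a b → z ∈ E (label T v) → z ≢ a → z ≢ b → NotName T z
    off-terminals⇒notName g z∈ z≢a z≢b ε refl with Link.names g ε z∈
    ... | inj₁ x = z≢a x
    ... | inj₂ x = z≢b x

    link⇒label : ∀ {v a b} → Link T v a b →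
      (∃ λ s → 3 ≤ s × IsCircuitOfSize s (label T v)) ⊎ (system (label T v) ≅ U 1 3) ⊎ IsSpike (label T v)
    link⇒label {v} {a} {b} g with labels v
    ... | inj₁ (k , 1≤ , φ) = inj₁ (k , subst (3 ≤_) (≅U⇒size {M = label T v} φ) (3≤ v) , 1≤ , φ)
    ... | inj₂ (inj₂ (3c , 4≤)) =
      let (m , 3≤m , φ , _) = threeConnected⇒tipCotipPair (label T v) (B v) (labelsConnected v) 3c 4≤
            (Link.left∈ g) (Link.right∈ g) (Link.left≢right g) (Link.spans g)
      in inj₂ (inj₂ (m , 3≤m , φ))
    link⇒label {v} {a} {b} g | inj₂ (inj₁ (suc k , _ , φ)) with ℕ.m≤n⇒m<n∨m≡n (3≤ v)
    ... | inj₂ eq = inj₂ (inj₁ (subst (λ s → system (label T v) ≅ U 1 s) (trans (sym (≅U⇒size {M = label T v} φ)) (sym eq)) φ))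
    -- Only the two terminals can be names, so a cocircuit with four elements would contain two
    -- parallel elements of `M`.
    ... | inj₁ 4≤ = ⊥-elim (absurd (∃-two (E (label T v) ─ pair a b) (∣─pair∣ (E (label T v)) 4≤ a b)))
      where
      off : ∀ {x} → x ∈ E (label T v) ─ pair a b → x ∈ E (label T v) × NotName T x
      off h = proj₁ (─⁻ {p = E (label T v)} h) , off-terminals⇒notName g (proj₁ (─⁻ {p = E (label T v)} h))
        (λ { refl → proj₂ (─⁻ {p = E (label T v)} h) pairˡ }) (λ { refl → proj₂ (─⁻ {p = E (label T v)} h) pairʳ })
      absurd : ¬ (∃₂ λ y z → y ∈ E (label T v) ─ pair a b × z ∈ E (label T v) ─ pair a b × y ≢ z)
      absurd (y , z , y∈ , z∈ , y≢z) = cocircuit-pair (label T v) φ (proj₁ (off y∈)) (proj₁ (off z∈)) y≢z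
        (np v y z (proj₁ (off y∈)) (proj₁ (off z∈)) (proj₂ (off y∈)) (proj₂ (off z∈)) y≢z)

    -- An end label contains a non-name besides e or f, so it cannot consist of parallel elements.
    end-not-U₁₃ : ∀ {v a b g} → Link T v a b → (g ≡ a ⊎ g ≡ b) → NotName T g → ¬ (system (label T v) ≅ U 1 3)
    end-not-U₁₃ {v} {a} {b} {g} link g∈ab ng φ with ∃-third {p = E (label T v)} (3≤ v) a b
    ... | z , z∈ , z≢a , z≢b = cocircuit-pair (label T v) φ g∈ z∈ g≢z (np v g z g∈ z∈ ng (off-terminals⇒notName link z∈ z≢a z≢b) g≢z)
      where
      g∈ : g ∈ E (label T v)
      g∈ = [ (λ { refl → Link.left∈ link }) , (λ { refl → Link.right∈ link }) ]′ g∈ab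
      g≢z : g ≢ z
      g≢z refl = [ z≢a , z≢b ]′ g∈ab

    chain⇒spikePath : ChainOf T e f → IsSpikePath T e f
    chain⇒spikePath (chainOf [] [] _ _) = contradiction refl e≢f
    chain⇒spikePath (chainOf vs@(v₀ ∷ vs′) ch size complete) = record
      { n = n
      ; pathOrder = record { order = mk↔ₛ′ P idx (λ i → sym (lookup-index (complete i))) (index-lookup size complete) ; consecutive = consec }
      ; labels = λ i → link⇒label (link i)
      ; first≇U₁₃ = end-not-U₁₃ (link zero) (inj₁ (sym (left-first ch))) ne
      ; last≇U₁₃ = end-not-U₁₃ (link (fromℕ n)) (inj₂ (sym (right-last ch))) nf
      ; oneVertex = λ n≡0 sp → subst (λ x → IsTipCotipPair (label T (P zero)) x f) (left-first ch)
          (subst (IsTipCotipPair (label T (P zero)) (left ch zero)) (right-zero n≡0) (link⇒spike-pair (link zero) sp))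
      ; endElements = λ _ → inj₁ (e∈first , f∈last)
      ; interiorSpike = λ i 0<i i<n sp → left ch i , right ch i , Link.left≢right (link i) ,
          (λ a → mk⇔ (basepoint⇒ i a) λ { (inj₁ refl) → Link.left∈ (link i) , left-name i 0<i
                                          ; (inj₂ refl) → Link.right∈ (link i) , right-name i i<n }) ,
          link⇒spike-pair (link i) sp
      ; endSpike = endSp
      }
      where
      n = length vs′
      P : Fin (suc n) → Fin k
      P = List.lookup vs
      idx : Fin k → Fin (suc n)
      idx i = index (complete i)
      P-injective : ∀ {i j} → P i ≡ P j → i ≡ j
      P-injective {i} {j} eq = trans (sym (index-lookup size complete i)) (trans (cong idx eq) (index-lookup size complete j))
      link : ∀ i → Link T (P i) (left ch i) (right ch i)
      link = chain-link ch
      ne = notName e∈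
      nf = notName f∈
      e∈first : e ∈ E (label T (P zero))
      e∈first = subst (_∈ E (label T (P zero))) (left-first ch) (Link.left∈ (link zero))
      f∈last : f ∈ E (label T (P (fromℕ n)))
      f∈last = subst (_∈ E (label T (P (fromℕ n)))) (right-last ch) (Link.right∈ (link (fromℕ n)))
      right-zero : n ≡ 0 → right ch zero ≡ f
      right-zero n≡0 = trans (cong (right ch) (toℕ-injective (sym (trans (toℕ-fromℕ n) n≡0)))) (right-last ch)
      left∈pred : ∀ (j : Fin n) → left ch (suc j) ∈ E (label T (P (inject₁ j)))
      left∈pred j = subst (_∈ E (label T (P (inject₁ j)))) (right≡left ch j) (Link.right∈ (link (inject₁ j)))
      right∈succ : ∀ (j : Fin n) → right ch (inject₁ j) ∈ E (label T (P (suc j)))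
      right∈succ j = subst (_∈ E (label T (P (suc j)))) (sym (right≡left ch j)) (Link.left∈ (link (suc j)))
      step≢ : ∀ (j : Fin n) → P (inject₁ j) ≢ P (suc j)
      step≢ j eq = ℕ.<-irrefl (trans (sym (toℕ-inject₁ j)) (cong toℕ (P-injective eq))) (ℕ.n<1+n (toℕ j))
      joint : ∀ (j : Fin n) → ∃ λ ε → name T ε ≡ right ch (inject₁ j) × Joins (graph T) ε (P (inject₁ j)) (P (suc j))
      joint j = shared⇒joins (step≢ j) (Link.right∈ (link (inject₁ j))) (right∈succ j)
      left-name : ∀ i → 0 < toℕ i → ∃ λ ε → name T ε ≡ left ch i
      left-name i 0<i with predecessor i 0<i
      ... | j , refl = proj₁ (joint j) , trans (proj₁ (proj₂ (joint j))) (right≡left ch j)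
      right-name : ∀ i → toℕ i < n → ∃ λ ε → name T ε ≡ right ch i
      right-name i i<n with successor i i<n
      ... | j , refl = proj₁ (joint j) , proj₁ (proj₂ (joint j))
      basepoint⇒ : ∀ i a → IsBasepoint T (P i) a → a ≡ left ch i ⊎ a ≡ right ch i
      basepoint⇒ i a (a∈ , ε , refl) = Link.names (link i) ε a∈
      consec : ∀ i j → Adjacent (graph T) (P i) (P j) ⇔ (toℕ j ≡ suc (toℕ i) ⊎ toℕ i ≡ suc (toℕ j))
      consec i j = mk⇔ to from
        where
        to : Adjacent (graph T) (P i) (P j) → toℕ j ≡ suc (toℕ i) ⊎ toℕ i ≡ suc (toℕ j)
        -- The name is a terminal of `P i` and is neither `e` nor `f`. The chain therefore places it
        -- also in the vertex before or after `P i`, and that vertex must be `P j`.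
        to (ε , js) with Link.names (link i) ε (proj₁ (joins⇒name∈ js))
        to (ε , js) | inj₁ eq with first-or-later i
        ... | inj₁ refl = contradiction (trans eq (left-first ch)) (ne ε)
        ... | inj₂ (i′ , refl) with joins⇒ends js (subst (_∈ E (label T (P (inject₁ i′)))) (sym eq) (left∈pred i′))
        ... | inj₁ x = contradiction x (step≢ i′)
        ... | inj₂ x = inj₂ (cong suc (trans (sym (toℕ-inject₁ i′)) (cong toℕ (P-injective x))))
        to (ε , js) | inj₂ eq with last-or-earlier i
        ... | inj₁ refl = contradiction (trans eq (right-last ch)) (nf ε)
        ... | inj₂ (i′ , refl) with joins⇒ends js (subst (_∈ E (label T (P (suc i′)))) (sym eq) (right∈succ i′))
        ... | inj₁ x = contradiction (sym x) (step≢ i′)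
        ... | inj₂ x = inj₁ (trans (cong toℕ (sym (P-injective x))) (cong suc (sym (toℕ-inject₁ i′))))
        next : ∀ i j → toℕ j ≡ suc (toℕ i) → ∃ λ ε → Joins (graph T) ε (P i) (P j)
        next i (suc j) eq with toℕ-injective (trans (sym (ℕ.suc-injective eq)) (sym (toℕ-inject₁ j)))
        ... | refl = proj₁ (joint j) , proj₂ (proj₂ (joint j))
        from : toℕ j ≡ suc (toℕ i) ⊎ toℕ i ≡ suc (toℕ j) → Adjacent (graph T) (P i) (P j)
        from (inj₁ eq) = next i j eq
        from (inj₂ eq) with next j i eq
        ... | ε , js = ε , Sum.swap js
      distinct-ends : 1 ≤ n → P zero ≢ P (fromℕ n)
      distinct-ends 1≤n eq = ℕ.<-irrefl (trans (cong toℕ (P-injective eq)) (toℕ-fromℕ n)) 1≤n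
      endSp : 1 ≤ n → ∀ i → i ≡ zero ⊎ i ≡ fromℕ n → IsSpike (label T (P i)) →
        ∃₂ λ p g → (∀ a → IsBasepoint T (P i) a ⇔ a ≡ p) × (∀ a → (a ∈ E (label T (P i)) × (a ≡ e ⊎ a ≡ f)) ⇔ a ≡ g) ×
                   IsTipCotipPair (label T (P i)) p g
      endSp 1≤n i (inj₁ refl) sp = right ch zero , e , (λ a → mk⇔ (bp a) λ { refl → Link.right∈ (link zero) , right-name zero 1≤n }) ,
          (λ a → mk⇔ (el a) λ { refl → e∈first , inj₁ refl }) ,
          IsTipCotipPair-sym (label T (P zero)) (subst (λ x → IsTipCotipPair (label T (P zero)) x (right ch zero)) (left-first ch) (link⇒spike-pair (link zero) sp))
        where
        bp : ∀ a → IsBasepoint T (P zero) a → a ≡ right ch zero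
        bp a h@(_ , ε , nm) with basepoint⇒ zero a h
        ... | inj₁ x = contradiction (trans nm (trans x (left-first ch))) (ne ε)
        ... | inj₂ x = x
        el : ∀ a → a ∈ E (label T (P zero)) × (a ≡ e ⊎ a ≡ f) → a ≡ e
        el a (a∈ , inj₁ x) = x
        el a (a∈ , inj₂ refl) with shared⇒name (distinct-ends 1≤n) a∈ f∈last
        ... | ε , nm = contradiction nm (nf ε)
      endSp 1≤n i (inj₂ refl) sp = left ch (fromℕ n) , f ,
          (λ a → mk⇔ (bp a) λ { refl → Link.left∈ (link (fromℕ n)) , left-name (fromℕ n) (subst (1 ≤_) (sym (toℕ-fromℕ n)) 1≤n) }) ,
          (λ a → mk⇔ (el a) λ { refl → f∈last , inj₂ refl }) ,
          subst (IsTipCotipPair (label T (P (fromℕ n))) (left ch (fromℕ n))) (right-last ch) (link⇒spike-pair (link (fromℕ n)) sp)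
        where
        bp : ∀ a → IsBasepoint T (P (fromℕ n)) a → a ≡ left ch (fromℕ n)
        bp a h@(_ , ε , nm) with basepoint⇒ (fromℕ n) a h
        ... | inj₂ x = contradiction (trans nm (trans x (right-last ch))) (nf ε)
        ... | inj₁ x = x
        el : ∀ a → a ∈ E (label T (P (fromℕ n))) × (a ≡ e ⊎ a ≡ f) → a ≡ f
        el a (a∈ , inj₂ x) = x
        el a (a∈ , inj₁ refl) with shared⇒name (distinct-ends 1≤n) e∈first a∈
        ... | ε , nm = contradiction nm (ne ε)

  module _ (path : IsSpikePath T e f) where
    private
      module S = IsSpikePath path
      module O = PathOrder S.pathOrder
      n = S.n
      v : Fin (suc n) → Fin k
      v = O.P

      v-injective : ∀ {i j} → v i ≡ v j → i ≡ j
      v-injective {i} {j} eq = trans (sym (Inverse.strictlyInverseʳ O.order i))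
        (trans (cong (Inverse.from O.order) eq) (Inverse.strictlyInverseʳ O.order j))

    module _ {e₁ f₁ : Fin N} (ends : (e₁ ≡ e × f₁ ≡ f) ⊎ (e₁ ≡ f × f₁ ≡ e × 1 ≤ n))
             (e₁∈ : e₁ ∈ E (label T (v zero))) (f₁∈ : f₁ ∈ E (label T (v (fromℕ n)))) where
      private
        e₁≢f₁ : e₁ ≢ f₁
        e₁≢f₁ = [ (λ { (refl , refl) → e≢f }) , (λ { (refl , refl , _) → e≢f ∘ sym }) ]′ ends
        ne₁ : NotName T e₁
        ne₁ = [ (λ { (refl , _) → notName e∈ }) , (λ { (refl , _) → notName f∈ }) ]′ ends
        nf₁ : NotName T f₁
        nf₁ = [ (λ { (_ , refl) → notName f∈ }) , (λ { (_ , refl , _) → notName e∈ }) ]′ ends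
        e₁∈ef : e₁ ≡ e ⊎ e₁ ≡ f
        e₁∈ef = Sum.map proj₁ proj₁ ends
        f₁∈ef : f₁ ≡ e ⊎ f₁ ≡ f
        f₁∈ef = Sum.swap (Sum.map proj₂ (proj₁ ∘ proj₂) ends)

        edgeAt : ∀ (i : Fin n) → Adjacent (graph T) (v (inject₁ i)) (v (suc i))
        edgeAt i = Equivalence.from (O.consecutive (inject₁ i) (suc i)) (inj₁ (cong suc (sym (toℕ-inject₁ i))))

        joint : Fin n → Fin N
        joint i = name T (proj₁ (edgeAt i))

        joint∈ : ∀ i → joint i ∈ E (label T (v (inject₁ i))) × joint i ∈ E (label T (v (suc i)))
        joint∈ i = joins⇒name∈ (proj₂ (edgeAt i))

        l : Fin (suc n) → Fin N
        l zero = e₁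
        l (suc i) = joint i

        rv : ∀ {i : Fin (suc n)} → View i → Fin N
        rv ‵fromℕ = f₁
        rv (‵inject₁ i) = joint i

        r : Fin (suc n) → Fin N
        r i = rv (view i)

        r-inject₁ : ∀ i → r (inject₁ i) ≡ joint i
        r-inject₁ i = cong rv (view-inject₁ i)

        r-last : r (fromℕ n) ≡ f₁
        r-last = cong rv (view-fromℕ n)

        l∈ : ∀ i → l i ∈ E (label T (v i))
        l∈ zero = e₁∈
        l∈ (suc i) = proj₂ (joint∈ i)

        r∈ : ∀ i → r i ∈ E (label T (v i))
        r∈ i with last-or-earlier i
        ... | inj₁ refl = subst (_∈ _) (sym r-last) f₁∈
        ... | inj₂ (j , refl) = subst (_∈ _) (sym (r-inject₁ j)) (proj₁ (joint∈ j))

        l≢r : ∀ i → l i ≢ r i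
        l≢r i eq with first-or-later i | last-or-earlier i
        ... | inj₁ refl | inj₁ x = e₁≢f₁ (trans eq (trans (cong r x) r-last))
        ... | inj₁ refl | inj₂ (j , x) = ne₁ (proj₁ (edgeAt j)) (sym (trans eq (trans (cong r x) (r-inject₁ j))))
        ... | inj₂ (i′ , refl) | inj₁ x = nf₁ (proj₁ (edgeAt i′)) (trans eq (trans (cong r x) r-last))
        -- If the two joints of a vertex agreed, the edge leaving it would have its name in the
        -- preceding vertex as well, which is not one of its ends.
        ... | inj₂ (i′ , refl) | inj₂ (j , x)
          with joins⇒ends (proj₂ (edgeAt j)) (subst (_∈ E (label T (v (inject₁ i′)))) (trans eq (trans (cong r x) (r-inject₁ j))) (proj₁ (joint∈ i′)))
        ... | inj₁ y = ℕ.<-irrefl (trans (sym (toℕ-inject₁ i′)) (cong toℕ (trans (v-injective y) (sym x)))) (ℕ.n<1+n (toℕ i′))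
        ... | inj₂ y = ℕ.<-irrefl (trans (sym (toℕ-inject₁ i′)) (trans (cong toℕ (v-injective y))
                         (cong suc (trans (sym (toℕ-inject₁ j)) (cong toℕ (sym x)))))) (ℕ.<-trans (ℕ.n<1+n (toℕ i′)) (ℕ.n<1+n _))

        same-name : ∀ {ε ε′ i j} → Joins (graph T) ε i j → Joins (graph T) ε′ i j → name T ε ≡ name T ε′
        same-name {ε} {ε′} {i} {j} js js′ = x∈⁅y⁆⇒x≡y _ (subst (name T ε ∈_) (trans (sym (joined ε i j js)) (joined ε′ i j js′)) (x∈⁅x⁆ _))

        neighbour : ∀ {ε} i → name T ε ∈ E (label T (v i)) → ∃ λ j → Joins (graph T) ε (v i) (v j)
        neighbour {ε} i h with name∈⇒end ε (v i) h
        ... | inj₁ x = Inverse.from O.order (end₂ ε) ,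
            joins-ends {G = T} (λ y → ends-distinct ε (trans (sym x) (trans y (vfrom _)))) (inj₁ x) (inj₂ (vfrom _))
          where
          vfrom : ∀ w → v (Inverse.from O.order w) ≡ w
          vfrom = Inverse.strictlyInverseˡ O.order
        ... | inj₂ x = Inverse.from O.order (end₁ ε) ,
            joins-ends {G = T} (λ y → ends-distinct ε (sym (trans (sym x) (trans y (vfrom _))))) (inj₂ x) (inj₁ (vfrom _))
          where
          vfrom : ∀ w → v (Inverse.from O.order w) ≡ w
          vfrom = Inverse.strictlyInverseˡ O.order

        -- An edge at `v i` leads to a vertex consecutive to it, and edges joining the same two
        -- vertices have the same name, namely the joint in between.
        names : ∀ i ε → name T ε ∈ E (label T (v i)) → name T ε ≡ l i ⊎ name T ε ≡ r i
        names i ε h with neighbour {ε} i h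
        ... | j , js with Equivalence.to (O.consecutive i j) (ε , js)
        ... | inj₁ eq with first-or-later j
        ... | inj₁ refl = contradiction eq λ ()
        ... | inj₂ (j′ , refl) with toℕ-injective (trans (sym (ℕ.suc-injective eq)) (sym (toℕ-inject₁ j′)))
        ... | refl = inj₂ (trans (same-name js (proj₂ (edgeAt j′))) (sym (r-inject₁ j′)))
        names i ε h | j , js | inj₂ eq with first-or-later i
        ... | inj₁ refl = contradiction eq λ ()
        ... | inj₂ (i′ , refl) with toℕ-injective (trans (sym (ℕ.suc-injective eq)) (sym (toℕ-inject₁ i′)))
        ... | refl = inj₁ (same-name (Sum.swap js) (proj₂ (edgeAt i′)))

        basepoint-l : ∀ i → S.Basepoint (suc i) (l (suc i))
        basepoint-l i = l∈ (suc i) , proj₁ (edgeAt i) , refl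

        basepoint-r : ∀ i → S.Basepoint (inject₁ i) (r (inject₁ i))
        basepoint-r i = r∈ (inject₁ i) , proj₁ (edgeAt i) , sym (r-inject₁ i)

        tip⇒circuitsSpan : ∀ i {p q} → IsTipCotipPair (label T (v i)) p q → (l i ≡ p × r i ≡ q) ⊎ (l i ≡ q × r i ≡ p) → CircuitsSpan (label T (v i)) (l i) (r i)
        tip⇒circuitsSpan i tc (inj₁ (refl , refl)) = IsTipCotipPair⇒circuitsSpan {M = label T (v i)} tc
        tip⇒circuitsSpan i tc (inj₂ (refl , refl)) = circuitsSpan-sym {M = label T (v i)} (IsTipCotipPair⇒circuitsSpan {M = label T (v i)} tc)

        1≤n : Fin n → 1 ≤ n
        1≤n zero = s≤s z≤n
        1≤n (suc _) = s≤s z≤n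

        spike⇒circuitsSpan : ∀ i → IsSpike (label T (v i)) → CircuitsSpan (label T (v i)) (l i) (r i)
        spike⇒circuitsSpan i sp with first-or-later i | last-or-earlier i
        ... | inj₁ refl | inj₁ x = only-vertex ends
          where
          only-vertex : (e₁ ≡ e × f₁ ≡ f) ⊎ (e₁ ≡ f × f₁ ≡ e × 1 ≤ n) → CircuitsSpan (label T (v zero)) e₁ (r zero)
          only-vertex (inj₂ (_ , _ , 1≤n)) = contradiction (trans (cong toℕ x) (toℕ-fromℕ n)) (ℕ.<⇒≢ 1≤n)
          only-vertex (inj₁ (e₁≡e , f₁≡f)) = tip⇒circuitsSpan zero (S.oneVertex (sym (trans (cong toℕ x) (toℕ-fromℕ n))) sp)
            (inj₁ (e₁≡e , trans (cong r x) (trans r-last f₁≡f)))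
        spike⇒circuitsSpan i sp | inj₁ refl | inj₂ (j , x) with S.endSpike (1≤n j) zero (inj₁ refl) sp
        ... | p , g , bp , el , tc = tip⇒circuitsSpan zero tc (inj₂ (Equivalence.to (el e₁) (e₁∈ , e₁∈ef) ,
                Equivalence.to (bp (r zero)) (subst (λ i → S.Basepoint i (r i)) (sym x) (basepoint-r j))))
        spike⇒circuitsSpan i sp | inj₂ (i′ , refl) | inj₁ x with S.endSpike (1≤n i′) (suc i′) (inj₂ x) sp
        ... | p , g , bp , el , tc = tip⇒circuitsSpan (suc i′) tc (inj₁ (Equivalence.to (bp (l (suc i′))) (basepoint-l i′) ,
                Equivalence.to (el (r (suc i′))) (r∈ (suc i′) , subst (λ y → y ≡ e ⊎ y ≡ f) (sym (trans (cong r x) r-last)) f₁∈ef)))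
        spike⇒circuitsSpan i sp | inj₂ (i′ , refl) | inj₂ (j , x)
          with S.interiorSpike (suc i′) (s≤s z≤n) (subst (_< n) (trans (sym (toℕ-inject₁ j)) (cong toℕ (sym x))) (toℕ<n j)) sp
        ... | p , q , p≢q , bp , tc = tip⇒circuitsSpan (suc i′) tc (match (Equivalence.to (bp _) (basepoint-l i′))
                (Equivalence.to (bp _) (subst (λ i → S.Basepoint i (r i)) (sym x) (basepoint-r j))))
          where
          match : l (suc i′) ≡ p ⊎ l (suc i′) ≡ q → r (suc i′) ≡ p ⊎ r (suc i′) ≡ q → _
          match (inj₁ a) (inj₁ b) = contradiction (trans a (sym b)) (l≢r (suc i′))
          match (inj₁ a) (inj₂ b) = inj₁ (a , b)
          match (inj₂ a) (inj₁ b) = inj₂ (a , b)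
          match (inj₂ a) (inj₂ b) = contradiction (trans a (sym b)) (l≢r (suc i′))

        label⇒circuitsSpan : ∀ i → CircuitsSpan (label T (v i)) (l i) (r i)
        label⇒circuitsSpan i with S.labels i
        ... | inj₁ (s , _ , cs) = whole⇒circuitsSpan (label T (v i)) (circuitOfSize⇒whole (label T (v i)) (nonempty (v i)) cs)
        ... | inj₂ (inj₁ φ) = cocircuit⇒circuitsSpan (label T (v i)) φ (l≢r i)
        ... | inj₂ (inj₂ sp) = spike⇒circuitsSpan i sp

      spikePath⇒chain : ChainOf T e₁ f₁
      spikePath⇒chain = chainOf (List.tabulate v)
        (subst (Chain T e₁ (List.tabulate v)) r-last (tabulate-chain n v l r
          (λ i → record { left∈ = l∈ i ; right∈ = r∈ i ; left≢right = l≢r i ; spans = label⇒circuitsSpan i ; names = names i })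
          r-inject₁))
        (trans (length-tabulate v) (↔⇒≡ O.order))
        λ w → subst (_∈ₗ List.tabulate v) (Inverse.strictlyInverseˡ O.order w) (∈-tabulate⁺ {f = v} (Inverse.from O.order w))

    spikePath⇒circuitsSpan : CircuitsSpan M e f
    spikePath⇒circuitsSpan = go n refl
      where
      in-first : ∀ {a} → a ∈ E M → n ≡ 0 → a ∈ E (label T (v zero)) × a ∈ E (label T (v (fromℕ n)))
      in-first {a} a∈ n≡0 with proj₁ (Equivalence.to (IsTreeDecomposition.groundSet isTreeDecomposition a) a∈)
      ... | w , h = at zero , at (fromℕ n)
        where
        all-zero : ∀ i → toℕ i ≡ 0
        all-zero i = ℕ.n≤0⇒n≡0 (subst (toℕ i ≤_) n≡0 (s≤s⁻¹ (toℕ<n i)))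
        at : ∀ i → a ∈ E (label T (v i))
        at i = subst (λ j → a ∈ E (label T j)) (trans (sym (Inverse.strictlyInverseˡ O.order w))
          (cong v (toℕ-injective (trans (all-zero _) (sym (all-zero i)))))) h
      finish : ∀ {a b} → ChainOf T a b → NotName T a → NotName T b → CircuitsSpan M a b
      finish ch na nb = chain⇒circuitsSpan yields wf na nb ch
      go : ∀ x → n ≡ x → CircuitsSpan M e f
      go zero eq = finish (spikePath⇒chain (inj₁ (refl , refl)) (proj₁ (in-first e∈ eq)) (proj₂ (in-first f∈ eq))) (notName e∈) (notName f∈)
      go (suc _) eq with S.endElements (subst (1 ≤_) (sym eq) (s≤s z≤n))
      ... | inj₁ (x , y) = finish (spikePath⇒chain (inj₁ (refl , refl)) x y) (notName e∈) (notName f∈)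
      ... | inj₂ (x , y) = circuitsSpan-sym {M = M} (finish (spikePath⇒chain (inj₂ (refl , refl , subst (1 ≤_) (sym eq) (s≤s z≤n))) x y) (notName f∈) (notName e∈))

theorem4p1 : ∀ {N : ℕ} (M : Matroid N) → Simple M → Connected M → Binary M →
    (e f : Fin N) → e ∈ E M → f ∈ E M → e ≢ f →
    ∀ {k m : ℕ} (T : LabelledGraph N k m) → IsCanonicalTreeDecomposition T M →
    (∀ (C : Subset N) → IsCircuit M C → e ∈ C → f ∈ C → Spanning M C) ⇔ IsSpikePath T e f
theorem4p1 {N} M simple connected binary e f e∈ f∈ e≢f T c = mk⇔ to from
  where
  size : 3 ≤ ∣ E M ∣
  size with connected e f e∈ f∈ e≢f
  ... | C , cC , _ = ℕ.≤-trans (simple C cC) (p⊆q⇒∣p∣≤∣q∣ {p = C} {q = E M} (proj₁ cC))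
  module Can = Canonical c size e∈ f∈ e≢f
  yields = IsTreeDecomposition.yields (IsCanonicalTreeDecomposition.isTreeDecomposition c)
  cs = Binary⇒CycleSpace M binary
  np = simple⇒no-parallel M simple
  inherited = labels-inherit yields Can.wf cs np
  B = proj₁ inherited
  to : (∀ (C : Subset N) → IsCircuit M C → e ∈ C → f ∈ C → Spanning M C) → IsSpikePath T e f
  to sp = Can.chain⇒spikePath B (proj₂ inherited) (circuitsSpan⇒chain yields Can.wf cs np (canonical⇒noBadCircuit c size B) e∈ f∈ e≢f
    λ C cC x y → Equivalence.to (Spanning⇔Spans M cC) (sp C cC x y))
  from : IsSpikePath T e f → ∀ (C : Subset N) → IsCircuit M C → e ∈ C → f ∈ C → Spanning M C
  from path C cC x y = Equivalence.from (Spanning⇔Spans M cC) (Can.spikePath⇒circuitsSpan path C cC x y)
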